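{- There is an absolute constant $c_0>0$ such that for all sufficiently large $x$, there are at least $c_0x$ positive integers $n\le x$ for which both $\phi(n)$ and $\lambda(n)$ are $2$-dense.
   Context: $\phi$ is Euler's totient function and $\lambda(n)$ is Carmichael's function, the maximal order of an element of the group $(\mathbb{Z}/n\mathbb{Z})^*$. For real $u$, a positive integer $m$ is called $u$-dense if for every real $y$ with $1\le y<m$ there is a divisor of $m$ in the interval $(y,uy]$. -}

module Defs where

open import Data.Bool using (Bool; if_then_else_)
open import Data.Nat using (ℕ; zero; suc; _+_; _*_; _^_; _≤_; _<_; _⊔_; _≟_)
open import Data.Nat.GCD using (gcd)
open import Data.Nat.DivMod using (_%_)
open import Data.Nat.Divisibility using (_∣_)
open import Data.List using (List; []; _∷_; map; filter; length; upTo; foldr)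
open import Data.Product using (∃; _×_)
open import Relation.Nullary.Decidable using (⌊_⌋)

range1 : ℕ → List ℕ
range1 n = map suc (upTo n)

totient : ℕ → ℕ
totient n = length (filter (λ k → gcd k n ≟ 1) (range1 n))

firstSat : (ℕ → Bool) → List ℕ → ℕ
firstSat p [] = 0
firstSat p (k ∷ ks) = if p k then k else firstSat p ks

-- multiplicative order of a modulo n (n ≥ 1): least k ≥ 1 with a^k ≡ 1 (mod n).
-- For a unit a the order is ≤ φ(n) ≤ n, so searching k ∈ [1..n] suffices.
order : ℕ → ℕ → ℕ
order zero    a = 0
order (suc m) a = firstSat (λ k → ⌊ (a ^ k) % suc m ≟ 1 % suc m ⌋) (range1 (suc m))

carmichael : ℕ → ℕ
carmichael n = foldr _⊔_ 0 (map (order n) (filter (λ a → gcd a n ≟ 1) (range1 n)))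

-- m is 2-dense: for every real y with 1 ≤ y < m there is a divisor d of m
-- with y < d ≤ 2y.  It suffices to quantify over rational y = a / b (b ≥ 1):
-- 1 ≤ a/b < m  ⇔  b ≤ a < m*b,  and  a/b < d ≤ 2a/b  ⇔  a < d*b ≤ 2*a.
TwoDense : ℕ → Set
TwoDense m = ∀ (a b : ℕ) → 1 ≤ b → b ≤ a → a < m * b →
             ∃ λ d → d ∣ m × a < d * b × d * b ≤ 2 * a

{-# OPTIONS --safe #-}
-- n is taken of the form 2 ^ (k + 2) · m · p₁ ⋯ p_K · p.  If λ(n) has a 2-dense divisor M such that no prime factor
-- of n exceeds 2M, then λ(n) and φ(n) are 2-dense: M r is 2-dense whenever M is and r ≤ 2M, and the prime factors
-- of φ(n) do not exceed those of n.  Here M = 2 ^ k ∏ q, where the distinct primes q are taken from windows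
-- (E u, E (w u)] with u in geometric progression, sufficiently many from each, and every q divides p' - 1 for some
-- prime p' ∣ n; then q ∣ λ(n).
--
-- A sieve bounds the number of primes p' for which p' - 1 has no prime factor in a wide window, and with Chebyshev's
-- lower bound this shows that a positive proportion of all primes p' do have one, even when boundedly many q are
-- excluded.  If m fails to have enough such prime factors for some window, then multiplying m by products of the
-- primes that it lacks yields many distinct integers; so the failing m ≤ z have small logarithmic density, and the
-- sum over all windows well below log z is still small.  The remaining boundedly many windows, up to a fixed power
-- of x, are served by p₁, …, p_K, and the final prime p is counted by Chebyshev's bound.

module Submission where

open import Defs
open import Data.Nat using (ℕ; zero; suc; _+_; _*_; _∸_; _^_; _⊔_; _≤_; _<_; _≟_; _≤?_; _<?_; z≤n; s≤s; _!; NonZero; >-nonZero; >-nonZero⁻¹; ≢-nonZero; nonTrivial⇒n>1)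
import Data.Nat.Properties as ℕₚ
open ℕₚ using
  (*-assoc; *-cancelʳ-≡; *-cancelʳ-≤; *-cancelˡ-≡; *-cancelˡ-≤; *-comm; *-distribʳ-+; *-distribʳ-∸;
   *-distribˡ-+; *-identityʳ; *-identityˡ; *-mono-≤; *-monoʳ-<; *-monoʳ-≤; *-monoˡ-≤; *-suc; *-zeroʳ;
   +-assoc; +-cancelˡ-≡; +-cancelˡ-≤; +-comm; +-identityʳ; +-mono-≤; +-monoʳ-≤; +-monoˡ-<; +-monoˡ-≤; +-suc;
   <-irrefl; <-trans; <-≤-trans; <⇒≤; <⇒≱; ^-*-assoc; ^-distribˡ-+-*; ^-monoʳ-<; ^-monoʳ-≤; ^-zeroˡ; m*n≢0;
   m+[n∸m]≡n; m+n∸n≡m; m<m*n; m<m+n; m<n⇒0<n∸m; m^n>0; m^n≢0; m∸n+n≡m; m∸n≤m; m≤m*n; m≤m+n; m≤m⊔n; m≤n*m;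
   m≤n+m; m≤n⇒m<n∨m≡n; m≤n⇒m≤1+n; m≤n⇒∃[o]m+o≡n; m≤n⊔m; n≢0⇒n>0; n≤1+n; suc-injective; ≤-<-trans; ≤-antisym;
   ≤-pred; ≤-refl; ≤-reflexive; ≤-total; ≤-trans; ≮⇒≥; ≰⇒>; ⊔-sel)
open import Data.Nat.DivMod using (_%_; _/_)
import Data.Nat.DivMod as DivMod
open import Data.Nat.Divisibility using (_∣_; _∣?_; _∤_; divides)
import Data.Nat.Divisibility as Div
open import Data.Nat.GCD using (gcd)
open import Data.Nat.Coprimality using (Coprime)
import Data.Nat.Coprimality as Cop
open import Data.Nat.Primality using (Prime; prime?; euclidsLemma)
import Data.Nat.Primality as Pr
open import Data.Nat.Primality.Factorisation using (factorise; factorisationHasAllPrimeFactors)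
open import Data.Nat.ListAction using (product)
import Data.Nat.ListAction.Properties as ListAct
open import Data.Nat.Induction using (<-rec)
open import Data.Nat.Tactic.RingSolver using (solve-∀)
import Data.Integer as ℤ
open import Data.Integer using (ℤ)
import Data.Integer.Properties as ℤₚ
open import Data.Rational using (ℚ; 0ℚ; 1ℚ) renaming (_+_ to _⊕_; _*_ to _⊗_; _-_ to _⊝_; -_ to ⊖_; _≤_ to _⊑_; _<_ to _⊏_)
import Data.Rational as ℚ
import Data.Rational.Properties as ℚₚ
open ℚₚ using () renaming
  (≤-trans to ⊑-trans; ≤-reflexive to ⊑-reflexive; ≤-refl to ⊑-refl; ≤-total to ⊑-total;
   ≤-antisym to ⊑-antisym; *-identityˡ to ⊗-identityˡ; *-identityʳ to ⊗-identityʳ; *-zeroʳ to ⊗-zeroʳ;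
   *-zeroˡ to ⊗-zeroˡ; *-assoc to ⊗-assoc; *-comm to ⊗-comm; *-distribˡ-+ to ⊗-distribˡ-⊕;
   *-distribʳ-+ to ⊗-distribʳ-⊕; +-mono-≤ to ⊕-mono-⊑; +-monoʳ-≤ to ⊕-monoʳ-⊑; +-monoˡ-≤ to ⊕-monoˡ-⊑;
   +-identityʳ to ⊕-identityʳ; +-identityˡ to ⊕-identityˡ; +-comm to ⊕-comm; +-assoc to ⊕-assoc;
   +-inverseʳ to ⊕-inverseʳ; <-≤-trans to ⊏-⊑-trans)
open import Data.Rational.Solver using (module +-*-Solver)
open import Data.List using (List; []; _∷_; map; filter; length; upTo; foldr; _++_; concatMap; applyUpTo)
import Data.List.Properties as Listₚ
open import Data.List.Membership.Propositional using (_∈_; _∉_; find)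
import Data.List.Membership.Propositional.Properties as Mem
open import Data.List.Relation.Unary.Any as Any using (Any; here; there)
open import Data.List.Relation.Unary.All as All using (All; []; _∷_)
import Data.List.Relation.Unary.All.Properties as Allₚ
open import Data.List.Relation.Unary.AllPairs as AllPairs using (AllPairs; []; _∷_)
import Data.List.Relation.Unary.AllPairs.Properties as AllPairsₚ
open import Data.List.Relation.Unary.Unique.Propositional using (Unique)
import Data.List.Relation.Unary.Unique.Propositional.Properties as Uniq
open import Data.List.Relation.Binary.Permutation.Propositional using (_↭_; ↭-refl; ↭-sym; ↭-trans)
import Data.List.Relation.Binary.Permutation.Propositional as Perm
import Data.List.Relation.Binary.Permutation.Propositional.Properties as Permₚ
open import Data.Product using (∃; ∃₂; _×_; _,_; proj₁; proj₂)
open import Data.Sum using (_⊎_; inj₁; inj₂; [_,_]′)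
open import Data.Unit using (⊤; tt)
open import Data.Empty using (⊥; ⊥-elim)
import Data.Bool.Properties as Boolₚ
open import Data.Bool using (Bool; true; false; if_then_else_)
open import Function using (_∘_; id; case_of_)
open import Relation.Nullary using (¬_; Dec; yes; no; does)
open import Relation.Nullary.Decidable using (⌊_⌋; _×-dec_; ¬?)
open import Relation.Unary using (Decidable)
open import Relation.Binary.PropositionalEquality using (_≡_; _≢_; refl; sym; trans; cong; cong₂; subst; subst₂)
open import Relation.Binary.PropositionalEquality.Properties using (setoid)
import Data.List.Relation.Binary.Permutation.Setoid.Properties as SPermₚ
open import Data.Integer.Tactic.RingSolver using () renaming (solve-∀ to ℤsolve-∀)
open +-*-Solver using (solve; _:+_; _:*_; _:=_; _:-_; con)

-- The multipliers applied to a failing m depend on m, because the divisors q already taken from a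
-- window must not be taken again. The products stay distinct because the search proceeds in rounds
-- over increasing ranges of primes: the q taken before a round depend only on the prime factors of
-- m below that round's range, and these can be read off the product. After j doublings of the
-- exponent the failing m have proportion about (θ / (θ + 1)) ^ j. With a fixed j, the sum over all
-- windows would grow like log log x. So j grows linearly with the distance from the last window,
-- slowly enough that R rounds still end below z, since consecutive windows grow at least by the
-- factor 2 in the exponent. The topmost windows leave no room for R J doublings; these are the ones
-- left to p₁, ..., p_K. The final p must stay below the product of the q from the last window, so
-- the size of n / p has to be known well. Each pᵢ therefore has its exponent in an interval of
-- length ε near K² ε, and K such primes blur the exponent of n / p by only K ε.

private variable
  𝔸 𝔹 : Set

-- Rational arithmetic, embedded naturals and their reciprocals

⊗-monoˡ : ∀ {a b c} → 0ℚ ⊑ a → b ⊑ c → a ⊗ b ⊑ a ⊗ c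
⊗-monoˡ {a} 0≤a b≤c = ℚₚ.*-monoˡ-≤-nonNeg a {{ℚ.nonNegative 0≤a}} b≤c

⊗-monoʳ : ∀ {a b c} → 0ℚ ⊑ c → a ⊑ b → a ⊗ c ⊑ b ⊗ c
⊗-monoʳ {c = c} 0≤c a≤b = ℚₚ.*-monoʳ-≤-nonNeg c {{ℚ.nonNegative 0≤c}} a≤b

⊗-mono : ∀ {a b c d} → 0ℚ ⊑ a → 0ℚ ⊑ d → a ⊑ b → c ⊑ d → a ⊗ c ⊑ b ⊗ d
⊗-mono 0≤a 0≤d a≤b c≤d = ⊑-trans (⊗-monoˡ 0≤a c≤d) (⊗-monoʳ 0≤d a≤b)

⊗-nonneg : ∀ {a b} → 0ℚ ⊑ a → 0ℚ ⊑ b → 0ℚ ⊑ a ⊗ b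
⊗-nonneg {a} {b} 0≤a 0≤b = subst (_⊑ a ⊗ b) (⊗-zeroʳ a) (⊗-monoˡ 0≤a 0≤b)

⊕-nonneg : ∀ {a b} → 0ℚ ⊑ a → 0ℚ ⊑ b → 0ℚ ⊑ a ⊕ b
⊕-nonneg 0≤a 0≤b = ⊕-mono-⊑ 0≤a 0≤b

≤-+ʳ : ∀ {a b} → 0ℚ ⊑ b → a ⊑ a ⊕ b
≤-+ʳ {a} {b} 0≤b = subst (_⊑ a ⊕ b) (⊕-identityʳ a) (⊕-monoʳ-⊑ a 0≤b)

≤-+ˡ : ∀ {a b} → 0ℚ ⊑ a → b ⊑ a ⊕ b
≤-+ˡ {a} {b} 0≤a = subst (_⊑ a ⊕ b) (⊕-identityˡ b) (⊕-monoˡ-⊑ b 0≤a)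

0≤1 : 0ℚ ⊑ 1ℚ
0≤1 = ℚ.*≤* (ℤ.+≤+ z≤n)

ι : ℕ → ℚ
ι zero = 0ℚ
ι (suc n) = 1ℚ ⊕ ι n

ι-+ : ∀ m n → ι (m + n) ≡ ι m ⊕ ι n
ι-+ zero n = sym (⊕-identityˡ (ι n))
ι-+ (suc m) n = trans (cong (1ℚ ⊕_) (ι-+ m n)) (sym (⊕-assoc 1ℚ (ι m) (ι n)))

ι-* : ∀ m n → ι (m * n) ≡ ι m ⊗ ι n
ι-* zero n = sym (⊗-zeroˡ (ι n))
ι-* (suc m) n = trans (ι-+ n (m * n)) (trans (cong₂ _⊕_ (sym (⊗-identityˡ (ι n))) (ι-* m n)) (sym (⊗-distribʳ-⊕ (ι n) 1ℚ (ι m))))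

0≤ι : ∀ n → 0ℚ ⊑ ι n
0≤ι zero = ⊑-refl
0≤ι (suc n) = ⊕-nonneg 0≤1 (0≤ι n)

ι-mono : ∀ {m n} → m ≤ n → ι m ⊑ ι n
ι-mono {n = n} z≤n = 0≤ι n
ι-mono (s≤s m≤n) = ⊕-monoʳ-⊑ 1ℚ (ι-mono m≤n)

ι-1 : ι 1 ≡ 1ℚ
ι-1 = ⊕-identityʳ 1ℚ

0<1 : 0ℚ ⊏ 1ℚ
0<1 = ℚ.*<* (ℤ.+<+ (s≤s z≤n))

ι-pos : ∀ n → 0ℚ ⊏ ι (suc n)
ι-pos n = ⊏-⊑-trans 0<1 (≤-+ʳ (0≤ι n))

ι-mono-< : ∀ {m n} → m < n → ι m ⊏ ι n
ι-mono-< {m} {n} m<n = ⊏-⊑-trans (subst (_⊏ ι (suc m)) (⊕-identityˡ (ι m)) (ℚₚ.+-monoˡ-< (ι m) 0<1)) (ι-mono m<n)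

ι-cancel-≤ : ∀ {m n} → ι m ⊑ ι n → m ≤ n
ι-cancel-≤ {m} {n} h with m ≤? n
... | yes p = p
... | no ¬p = ⊥-elim (ℚₚ.<-irrefl refl (⊏-⊑-trans (ι-mono-< (≰⇒> ¬p)) h))

-- The value 0 at 0 makes `rc-*` hold without exception.
rc : ℕ → ℚ
rc zero = 0ℚ
rc (suc n) = ℚ.1/_ (ι (suc n)) {{ℚ.>-nonZero (ι-pos n)}}

ι-rc : ∀ {n} → 1 ≤ n → ι n ⊗ rc n ≡ 1ℚ
ι-rc {suc n} _ = ℚₚ.*-inverseʳ (ι (suc n)) {{ℚ.>-nonZero (ι-pos n)}}

⊗-cancelˡ : ∀ {m a b} → 1 ≤ m → ι m ⊗ a ⊑ ι m ⊗ b → a ⊑ b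
⊗-cancelˡ {suc m} _ h = ℚₚ.*-cancelˡ-≤-pos (ι (suc m)) {{ℚ.positive (ι-pos m)}} h

⊗-cancelˡ-≡ : ∀ {m a b} → 1 ≤ m → ι m ⊗ a ≡ ι m ⊗ b → a ≡ b
⊗-cancelˡ-≡ 1≤m h = ⊑-antisym (⊗-cancelˡ 1≤m (⊑-reflexive h)) (⊗-cancelˡ 1≤m (⊑-reflexive (sym h)))

0≤rc : ∀ n → 0ℚ ⊑ rc n
0≤rc zero = ⊑-refl
0≤rc (suc n) = ⊗-cancelˡ {suc n} (s≤s z≤n) (subst₂ _⊑_ (sym (⊗-zeroʳ (ι (suc n)))) (sym (ι-rc {suc n} (s≤s z≤n))) 0≤1)

rc-* : ∀ m n → rc (m * n) ≡ rc m ⊗ rc n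
rc-* zero n = sym (⊗-zeroˡ (rc n))
rc-* (suc m) zero = trans (cong rc (*-zeroʳ m)) (sym (⊗-zeroʳ (rc (suc m))))
rc-* (suc m) (suc n) = ⊗-cancelˡ-≡ {suc m * suc n} (s≤s z≤n) (trans (ι-rc {suc m * suc n} (s≤s z≤n)) (sym eq))
  where
  eq : ι (suc m * suc n) ⊗ (rc (suc m) ⊗ rc (suc n)) ≡ 1ℚ
  eq = trans (cong (_⊗ (rc (suc m) ⊗ rc (suc n))) (ι-* (suc m) (suc n)))
       (trans (solve 4 (λ a b c d → (a :* b) :* (c :* d) := (a :* c) :* (b :* d)) refl (ι (suc m)) (ι (suc n)) (rc (suc m)) (rc (suc n)))
       (trans (cong₂ _⊗_ (ι-rc {suc m} (s≤s z≤n)) (ι-rc {suc n} (s≤s z≤n))) (⊗-identityˡ 1ℚ)))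

rc-anti : ∀ {m n} → 1 ≤ m → m ≤ n → rc n ⊑ rc m
rc-anti {m} {n} 1≤m m≤n = ⊗-cancelˡ 1≤m (⊗-cancelˡ (≤-trans 1≤m m≤n) h)
  where
  h : ι n ⊗ (ι m ⊗ rc n) ⊑ ι n ⊗ (ι m ⊗ rc m)
  h = subst₂ _⊑_
     (sym (trans (solve 3 (λ a b c → a :* (b :* c) := b :* (a :* c)) refl (ι n) (ι m) (rc n)) (trans (cong (ι m ⊗_) (ι-rc (≤-trans 1≤m m≤n))) (⊗-identityʳ (ι m)))))
     (sym (trans (cong (ι n ⊗_) (ι-rc 1≤m)) (⊗-identityʳ (ι n))))
     (ι-mono m≤n)

rc-1 : rc 1 ≡ 1ℚ
rc-1 = ⊗-cancelˡ-≡ {1} (s≤s z≤n) (trans (ι-rc {1} (s≤s z≤n)) (sym (trans (⊗-identityʳ (ι 1)) ι-1)))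

-- Finite sums over lists, and comparison of duplicate-free lists

Σ : List 𝔸 → (𝔸 → ℚ) → ℚ
Σ [] f = 0ℚ
Σ (x ∷ xs) f = f x ⊕ Σ xs f

Σ-cong : ∀ (xs : List 𝔸) {f g} → (∀ {x} → x ∈ xs → f x ≡ g x) → Σ xs f ≡ Σ xs g
Σ-cong [] h = refl
Σ-cong (x ∷ xs) h = cong₂ _⊕_ (h (here refl)) (Σ-cong xs (λ m → h (there m)))

Σ-mono : ∀ (xs : List 𝔸) {f g} → (∀ {x} → x ∈ xs → f x ⊑ g x) → Σ xs f ⊑ Σ xs g
Σ-mono [] h = ⊑-refl
Σ-mono (x ∷ xs) h = ⊕-mono-⊑ (h (here refl)) (Σ-mono xs (λ m → h (there m)))

Σ-nonneg : ∀ (xs : List 𝔸) {f} → (∀ x → 0ℚ ⊑ f x) → 0ℚ ⊑ Σ xs f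
Σ-nonneg [] h = ⊑-refl
Σ-nonneg (x ∷ xs) h = ⊕-nonneg (h x) (Σ-nonneg xs h)

Σ-+ : ∀ (xs : List 𝔸) f g → Σ xs (λ x → f x ⊕ g x) ≡ Σ xs f ⊕ Σ xs g
Σ-+ [] f g = sym (⊕-identityˡ 0ℚ)
Σ-+ (x ∷ xs) f g = trans (cong ((f x ⊕ g x) ⊕_) (Σ-+ xs f g))
  (solve 4 (λ a b c d → (a :+ b) :+ (c :+ d) := (a :+ c) :+ (b :+ d)) refl (f x) (g x) (Σ xs f) (Σ xs g))

Σ-*ˡ : ∀ (xs : List 𝔸) c f → Σ xs (λ x → c ⊗ f x) ≡ c ⊗ Σ xs f
Σ-*ˡ [] c f = sym (⊗-zeroʳ c)
Σ-*ˡ (x ∷ xs) c f = trans (cong (c ⊗ f x ⊕_) (Σ-*ˡ xs c f)) (sym (⊗-distribˡ-⊕ c (f x) (Σ xs f)))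

Σ-*ʳ : ∀ (xs : List 𝔸) c f → Σ xs (λ x → f x ⊗ c) ≡ Σ xs f ⊗ c
Σ-*ʳ xs c f = trans (Σ-cong xs (λ {x} _ → ⊗-comm (f x) c)) (trans (Σ-*ˡ xs c f) (⊗-comm c (Σ xs f)))

Σ-++ : ∀ (xs ys : List 𝔸) f → Σ (xs ++ ys) f ≡ Σ xs f ⊕ Σ ys f
Σ-++ [] ys f = sym (⊕-identityˡ (Σ ys f))
Σ-++ (x ∷ xs) ys f = trans (cong (f x ⊕_) (Σ-++ xs ys f)) (sym (⊕-assoc (f x) (Σ xs f) (Σ ys f)))

Σ-map : ∀ (xs : List 𝔸) (h : 𝔸 → 𝔹) f → Σ (map h xs) f ≡ Σ xs (λ x → f (h x))
Σ-map [] h f = refl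
Σ-map (x ∷ xs) h f = cong (f (h x) ⊕_) (Σ-map xs h f)

Σ-concatMap : ∀ (xs : List 𝔸) (h : 𝔸 → List 𝔹) f → Σ (concatMap h xs) f ≡ Σ xs (λ x → Σ (h x) f)
Σ-concatMap [] h f = refl
Σ-concatMap (x ∷ xs) h f = trans (Σ-++ (h x) (concatMap h xs) f) (cong (Σ (h x) f ⊕_) (Σ-concatMap xs h f))

Σ-const : ∀ (xs : List 𝔸) c → Σ xs (λ _ → c) ≡ ι (length xs) ⊗ c
Σ-const [] c = sym (⊗-zeroˡ c)
Σ-const (x ∷ xs) c = trans (cong₂ _⊕_ (sym (⊗-identityˡ c)) (Σ-const xs c)) (sym (⊗-distribʳ-⊕ c 1ℚ (ι (length xs))))

Σ-swap : ∀ (xs : List 𝔸) (ys : List 𝔹) (f : 𝔸 → 𝔹 → ℚ) → Σ xs (λ x → Σ ys (f x)) ≡ Σ ys (λ y → Σ xs (λ x → f x y))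
Σ-swap [] ys f = sym (trans (Σ-const ys 0ℚ) (⊗-zeroʳ (ι (length ys))))
Σ-swap (x ∷ xs) ys f = trans (cong (Σ ys (f x) ⊕_) (Σ-swap xs ys f)) (sym (Σ-+ ys (f x) (λ y → Σ xs (λ x → f x y))))

Σ-↭ : ∀ {xs ys : List 𝔸} f → xs ↭ ys → Σ xs f ≡ Σ ys f
Σ-↭ f Perm.refl = refl
Σ-↭ f (Perm.prep x p) = cong (f x ⊕_) (Σ-↭ f p)
Σ-↭ f (Perm.swap {ys = ys} x y p) = trans (cong (λ s → f x ⊕ (f y ⊕ s)) (Σ-↭ f p)) (solve 3 (λ a b c → a :+ (b :+ c) := b :+ (a :+ c)) refl (f x) (f y) (Σ ys f))
Σ-↭ f (Perm.trans p q) = trans (Σ-↭ f p) (Σ-↭ f q)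

∈-↭-∷ : ∀ {x : 𝔸} {ys} → x ∈ ys → ∃ λ ys' → ys ↭ x ∷ ys'
∈-↭-∷ x∈ys with Mem.∈-∃++ x∈ys
... | as , bs , refl = as ++ bs , Permₚ.shift _ as bs

⊆-tail : ∀ {x : 𝔸} {xs ys ys'} → All (x ≢_) xs → (∀ {z} → z ∈ x ∷ xs → z ∈ ys) → ys ↭ x ∷ ys' → ∀ {z} → z ∈ xs → z ∈ ys'
⊆-tail nx sub p {z} z∈ with Permₚ.∈-resp-↭ p (sub (there z∈))
... | here refl = ⊥-elim (All.lookup nx z∈ refl)
... | there m = m

unique-⊆-↭ : ∀ {xs ys : List 𝔸} → Unique xs → (∀ {z} → z ∈ xs → z ∈ ys) → ∃ λ zs → ys ↭ xs ++ zs
unique-⊆-↭ {xs = []} {ys} u sub = ys , ↭-refl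
unique-⊆-↭ {xs = x ∷ xs} (nx ∷ u) sub with ∈-↭-∷ (sub (here refl))
... | ys' , p with unique-⊆-↭ u (⊆-tail nx sub p)
... | zs , q = zs , ↭-trans p (Perm.prep x q)

Σ-⊆ : ∀ {xs ys : List 𝔸} {f} → Unique xs → (∀ {z} → z ∈ xs → z ∈ ys) → (∀ z → 0ℚ ⊑ f z) → Σ xs f ⊑ Σ ys f
Σ-⊆ {xs = xs} {f = f} u sub nn with unique-⊆-↭ u sub
... | zs , p = subst (Σ xs f ⊑_) (sym (trans (Σ-↭ f p) (Σ-++ xs zs f))) (≤-+ʳ (Σ-nonneg zs nn))

unique-⊆-length : ∀ {xs ys : List 𝔸} → Unique xs → (∀ {z} → z ∈ xs → z ∈ ys) → length xs ≤ length ys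
unique-⊆-length {xs = xs} u sub with unique-⊆-↭ u sub
... | zs , p = subst (length xs ≤_) (sym (trans (Permₚ.↭-length p) (Listₚ.length-++ xs))) (m≤m+n _ _)

unique-⊆-length-↭ : ∀ {xs ys : List 𝔸} → Unique xs → (∀ {z} → z ∈ xs → z ∈ ys) → length ys ≤ length xs → ys ↭ xs
unique-⊆-length-↭ {xs = xs} u sub le with unique-⊆-↭ u sub
... | [] , p = subst (_ ↭_) (Listₚ.++-identityʳ xs) p
... | z ∷ zs , p = ⊥-elim (<⇒≱ (m<m+n (length xs) {suc (length zs)} (s≤s z≤n)) (subst (_≤ length xs) (trans (Permₚ.↭-length p) (Listₚ.length-++ xs)) le))

Σ-filter-≤ : ∀ {P : 𝔸 → Set} (P? : Decidable P) (xs : List 𝔸) {f} → (∀ x → 0ℚ ⊑ f x) → Σ (filter P? xs) f ⊑ Σ xs f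
Σ-filter-≤ P? [] nn = ⊑-refl
Σ-filter-≤ P? (x ∷ xs) {f} nn with does (P? x)
... | true = ⊕-monoʳ-⊑ (f x) (Σ-filter-≤ P? xs nn)
... | false = ⊑-trans (Σ-filter-≤ P? xs nn) (≤-+ˡ (nn x))

∈-range1⁺ : ∀ {k n} → 1 ≤ k → k ≤ n → k ∈ range1 n
∈-range1⁺ {suc k} (s≤s z≤n) k<n = Mem.∈-map⁺ suc (Mem.∈-upTo⁺ k<n)

∈-range1⁻ : ∀ {k n} → k ∈ range1 n → 1 ≤ k × k ≤ n
∈-range1⁻ {k} {n} k∈ with Mem.∈-map⁻ suc k∈
... | j , j∈ , refl = s≤s z≤n , Mem.∈-upTo⁻ j∈

unique-range1 : ∀ n → Unique (range1 n)
unique-range1 n = Uniq.map⁺ suc-injective (Uniq.upTo⁺ n)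

length-range1 : ∀ n → length (range1 n) ≡ n
length-range1 n = trans (Listₚ.length-map suc (upTo n)) (Listₚ.length-upTo n)

unique-map-∈ : ∀ (f : 𝔸 → 𝔹) {xs} → (∀ {x y} → x ∈ xs → y ∈ xs → f x ≡ f y → x ≡ y) → Unique xs → Unique (map f xs)
unique-map-∈ f inj [] = []
unique-map-∈ f {x ∷ xs} inj (nx ∷ u) =
  Allₚ.map⁺ (All.tabulate (λ y∈ eq → All.lookup nx y∈ (inj (here refl) (there y∈) eq))) ∷
  unique-map-∈ f (λ a b → inj (there a) (there b)) u

-- Multiplicative orders modulo n

≡%⇒∣ : ∀ a t n .{{_ : NonZero n}} → (a + t) % n ≡ a % n → n ∣ t
≡%⇒∣ a t n eq = Div.∣m+n∣m⇒∣n (subst (n ∣_) eq' (Div.n∣m*n ((a + t) / n))) (Div.n∣m*n (a / n))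
  where
  eq' : (a + t) / n * n ≡ a / n * n + t
  eq' = +-cancelˡ-≡ (a % n) _ _ (trans (cong (_+ (a + t) / n * n) (sym eq)) (trans (sym (DivMod.m≡m%n+[m/n]*n (a + t) n))
        (trans (cong (_+ t) (DivMod.m≡m%n+[m/n]*n a n)) (+-assoc (a % n) _ t))))

%-*-cong : ∀ {a a' b b'} n .{{_ : NonZero n}} → a % n ≡ a' % n → b % n ≡ b' % n → (a * b) % n ≡ (a' * b') % n
%-*-cong {a} {a'} {b} {b'} n p q = trans (DivMod.%-distribˡ-* a b n) (trans (cong₂ (λ x y → (x * y) % n) p q) (sym (DivMod.%-distribˡ-* a' b' n)))

%-^-cong : ∀ {a a'} n .{{_ : NonZero n}} k → a % n ≡ a' % n → (a ^ k) % n ≡ (a' ^ k) % n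
%-^-cong n zero p = refl
%-^-cong n (suc k) p = %-*-cong n p (%-^-cong n k p)

%-down : ∀ {a b d n} .{{_ : NonZero n}} .{{_ : NonZero d}} → d ∣ n → a % n ≡ b % n → a % d ≡ b % d
%-down {a} {b} {d} {n} d∣n eq = trans (sym (DivMod.m∣n⇒o%n%m≡o%m d n a d∣n)) (trans (cong (_% d) eq) (DivMod.m∣n⇒o%n%m≡o%m d n b d∣n))

coprime-* : ∀ {a b n} → Coprime a n → Coprime b n → Coprime (a * b) n
coprime-* ca cb {d} (d∣ab , d∣n) = cb (Cop.coprime-divisor (λ (x , y) → ca (y , Div.∣-trans x d∣n)) d∣ab , d∣n)

coprime-^ : ∀ {a n} k → Coprime a n → Coprime (a ^ k) n
coprime-^ zero c = Cop.1-coprimeTo _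
coprime-^ (suc k) c = coprime-* c (coprime-^ k c)

coprime-∣-* : ∀ {a b c} → Coprime a b → a ∣ c → b ∣ c → a * b ∣ c
coprime-∣-* {a} {b} co a∣c (divides t refl) =
  subst (a * b ∣_) refl (Div.*-monoˡ-∣ b (Cop.coprime-divisor co (subst (a ∣_) (*-comm t b) a∣c)))

%-*-cancel : ∀ {a b} c n .{{_ : NonZero n}} → Coprime c n → (c * a) % n ≡ (c * b) % n → a % n ≡ b % n
%-*-cancel {a} {b} c n co eq = [ (λ a≤b → sym (cancel a b a≤b (sym eq))) , (λ b≤a → cancel b a b≤a eq) ]′ (≤-total a b)
  where
  cancel : ∀ a b → a ≤ b → (c * b) % n ≡ (c * a) % n → b % n ≡ a % n
  cancel a b a≤b eq with m≤n⇒∃[o]m+o≡n a≤b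
  ... | t , refl = DivMod.%-remove-+ʳ a (Cop.coprime-divisor (Cop.sym co) (≡%⇒∣ (c * a) (c * t) n (trans (cong (_% n) (sym (*-distribˡ-+ c a t))) eq)))

coprime-% : ∀ {a n} .{{_ : NonZero n}} → Coprime a n → Coprime (a % n) n
coprime-% {a} {n} co (x , y) = co (Div.∣n∣m%n⇒∣m y x , y)

units : ℕ → List ℕ
units n = filter (λ a → gcd a n ≟ 1) (range1 n)

∈-units⁺ : ∀ {a n} → 1 ≤ a → a ≤ n → Coprime a n → a ∈ units n
∈-units⁺ {a} {n} 1≤a a≤n co = Mem.∈-filter⁺ (λ a → gcd a n ≟ 1) (∈-range1⁺ 1≤a a≤n) (Cop.coprime⇒gcd≡1 co)

∈-units⁻ : ∀ {a n} → a ∈ units n → 1 ≤ a × a ≤ n × Coprime a n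
∈-units⁻ {a} {n} a∈ with Mem.∈-filter⁻ (λ a → gcd a n ≟ 1) {xs = range1 n} a∈
... | a∈r , g with ∈-range1⁻ a∈r
... | p , q = p , q , Cop.gcd≡1⇒coprime g

unique-units : ∀ n → Unique (units n)
unique-units n = Uniq.filter⁺ (λ a → gcd a n ≟ 1) (unique-range1 n)

unit-< : ∀ {a n} → 2 ≤ n → a ∈ units n → a < n
unit-< {a} {n} 2≤n a∈ with ∈-units⁻ a∈
... | _ , a≤n , co with m≤n⇒m<n∨m≡n a≤n
... | inj₁ a<n = a<n
... | inj₂ refl = ⊥-elim (<-irrefl (sym (co (Div.∣-refl , Div.∣-refl))) 2≤n)

coprime-%∈units : ∀ {a n} .{{_ : NonZero n}} → 2 ≤ n → Coprime a n → a % n ∈ units n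
coprime-%∈units {a} {n} 2≤n co = ∈-units⁺ (n≢0⇒n>0 λ e → <-irrefl (sym (co (DivMod-lem e , Div.∣-refl))) 2≤n) (DivMod.m%n≤n a n) (coprime-% co)
  where
  DivMod-lem : a % n ≡ 0 → n ∣ a
  DivMod-lem e = Div.m%n≡0⇒n∣m a n e

product-map-% : ∀ b n .{{_ : NonZero n}} us → product (map (λ u → (b * u) % n) us) % n ≡ (b ^ length us * product us) % n
product-map-% b n [] = refl
product-map-% b n (u ∷ us) = trans (%-*-cong n (DivMod.m%n%n≡m%n (b * u) n) (product-map-% b n us))
  (cong (_% n) (lem b u (b ^ length us) (product us)))
  where
  lem : ∀ b u x y → b * u * (x * y) ≡ b * x * (u * y)
  lem = solve-∀

coprime-product : ∀ {n us} → (∀ {u} → u ∈ us → Coprime u n) → Coprime (product us) n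
coprime-product {us = []} h = Cop.1-coprimeTo _
coprime-product {us = u ∷ us} h = coprime-* (h (here refl)) (coprime-product (λ m → h (there m)))

-- Multiplication by b permutes the units modulo n. Their product is thus multiplied by b ^ φ(n)
-- without changing, and as a unit it can be cancelled.
euler : ∀ {b n} .{{_ : NonZero n}} → 2 ≤ n → Coprime b n → (b ^ totient n) % n ≡ 1 % n
euler {b} {n} 2≤n co = %-*-cancel (product (units n)) n (coprime-product (λ m → proj₂ (proj₂ (∈-units⁻ m))))
  (trans (cong (_% n) (*-comm (product (units n)) _)) (trans (sym (product-map-% b n (units n)))
   (cong (_% n) (trans (ListAct.product-↭ (↭-sym perm)) (sym (*-identityʳ _))))))
  where
  f : ℕ → ℕ
  f u = (b * u) % n
  inj : ∀ {x y} → x ∈ units n → y ∈ units n → f x ≡ f y → x ≡ y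
  inj x∈ y∈ eq = trans (sym (DivMod.m<n⇒m%n≡m (unit-< 2≤n x∈))) (trans (%-*-cancel b n co eq) (DivMod.m<n⇒m%n≡m (unit-< 2≤n y∈)))
  sub : ∀ {z} → z ∈ map f (units n) → z ∈ units n
  sub z∈ with Mem.∈-map⁻ f z∈
  ... | u , u∈ , refl = coprime-%∈units 2≤n (coprime-* co (proj₂ (proj₂ (∈-units⁻ u∈))))
  perm : units n ↭ map f (units n)
  perm = unique-⊆-length-↭ (unique-map-∈ f inj (unique-units n)) sub (≤-reflexive (sym (Listₚ.length-map f (units n))))

totient≤ : ∀ n → totient n ≤ n
totient≤ n = ≤-trans (Listₚ.length-filter (λ a → gcd a n ≟ 1) (range1 n)) (≤-reflexive (length-range1 n))

1≤totient : ∀ {n} → 1 ≤ n → 1 ≤ totient n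
1≤totient {n} 1≤n = nonempty (∈-units⁺ ≤-refl 1≤n (Cop.1-coprimeTo n))
  where
  nonempty : ∀ {x} {xs : List ℕ} → x ∈ xs → 1 ≤ length xs
  nonempty {xs = _ ∷ _} _ = s≤s z≤n

firstSat-spec : ∀ p {ks k} → AllPairs _<_ ks → k ∈ ks → p k ≡ true → firstSat p ks ∈ ks × p (firstSat p ks) ≡ true × firstSat p ks ≤ k
firstSat-spec p {x ∷ ks} {k} (lt ∷ s) k∈ pk with p x in eq
... | true = here refl , eq , le k∈
  where
  le : k ∈ x ∷ ks → x ≤ k
  le (here refl) = ≤-refl
  le (there m) = <⇒≤ (All.lookup lt m)
... | false with k∈
...   | here refl = ⊥-elim (case trans (sym eq) pk of λ ())
...   | there m with firstSat-spec p s m pk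
...     | a , b , c = there a , b , c

sorted-range1 : ∀ n → AllPairs _<_ (range1 n)
sorted-range1 n = AllPairsₚ.map⁺ (AllPairs.map s≤s (AllPairsₚ.applyUpTo⁺₁ id n (λ i<j _ → i<j)))

order-spec : ∀ {n} .{{_ : NonZero n}} a k → 1 ≤ k → k ≤ n → (a ^ k) % n ≡ 1 % n →
  (1 ≤ order n a × order n a ≤ n) × (a ^ order n a) % n ≡ 1 % n × order n a ≤ k
order-spec {suc m} a k 1≤k k≤n eq with firstSat-spec (λ k → ⌊ (a ^ k) % suc m ≟ 1 % suc m ⌋) (sorted-range1 (suc m)) (∈-range1⁺ 1≤k k≤n) (true⁺ ((a ^ k) % suc m ≟ 1 % suc m) eq)
  where
  true⁺ : ∀ {P : Set} (d : Dec P) → P → ⌊ d ⌋ ≡ true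
  true⁺ (yes _) _ = refl
  true⁺ (no ¬p) p = ⊥-elim (¬p p)
... | o∈ , po , o≤k = ∈-range1⁻ o∈ , true⁻ ((a ^ order (suc m) a) % suc m ≟ 1 % suc m) po , o≤k
  where
  true⁻ : ∀ {P : Set} (d : Dec P) → ⌊ d ⌋ ≡ true → P
  true⁻ (yes p) _ = p

^-% : ∀ b o k n .{{_ : NonZero n}} .{{_ : NonZero o}} → (b ^ o) % n ≡ 1 % n → (b ^ k) % n ≡ (b ^ (k % o)) % n
^-% b o k n eq = trans (cong (λ x → (b ^ x) % n) (DivMod.m≡m%n+[m/n]*n k o))
  (trans (cong (_% n) (trans (^-distribˡ-+-* b (k % o) (k / o * o)) (cong (b ^ (k % o) *_) (trans (cong (b ^_) (*-comm (k / o) o)) (sym (^-*-assoc b o (k / o)))))))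
  (trans (%-*-cong {a = b ^ (k % o)} n refl (trans (%-^-cong n (k / o) eq) (cong (_% n) (^-zeroˡ (k / o))))) (cong (_% n) (*-identityʳ _))))

ord : ∀ n .{{_ : NonZero n}} → ℕ → ℕ
ord n b = order n (b % n)

module _ {n : ℕ} .{{_ : NonZero n}} (2≤n : 2 ≤ n) where
  private
    1≤n : 1 ≤ n
    1≤n = <⇒≤ 2≤n

    base : ∀ {b} k → (b ^ k) % n ≡ ((b % n) ^ k) % n
    base {b} k = %-^-cong n k (sym (DivMod.m%n%n≡m%n b n))

    spec : ∀ {b} → Coprime b n → _
    spec {b} co = order-spec {n} (b % n) (totient n) (1≤totient 1≤n) (totient≤ n) (trans (sym (base (totient n))) (euler 2≤n co))

  1≤ord : ∀ {b} → Coprime b n → 1 ≤ ord n b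
  1≤ord co = proj₁ (proj₁ (spec co))

  ^-ord : ∀ {b} → Coprime b n → (b ^ ord n b) % n ≡ 1 % n
  ^-ord {b} co = trans (base (ord n b)) (proj₁ (proj₂ (spec co)))

  ord-∣ : ∀ {b} k → Coprime b n → (b ^ k) % n ≡ 1 % n → ord n b ∣ k
  ord-∣ {b} k co eq = go (k % ord n b) refl
    where
    instance
      o≢0 : NonZero (ord n b)
      o≢0 = >-nonZero (1≤ord co)
    go : ∀ r → k % ord n b ≡ r → ord n b ∣ k
    go zero e = Div.m%n≡0⇒n∣m k (ord n b) e
    go (suc r) e = ⊥-elim (<⇒≱ r<o (proj₂ (proj₂ (order-spec (b % n) (suc r) (s≤s z≤n) (≤-trans (<⇒≤ r<o) (proj₂ (proj₁ (spec co)))) eq'))))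
      where
      r<o : suc r < ord n b
      r<o = subst (_< ord n b) e (DivMod.m%n<n k (ord n b))
      eq' : ((b % n) ^ suc r) % n ≡ 1 % n
      eq' = trans (sym (base (suc r))) (trans (cong (λ x → (b ^ x) % n) (sym e)) (trans (sym (^-% b (ord n b) k n (^-ord co))) eq))

*-^ : ∀ a b k → (a * b) ^ k ≡ a ^ k * b ^ k
*-^ a b zero = refl
*-^ a b (suc k) = trans (cong (a * b *_) (*-^ a b k)) (lem a b (a ^ k) (b ^ k))
  where
  lem : ∀ a b x y → a * b * (x * y) ≡ a * x * (b * y)
  lem = solve-∀

-- Prime powers dividing Carmichael's function

foldr-⊔-≥ : ∀ {x xs} → x ∈ xs → x ≤ foldr _⊔_ 0 xs
foldr-⊔-≥ {xs = y ∷ xs} (here refl) = m≤m⊔n y _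
foldr-⊔-≥ {xs = y ∷ xs} (there m) = ≤-trans (foldr-⊔-≥ m) (m≤n⊔m y _)

foldr-⊔-∈ : ∀ xs → foldr _⊔_ 0 xs ≡ 0 ⊎ foldr _⊔_ 0 xs ∈ xs
foldr-⊔-∈ [] = inj₁ refl
foldr-⊔-∈ (x ∷ xs) with ⊔-sel x (foldr _⊔_ 0 xs) | foldr-⊔-∈ xs
... | inj₁ e | _ = inj₂ (here e)
... | inj₂ e | inj₁ z = inj₁ (trans e z)
... | inj₂ e | inj₂ m = inj₂ (there (subst (_∈ xs) (sym e) m))

prime≥2 : ∀ {p} → Prime p → 2 ≤ p
prime≥2 {p} pr = nonTrivial⇒n>1 p {{Pr.prime⇒nonTrivial pr}}

prime≥1 : ∀ {p} → Prime p → 1 ≤ p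
prime≥1 pr = <⇒≤ (prime≥2 pr)

prime∤⇒coprime : ∀ {p n} → Prime p → p ∤ n → Coprime p n
prime∤⇒coprime pr p∤n {d} (d∣p , d∣n) with Pr.prime⇒irreducible pr d∣p
... | inj₁ e = e
... | inj₂ refl = ⊥-elim (p∤n d∣n)

prime∣prime : ∀ {p q} → Prime p → Prime q → p ∣ q → p ≡ q
prime∣prime pp pq p∣q with Pr.prime⇒irreducible pq p∣q
... | inj₁ refl = ⊥-elim (Pr.¬prime[1] pp)
... | inj₂ e = e

prime-divisor : ∀ {d} → 2 ≤ d → ∃ λ r → Prime r × r ∣ d
prime-divisor {d} 2≤d with factorise d {{>-nonZero (<⇒≤ 2≤d)}}
... | record { factors = [] ; isFactorisation = refl } = ⊥-elim (<-irrefl refl 2≤d)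
... | record { factors = r ∷ rs ; isFactorisation = refl ; factorsPrime = pr ∷ _ } = r , pr , Div.m∣m*n (product rs)

∣-prime-coprime : ∀ {b n} → 1 ≤ n → (∀ {r} → Prime r → r ∣ n → r ∤ b) → Coprime b n
∣-prime-coprime {b} {n} 1≤n h {d} (d∣b , d∣n) with 2 ≤? d
... | yes 2≤d = let r , pr , r∣d = prime-divisor 2≤d in ⊥-elim (h pr (Div.∣-trans r∣d d∣n) (Div.∣-trans r∣d d∣b))
... | no ¬2≤d = ≤-antisym (≮⇒≥ ¬2≤d) (n≢0⇒n>0 λ { refl → <-irrefl (sym (Div.0∣⇒≡0 d∣n)) 1≤n })

prime-power-split : ∀ q → 2 ≤ q → ∀ N → 1 ≤ N → ∃₂ λ f N' → N ≡ q ^ f * N' × q ∤ N'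
prime-power-split q 2≤q = <-rec _ go
  where
  go : ∀ N → (∀ {M} → M < N → 1 ≤ M → ∃₂ λ f N' → M ≡ q ^ f * N' × q ∤ N') → 1 ≤ N → ∃₂ λ f N' → N ≡ q ^ f * N' × q ∤ N'
  go N rec 1≤N with q ∣? N
  ... | no ¬d = 0 , N , sym (+-identityʳ N) , ¬d
  ... | yes (divides zero refl) = ⊥-elim (<-irrefl refl 1≤N)
  ... | yes (divides (suc t) refl) with rec (m<m*n (suc t) q 2≤q) (s≤s z≤n)
  ...   | f , N' , eq , nd = suc f , N' , trans (cong (_* q) eq) (lem q (q ^ f) N') , nd
    where
    lem : ∀ q x y → x * y * q ≡ q * x * y
    lem = solve-∀

module _ {n : ℕ} .{{_ : NonZero n}} (2≤n : 2 ≤ n) where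
  ord≤carmichael : ∀ {b} → Coprime b n → ord n b ≤ carmichael n
  ord≤carmichael co = foldr-⊔-≥ (Mem.∈-map⁺ (order n) (coprime-%∈units 2≤n co))

  carmichael-attained : ∃ λ a → Coprime a n × ord n a ≡ carmichael n
  carmichael-attained with foldr-⊔-∈ (map (order n) (units n))
  ... | inj₁ z = ⊥-elim (<-irrefl (sym z) (≤-trans (1≤ord 2≤n (Cop.1-coprimeTo n)) (ord≤carmichael (Cop.1-coprimeTo n))))
  ... | inj₂ m with Mem.∈-map⁻ (order n) m
  ...   | a , a∈ , eq = a , proj₂ (proj₂ (∈-units⁻ a∈)) , trans (cong (order n) (DivMod.m<n⇒m%n≡m (unit-< 2≤n a∈))) (sym eq)

  private
    One : ℕ → Set
    One x = x % n ≡ 1 % n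

    one-^ : ∀ {x} k → One x → One (x ^ k)
    one-^ k h = trans (%-^-cong n k h) (cong (_% n) (^-zeroˡ k))

    one-cancelʳ : ∀ x {y} → One y → One (x * y) → One x
    one-cancelʳ x h h' = trans (trans (cong (_% n) (sym (*-identityʳ x))) (sym (%-*-cong {a = x} n refl h))) h'

  carmichael∣totient : carmichael n ∣ totient n
  carmichael∣totient with carmichael-attained
  ... | a , co , eq = subst (_∣ totient n) eq (ord-∣ 2≤n (totient n) co (euler 2≤n co))

  -- Otherwise a ^ (q ^ f) * b ^ t has order exceeding the maximal one, where q ^ f exactly divides the latter.
  primePower∣carmichael : ∀ {b q} e → Prime q → Coprime b n → q ^ e ∣ ord n b → q ^ e ∣ carmichael n
  primePower∣carmichael {b} {q} e pq cb (divides t l≡) with carmichael-attained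
  ... | a , ca , eqa with prime-power-split q (prime≥2 pq) (carmichael n) (subst (1 ≤_) eqa (1≤ord 2≤n ca))
  ... | f , λ' , split , q∤λ' with e ≤? f
  ...   | yes e≤f = subst (q ^ e ∣_) (sym split) (Div.∣m⇒∣m*n λ' (^-mono-∣ e≤f))
    where
    ^-mono-∣ : ∀ {e f} → e ≤ f → q ^ e ∣ q ^ f
    ^-mono-∣ {e} e≤f with m≤n⇒∃[o]m+o≡n e≤f
    ... | d , refl = subst (q ^ e ∣_) (sym (^-distribˡ-+-* q e d)) (Div.m∣m*n (q ^ d))
  ...   | no e≰f = ⊥-elim (<⇒≱ big (≤-trans (Div.∣⇒≤ {{>-nonZero (1≤ord 2≤n cc)}} (coprime-∣-* coλ' λ'∣o q∣o)) (ord≤carmichael cc)))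
    where
    c = a ^ (q ^ f) * b ^ t
    cc : Coprime c n
    cc = coprime-* (coprime-^ (q ^ f) ca) (coprime-^ t cb)
    o = ord n c
    coq : Coprime (q ^ e) λ'
    coq = coprime-^ e (prime∤⇒coprime pq q∤λ')
    coλ' : Coprime λ' (q ^ e)
    coλ' = Cop.sym coq
    cpow : ∀ k → c ^ k ≡ a ^ (q ^ f * k) * b ^ (t * k)
    cpow k = trans (*-^ (a ^ (q ^ f)) (b ^ t) k) (cong₂ _*_ (^-*-assoc a (q ^ f) k) (^-*-assoc b t k))
    one-c : ∀ k → One (a ^ (q ^ f * (o * k)) * b ^ (t * (o * k)))
    one-c k = subst One (trans (^-*-assoc c o k) (cpow (o * k))) (one-^ k (^-ord 2≤n cc))
    bone : One (b ^ (t * (o * q ^ e)))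
    bone = subst One (trans (^-*-assoc b (ord n b) o) (cong (b ^_) (trans (cong (_* o) l≡) (l3 t (q ^ e) o)))) (one-^ o (^-ord 2≤n cb))
      where
      l3 : ∀ t x o → t * x * o ≡ t * (o * x)
      l3 = solve-∀
    aone : One (a ^ (q ^ f * (o * λ')))
    aone = subst One (trans (^-*-assoc a (ord n a) o) (cong (a ^_) (trans (cong (_* o) (trans eqa split)) (l3 (q ^ f) λ' o)))) (one-^ o (^-ord 2≤n ca))
      where
      l3 : ∀ t x o → t * x * o ≡ t * (o * x)
      l3 = solve-∀
    instance
      qf≢0 : NonZero (q ^ f)
      qf≢0 = m^n≢0 q f {{Pr.prime⇒nonZero pq}}
      t≢0 : NonZero t
      t≢0 = ≢-nonZero λ { refl → <-irrefl (sym l≡) (1≤ord 2≤n cb) }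
    -- The exponent o * q ^ e kills the power of b in c, so the order of a divides q ^ f * (o * q ^
    -- e), and λ' is prime to q. For `q∣o` the exponent o * λ' kills the power of a instead.
    λ'∣o : λ' ∣ o
    λ'∣o = Cop.coprime-divisor coλ' (subst (λ' ∣_) (*-comm o (q ^ e)) (Div.*-cancelˡ-∣ (q ^ f) (subst (_∣ q ^ f * (o * q ^ e)) (trans eqa split)
       (ord-∣ 2≤n _ ca (one-cancelʳ (a ^ (q ^ f * (o * q ^ e))) bone (one-c (q ^ e)))))))
    q∣o : q ^ e ∣ o
    q∣o = Cop.coprime-divisor coq (subst (q ^ e ∣_) (*-comm o λ') (Div.*-cancelˡ-∣ t (subst (_∣ t * (o * λ')) l≡
       (ord-∣ 2≤n _ cb (one-cancelʳ (b ^ (t * (o * λ'))) aone (subst One (*-comm (a ^ (q ^ f * (o * λ'))) _) (one-c λ')))))))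
    1≤λ' : 1 ≤ λ'
    1≤λ' = n≢0⇒n>0 λ { refl → q∤λ' (_ Div.∣0) }
    big : carmichael n < λ' * q ^ e
    big = subst₂ _<_ (trans (*-comm λ' (q ^ f)) (sym split)) refl
          (*-monoʳ-< λ' {{>-nonZero 1≤λ'}} (^-monoʳ-< q (prime≥2 pq) (≰⇒> e≰f)))

-- The k-th difference of x ^ k is k!, so x ^ k ≡ 1 (mod p) fails somewhere on 1, …, k + 1 if 0 < k < p.
Δ : (ℕ → ℤ) → ℕ → ℤ
Δ f x = f (suc x) ℤ.- f x

-- f behaves like a polynomial of degree at most k in which x ^ k has coefficient c: differencing
-- lowers the degree by one and multiplies the leading coefficient by the degree.
data Deg : ℕ → ℤ → (ℕ → ℤ) → Set where
  const : ∀ {c f} → (∀ x → f x ≡ c) → Deg zero c f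
  diff  : ∀ {k c f} → Deg k (ℤ.+ suc k ℤ.* c) (Δ f) → Deg (suc k) c f

Deg-ext : ∀ k {c f g} → (∀ x → f x ≡ g x) → Deg k c f → Deg k c g
Deg-ext zero eq (const d) = const λ x → trans (sym (eq x)) (d x)
Deg-ext (suc k) eq (diff d) = diff (Deg-ext k (λ x → cong₂ ℤ._-_ (eq (suc x)) (eq x)) d)

Deg-+ : ∀ k {c c' f g} → Deg k c f → Deg k c' g → Deg k (c ℤ.+ c') (λ x → f x ℤ.+ g x)
Deg-+ zero (const d) (const e) = const λ x → cong₂ ℤ._+_ (d x) (e x)
Deg-+ (suc k) {c} {c'} {f} {g} (diff d) (diff e) = diff (Deg-ext k (λ x → lem (f (suc x)) (f x) (g (suc x)) (g x))
  (subst (λ z → Deg k z (λ x → Δ f x ℤ.+ Δ g x)) (sym (ℤₚ.*-distribˡ-+ (ℤ.+ suc k) c c')) (Deg-+ k d e)))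
  where
  lem : ∀ a b c d → (a ℤ.- b) ℤ.+ (c ℤ.- d) ≡ (a ℤ.+ c) ℤ.- (b ℤ.+ d)
  lem = ℤsolve-∀

Deg-up : ∀ k {c f} → Deg k c f → Deg (suc k) (ℤ.+ 0) f
Deg-up zero {c} (const d) = diff (const λ x → trans (cong₂ ℤ._-_ (d (suc x)) (d x)) (ℤₚ.+-inverseʳ c))
Deg-up (suc k) {c} {f} (diff d) = diff (subst (λ z → Deg (suc k) z (Δ f)) (sym (ℤₚ.*-zeroʳ (ℤ.+ suc (suc k)))) (Deg-up k d))

Deg-x : ∀ k {c f} → Deg k c f → Deg (suc k) c (λ x → ℤ.+ x ℤ.* f x)
Deg-x zero {c} {f} (const d) = diff (const λ x → trans (cong₂ (λ u v → ℤ.+ suc x ℤ.* u ℤ.- ℤ.+ x ℤ.* v) (d (suc x)) (d x)) (lem (ℤ.+ x) c))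
  where
  lem : ∀ x c → (ℤ.+ 1 ℤ.+ x) ℤ.* c ℤ.- x ℤ.* c ≡ ℤ.+ 1 ℤ.* c
  lem = ℤsolve-∀
Deg-x (suc k) {c} {f} dd@(diff d) = diff (subst (λ z → Deg (suc k) z (Δ (λ x → ℤ.+ x ℤ.* f x))) eq
  (Deg-ext (suc k) (λ x → lem (ℤ.+ x) (f (suc x)) (f x)) (Deg-+ (suc k) (Deg-+ (suc k) (Deg-x k d) dd) (Deg-up k d))))
  where
  lem : ∀ x a b → (x ℤ.* (a ℤ.- b) ℤ.+ b) ℤ.+ (a ℤ.- b) ≡ (ℤ.+ 1 ℤ.+ x) ℤ.* a ℤ.- x ℤ.* b
  lem = ℤsolve-∀
  eq : (ℤ.+ suc k ℤ.* c ℤ.+ c) ℤ.+ ℤ.+ 0 ≡ ℤ.+ suc (suc k) ℤ.* c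
  eq = lem2 (ℤ.+ suc k) c
    where
    lem2 : ∀ x c → (x ℤ.* c ℤ.+ c) ℤ.+ ℤ.+ 0 ≡ (ℤ.+ 1 ℤ.+ x) ℤ.* c
    lem2 = ℤsolve-∀

Deg-^ : ∀ k → Deg k (ℤ.+ 1) (λ x → ℤ.+ (x ^ k))
Deg-^ zero = const λ _ → refl
Deg-^ (suc k) = Deg-ext (suc k) (λ x → sym (ℤₚ.pos-* x (x ^ k))) (Deg-x k (Deg-^ k))

Mult : ℕ → ℤ → Set
Mult p z = ∃ λ t → z ≡ t ℤ.* ℤ.+ p

-- Differences of multiples of p are multiples of p, and after k differences only the constant k! c
-- remains.
Deg-Mult : ∀ p k {c f} s → Deg k c f → (∀ x → x ≤ k → Mult p (f (s + x))) → Mult p (ℤ.+ (k !) ℤ.* c)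
Deg-Mult p zero {c} s (const d) h with h 0 z≤n
... | t , eq = t , trans (ℤₚ.*-identityˡ c) (trans (sym (d (s + 0))) eq)
Deg-Mult p (suc k) {c} {f} s (diff d) h with Deg-Mult p k s d step
  where
  step : ∀ x → x ≤ k → Mult p (Δ f (s + x))
  step x x≤k with h x (m≤n⇒m≤1+n x≤k) | h (suc x) (s≤s x≤k)
  ... | t , e | t' , e' = t' ℤ.- t , trans (cong₂ ℤ._-_ (trans (cong f (sym (+-suc s x))) e') e) (lem t' t (ℤ.+ p))
    where
    lem : ∀ a b p → a ℤ.* p ℤ.- b ℤ.* p ≡ (a ℤ.- b) ℤ.* p
    lem = ℤsolve-∀
... | t , eq = t , trans (trans (cong (ℤ._* c) (ℤₚ.pos-* (suc k) (k !))) (lem (ℤ.+ suc k) (ℤ.+ (k !)) c)) eq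
  where
  lem : ∀ a b c → a ℤ.* b ℤ.* c ≡ b ℤ.* (a ℤ.* c)
  lem = ℤsolve-∀

prime∤! : ∀ {p} → Prime p → ∀ k → k < p → p ∤ k !
prime∤! pr zero k<p d = Pr.¬prime[1] (subst Prime (Div.∣1⇒≡1 d) pr)
prime∤! pr (suc k) k<p d with euclidsLemma (suc k) (k !) pr d
... | inj₁ d' = <⇒≱ k<p (Div.∣⇒≤ d')
... | inj₂ d' = prime∤! pr k (<⇒≤ k<p) d'

nonresidue : ∀ {p} .{{_ : NonZero p}} → Prime p → ∀ k → 1 ≤ k → k + 1 < p → ∃ λ b → 1 ≤ b × b < p × (b ^ k) % p ≢ 1 % p
nonresidue {p} pr (suc k) 1≤k k<p with All.all? (λ b → (b ^ suc k) % p ≟ 1 % p) (range1 (suc k + 1))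
... | no ¬all with find (Allₚ.¬All⇒Any¬ (λ b → (b ^ suc k) % p ≟ 1 % p) (range1 (suc k + 1)) ¬all)
...   | b , b∈ , ne = b , proj₁ (∈-range1⁻ b∈) , ≤-<-trans (proj₂ (∈-range1⁻ b∈)) k<p , ne
nonresidue {p} pr (suc k) 1≤k k<p | yes all = ⊥-elim (prime∤! pr (suc k) (<-trans (m<m+n (suc k) (s≤s z≤n)) k<p) p∣)
  where
  f : ℕ → ℤ
  f x = ℤ.+ (x ^ suc k) ℤ.+ ℤ.-[1+ 0 ]
  constDeg : ∀ j → Deg (suc j) (ℤ.+ 0) (λ _ → ℤ.-[1+ 0 ])
  constDeg zero = diff (const λ _ → refl)
  constDeg (suc j) = Deg-up (suc j) (constDeg j)
  df : Deg (suc k) (ℤ.+ 1) f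
  df = Deg-+ (suc k) (Deg-^ (suc k)) (constDeg k)
  vals : ∀ x → x ≤ suc k → Mult p (f (1 + x))
  vals x x≤ with m≤n⇒∃[o]m+o≡n (m^n>0 (suc x) (suc k))
  ... | t , eq with ≡%⇒∣ 1 t p (trans (cong (_% p) eq) (All.lookup all (∈-range1⁺ (s≤s z≤n) (subst (suc x ≤_) (+-comm 1 (suc k)) (s≤s x≤)))))
  ...   | divides s refl = ℤ.+ s , trans (cong (λ z → ℤ.+ z ℤ.+ ℤ.-[1+ 0 ]) (sym eq)) (ℤₚ.pos-* s p)
  p∣ : p ∣ (suc k) !
  p∣ with Deg-Mult p (suc k) 1 df vals
  ... | t , eq = divides ℤ.∣ t ∣ (trans (cong ℤ.∣_∣ (trans (sym (ℤₚ.*-identityʳ (ℤ.+ ((suc k) !)))) eq)) (ℤₚ.abs-* t (ℤ.+ p)))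

-- If r divides the b found so far, P * product rs is added. This changes neither b modulo P nor b
-- modulo the earlier primes. It does destroy divisibility by r: r is not in rs, since b avoids rs,
-- and r does not divide P, since b₀ is a unit modulo P.
lift-avoiding : ∀ P .{{_ : NonZero P}} {b₀} → Coprime b₀ P → ∀ rs → All Prime rs → ∃ λ b → b % P ≡ b₀ % P × (∀ {r} → r ∈ rs → r ∤ b)
lift-avoiding P {b₀} co [] [] = b₀ , refl , λ ()
lift-avoiding P {b₀} co (r ∷ rs) (pr ∷ prs) with lift-avoiding P co rs prs
... | b , eq , av with r ∣? b
...   | no r∤b = b , eq , λ { (here refl) → r∤b ; (there m) → av m }
...   | yes r∣b = b + P * product rs , trans (DivMod.%-remove-+ʳ b (Div.m∣m*n (product rs))) eq , av'
  where
  r∤P : r ∤ P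
  r∤P r∣P = Pr.¬prime[1] (subst Prime (co (Div.∣n∣m%n⇒∣m r∣P (subst (r ∣_) eq (Div.%-presˡ-∣ r∣b r∣P)) , r∣P)) pr)
  av' : ∀ {s} → s ∈ r ∷ rs → s ∤ b + P * product rs
  av' (here refl) d with euclidsLemma P (product rs) pr (Div.∣m+n∣m⇒∣n d r∣b)
  ... | inj₁ x = r∤P x
  ... | inj₂ x = av (factorisationHasAllPrimeFactors pr x prs) r∣b
  av' {s} (there m) d = av m (Div.∣m+n∣m⇒∣n (subst (s ∣_) (+-comm b _) d) (Div.∣n⇒∣m*n P (ListAct.∈⇒∣product m)))

lift-unit : ∀ P n .{{_ : NonZero P}} .{{_ : NonZero n}} {b₀} → Coprime b₀ P → ∃ λ b → b % P ≡ b₀ % P × Coprime b n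
lift-unit P n co with factorise n
... | record { factors = rs ; isFactorisation = eq ; factorsPrime = prs } with lift-avoiding P co rs prs
... | b , e , av = b , e , ∣-prime-coprime (>-nonZero⁻¹ n) (λ {r} pr r∣n → av (factorisationHasAllPrimeFactors pr (subst (r ∣_) eq r∣n) prs))

-- Recursion for Euler's function, one prime factor at a time

sumN : (ℕ → ℕ) → ℕ → ℕ
sumN f zero = 0
sumN f (suc n) = f 0 + sumN (f ∘ suc) n

sumN-cong : ∀ {f g} n → (∀ i → i < n → f i ≡ g i) → sumN f n ≡ sumN g n
sumN-cong zero h = refl
sumN-cong (suc n) h = cong₂ _+_ (h 0 (s≤s z≤n)) (sumN-cong n (λ i i<n → h (suc i) (s≤s i<n)))

sumN-+ : ∀ f g n → sumN (λ i → f i + g i) n ≡ sumN f n + sumN g n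
sumN-+ f g zero = refl
sumN-+ f g (suc n) = trans (cong (f 0 + g 0 +_) (sumN-+ (f ∘ suc) (g ∘ suc) n)) (lem (f 0) (g 0) _ _)
  where
  lem : ∀ a b c d → a + b + (c + d) ≡ a + c + (b + d)
  lem = solve-∀

sumN-split : ∀ f a b → sumN f (a + b) ≡ sumN f a + sumN (λ i → f (a + i)) b
sumN-split f zero b = refl
sumN-split f (suc a) b = trans (cong (f 0 +_) (sumN-split (f ∘ suc) a b)) (sym (+-assoc (f 0) _ _))

sumN-blocks : ∀ f m p → sumN f (m * p) ≡ sumN (λ j → sumN (λ i → f (j * p + i)) p) m
sumN-blocks f zero p = refl
sumN-blocks f (suc m) p = trans (sumN-split f p (m * p)) (cong (sumN f p +_) (trans (sumN-blocks (λ i → f (p + i)) m p)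
  (sumN-cong m (λ j _ → sumN-cong p (λ i _ → cong f (sym (+-assoc p (j * p) i)))))))

sumN-const : ∀ c n → sumN (λ _ → c) n ≡ n * c
sumN-const c zero = refl
sumN-const c (suc n) = cong (c +_) (sumN-const c n)

sumN-last : ∀ f n → (∀ i → i < n → f i ≡ 0) → sumN f (suc n) ≡ f n
sumN-last f zero h = +-identityʳ (f 0)
sumN-last f (suc n) h = trans (cong (_+ sumN (f ∘ suc) (suc n)) (h 0 (s≤s z≤n))) (sumN-last (f ∘ suc) n (λ i i<n → h (suc i) (s≤s i<n)))

ind : ∀ {P : Set} → Dec P → ℕ
ind (yes _) = 1
ind (no _) = 0

ind-cong : ∀ {P Q : Set} (p : Dec P) (q : Dec Q) → (P → Q) → (Q → P) → ind p ≡ ind q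
ind-cong (yes _) (yes _) f g = refl
ind-cong (yes p) (no ¬q) f g = ⊥-elim (¬q (f p))
ind-cong (no ¬p) (yes q) f g = ⊥-elim (¬p (g q))
ind-cong (no _) (no _) f g = refl

length-filter-sumN : ∀ {P : ℕ → Set} (P? : Decidable P) h n → length (filter P? (map suc (applyUpTo h n))) ≡ sumN (λ i → ind (P? (suc (h i)))) n
length-filter-sumN P? h zero = refl
length-filter-sumN P? h (suc n) with P? (suc (h 0))
... | yes _ = cong suc (length-filter-sumN P? (h ∘ suc) n)
... | no _ = length-filter-sumN P? (h ∘ suc) n

no⊥ : Dec ⊥
no⊥ = no id

gcd⇒co : ∀ k m → gcd k m ≡ 1 → Coprime k m
gcd⇒co k m = Cop.gcd≡1⇒coprime {k} {m}

co⇒gcd : ∀ k m → Coprime k m → gcd k m ≡ 1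
co⇒gcd k m = Cop.coprime⇒gcd≡1 {k} {m}

χ : ℕ → ℕ → ℕ
χ m k = ind (gcd k m ≟ 1)

totient-sumN : ∀ n → totient n ≡ sumN (λ i → χ n (suc i)) n
totient-sumN n = length-filter-sumN (λ k → gcd k n ≟ 1) id n

χ-cong : ∀ m k m' k' → (Coprime k m → Coprime k' m') → (Coprime k' m' → Coprime k m) → χ m k ≡ χ m' k'
χ-cong m k m' k' f g = ind-cong (gcd k m ≟ 1) (gcd k' m' ≟ 1) (λ e → co⇒gcd k' m' (f (gcd⇒co k m e))) (λ e → co⇒gcd k m (g (gcd⇒co k' m' e)))

χ-sum : ∀ p m → sumN (λ i → χ m (suc i)) (p * m) ≡ p * totient m
χ-sum p m = trans (sumN-blocks (λ i → χ m (suc i)) p m) (trans (sumN-cong p (λ j _ → trans (sumN-cong m (λ i _ → per j i)) (sym (totient-sumN m)))) (sumN-const (totient m) p))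
  where
  per : ∀ j i → χ m (suc (j * m + i)) ≡ χ m (suc i)
  per j i = χ-cong m (suc (j * m + i)) m (suc i)
    (λ co {d} (a , b) → co (subst (d ∣_) (+-suc (j * m) i) (Div.∣m∣n⇒∣m+n (Div.∣n⇒∣m*n j b) a) , b))
    (λ co {d} (a , b) → co (Div.∣m+n∣m⇒∣n (subst (d ∣_) (sym (+-suc (j * m) i)) a) (Div.∣n⇒∣m*n j b) , b))

totient-*-∣ : ∀ {p m} → p ∣ m → totient (p * m) ≡ p * totient m
totient-*-∣ {p} {m} p∣m = trans (totient-sumN (p * m)) (trans (sumN-cong (p * m) (λ i _ → χ-cong (p * m) (suc i) m (suc i)
    (λ co (a , b) → co (a , Div.∣n⇒∣m*n p b))
    (λ co → Cop.sym (coprime-* (λ (a , b) → co (b , Div.∣-trans a p∣m)) (Cop.sym co))))) (χ-sum p m))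

-- There are p φ(m) numbers up to p m prime to m, by periodicity. Those not prime to p m are the p j
-- with j ≤ m prime to m.
totient-*-∤ : ∀ {p m} → Prime p → p ∤ m → totient (p * m) + totient m ≡ p * totient m
totient-*-∤ {zero} pr _ = ⊥-elim (Pr.¬prime[0] pr)
totient-*-∤ {suc p'} {m} pr p∤m = sym (trans (sym (χ-sum p m)) (trans (sumN-cong (p * m) (λ i _ → pointwise (suc i)))
    (trans (sumN-+ (λ i → χ (p * m) (suc i)) (λ i → ind (both? (suc i))) (p * m)) (cong₂ _+_ (sym (totient-sumN (p * m))) second))))
  where
  p = suc p'
  both? : ∀ k → Dec (p ∣ k × gcd k m ≡ 1)
  both? k = (p ∣? k) ×-dec (gcd k m ≟ 1)
  pointwise : ∀ k → χ m k ≡ χ (p * m) k + ind (both? k)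
  pointwise k with p ∣? k | gcd k m ≟ 1 | gcd k (p * m) ≟ 1
  ... | yes p∣k | yes e | yes e' = ⊥-elim (Pr.¬prime[1] (subst Prime (gcd⇒co k (p * m) e' (p∣k , Div.m∣m*n m)) pr))
  ... | yes p∣k | yes e | no _ = refl
  ... | yes p∣k | no _ | yes e' = ⊥-elim (Pr.¬prime[1] (subst Prime (gcd⇒co k (p * m) e' (p∣k , Div.m∣m*n m)) pr))
  ... | yes p∣k | no _ | no _ = refl
  ... | no p∤k | yes e | yes e' = refl
  ... | no p∤k | yes e | no ¬e = ⊥-elim (¬e (co⇒gcd k (p * m) (Cop.sym (coprime-* (prime∤⇒coprime pr p∤k) (Cop.sym (gcd⇒co k m e))))))
  ... | no p∤k | no ¬e | yes e' = ⊥-elim (¬e (co⇒gcd k m (λ (a , b) → gcd⇒co k (p * m) e' (a , Div.∣n⇒∣m*n p b))))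
  ... | no p∤k | no _ | no _ = refl
  second : sumN (λ i → ind (both? (suc i))) (p * m) ≡ totient m
  second = trans (cong (sumN (λ i → ind (both? (suc i)))) (*-comm p m)) (trans (sumN-blocks (λ i → ind (both? (suc i))) m p)
    (trans (sumN-cong m (λ j _ → trans (sumN-last (λ i → ind (both? (suc (j * p + i)))) p' (λ i i<p' → low j i i<p')) (top j))) (sym (totient-sumN m))))
    where
    low : ∀ j i → i < p' → ind (both? (suc (j * p + i))) ≡ 0
    low j i i<p' = ind-cong (both? (suc (j * p + i))) no⊥ (λ (d , _) → <⇒≱ (s≤s i<p')
      (Div.∣⇒≤ (Div.∣m+n∣m⇒∣n (subst (p ∣_) (sym (+-suc (j * p) i)) d) (Div.n∣m*n j)))) (λ ())
    top : ∀ j → ind (both? (suc (j * p + p'))) ≡ χ m (suc j)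
    top j = ind-cong (both? (suc (j * p + p'))) (gcd (suc j) m ≟ 1)
      (λ (_ , e) → co⇒gcd (suc j) m (λ {d} (a , b) → gcd⇒co (suc (j * p + p')) m e (subst (d ∣_) (sym eq) (Div.∣m⇒∣m*n p a) , b)))
      (λ e → subst (p ∣_) (sym eq) (Div.n∣m*n (suc j)) , co⇒gcd (suc (j * p + p')) m (subst (λ k → Coprime k m) (sym eq)
           (coprime-* (gcd⇒co (suc j) m e) (prime∤⇒coprime pr p∤m))))
      where
      eq : suc (j * p + p') ≡ suc j * p
      eq = trans (sym (+-suc (j * p) p')) (+-comm (j * p) p)

totient-prime : ∀ {p} → Prime p → totient p ≡ p ∸ 1
totient-prime {p} pr = trans (sym (m+n∸n≡m (totient p) 1)) (cong (_∸ 1) (trans (cong (λ x → totient x + 1) (sym (*-identityʳ p)))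
  (trans (totient-*-∤ {p} {1} pr (λ d → Pr.¬prime[1] (subst Prime (Div.∣1⇒≡1 d) pr))) (*-identityʳ p))))

-- By the recursion φ(n) is a product of factors p and p - 1 with p a prime factor of n.
prime∣totient⇒≤ : ∀ {n r y} → 1 ≤ n → (∀ {p} → Prime p → p ∣ n → p ≤ y) → Prime r → r ∣ totient n → r ≤ y
prime∣totient⇒≤ {n} {r} {y} 1≤n hy pr r∣ with factorise n {{>-nonZero 1≤n}}
... | record { factors = rs ; isFactorisation = refl ; factorsPrime = prs } = go rs prs hy r∣
  where
  go : ∀ rs → All Prime rs → (∀ {p} → Prime p → p ∣ product rs → p ≤ y) → r ∣ totient (product rs) → r ≤ y
  go [] [] hy d = ⊥-elim (Pr.¬prime[1] (subst Prime (Div.∣1⇒≡1 d) pr))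
  go (p ∷ rs) (pp ∷ prs) hy d with p ∣? product rs
  ... | yes p∣ = [ (λ x → ≤-trans (≤-reflexive (prime∣prime pr pp x)) (hy pp (Div.m∣m*n (product rs)))) , (λ x → go rs prs (λ pq h → hy pq (Div.∣n⇒∣m*n p h)) x) ]′
                   (euclidsLemma p (totient (product rs)) pr (subst (r ∣_) (totient-*-∣ p∣) d))
  ... | no p∤ = [ (λ x → ≤-trans (Div.∣⇒≤ {{>-nonZero (m<n⇒0<n∸m (prime≥2 pp))}} x) (≤-trans (m∸n≤m p 1) (hy pp (Div.m∣m*n (product rs)))))
                , (λ x → go rs prs (λ pq h → hy pq (Div.∣n⇒∣m*n p h)) x) ]′
                   (euclidsLemma (p ∸ 1) (totient (product rs)) pr (subst (r ∣_) eq d))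
    where
    T' = totient (product rs)
    eq : totient (p * product rs) ≡ (p ∸ 1) * T'
    eq = trans (sym (m+n∸n≡m _ T')) (trans (cong₂ _∸_ (totient-*-∤ pp p∤) (sym (*-identityˡ T'))) (sym (*-distribʳ-∸ T' p 1)))

-- Write p - 1 = e q and take a unit b modulo n with b ^ e ≢ 1 modulo p. Its order modulo p divides
-- q e but not e, hence is divisible by q, and it divides the order modulo n.
prime∣p-1⇒∣carmichael : ∀ {n p q} → 2 ≤ n → Prime p → p ∣ n → Prime q → q ∣ p ∸ 1 → q ∣ carmichael n
prime∣p-1⇒∣carmichael {n} {p} {q} 2≤n pp p∣n pq (divides e eq) = res
  where
  instance
    n≢0 : NonZero n
    n≢0 = >-nonZero (<⇒≤ 2≤n)
    p≢0 : NonZero p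
    p≢0 = Pr.prime⇒nonZero pp
  2≤p = prime≥2 pp
  1≤p-1 : 1 ≤ p ∸ 1
  1≤p-1 = m<n⇒0<n∸m 2≤p
  1≤e : 1 ≤ e
  1≤e = n≢0⇒n>0 λ { refl → <-irrefl (sym eq) 1≤p-1 }
  -- `nonresidue` tests 1, ..., e + 1, which have to stay below p; this holds because q ≥ 2.
  e<p : e + 1 < p
  e<p = <-≤-trans (+-monoˡ-< 1 (subst (e <_) (sym eq) (m<m*n e q {{>-nonZero 1≤e}} (prime≥2 pq)))) (≤-reflexive (m∸n+n≡m (<⇒≤ 2≤p)))
  res : q ∣ carmichael n
  res with nonresidue pp e 1≤e e<p
  ... | b₀ , 1≤b₀ , b₀<p , ne with lift-unit p n {b₀} (Cop.sym (prime∤⇒coprime pp (Div.>⇒∤ {{>-nonZero 1≤b₀}} b₀<p)))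
  ... | b , eqb , cob = subst (_∣ carmichael n) (*-identityʳ q) (primePower∣carmichael 2≤n 1 pq cob (subst (_∣ ord n b) (sym (*-identityʳ q)) q∣o))
    where
    cobp : Coprime b p
    cobp (x , y) = cob (x , Div.∣-trans y p∣n)
    g∣o : ord p b ∣ ord n b
    g∣o = ord-∣ 2≤p (ord n b) cobp (%-down p∣n (^-ord 2≤n cob))
    g∣qe : ord p b ∣ q * e
    g∣qe = subst (ord p b ∣_) (trans (totient-prime pp) (trans eq (*-comm e q))) (ord-∣ 2≤p (totient p) cobp (euler 2≤p cobp))
    q∣o : q ∣ ord n b
    q∣o with q ∣? ord p b
    ... | yes d = Div.∣-trans d g∣o
    ... | no ¬d with Cop.coprime-divisor (Cop.sym (prime∤⇒coprime pq ¬d)) g∣qe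
    ...   | divides s refl = ⊥-elim (ne (trans (sym (%-^-cong p (s * ord p b) eqb)) (trans (cong (λ x → (b ^ x) % p) (*-comm s (ord p b))) (trans (cong (_% p) (sym (^-*-assoc b (ord p b) s)))
             (trans (%-^-cong p s (^-ord 2≤p cobp)) (cong (_% p) (^-zeroˡ s)))))))

-- The order of 5 modulo powers of 2

-- This is 1 + 5 + ⋯ + 5 ^ (o - 1) = (5 ^ o - 1) / 4.
geom5 : ℕ → ℕ
geom5 zero = 0
geom5 (suc o) = 1 + 5 * geom5 o

5^ : ∀ o → 5 ^ o ≡ 1 + 4 * geom5 o
5^ zero = refl
5^ (suc o) = trans (cong (5 *_) (5^ o)) (lem (geom5 o))
  where
  lem : ∀ g → 5 * (1 + 4 * g) ≡ 1 + 4 * (1 + 5 * g)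
  lem = solve-∀

geom5-+ : ∀ a b → geom5 (a + b) ≡ geom5 a + 5 ^ a * geom5 b
geom5-+ zero b = sym (+-identityʳ (geom5 b))
geom5-+ (suc a) b = trans (cong (λ x → 1 + 5 * x) (geom5-+ a b)) (lem (geom5 a) (5 ^ a) (geom5 b))
  where
  lem : ∀ g f h → 1 + 5 * (g + f * h) ≡ 1 + 5 * g + 5 * f * h
  lem = solve-∀

geom5-parity : ∀ o → ∃ λ y → geom5 o ≡ 2 * y + o
geom5-parity zero = 0 , refl
geom5-parity (suc o) with geom5-parity o
... | y , eq = 5 * y + 2 * o , trans (cong (λ x → 1 + 5 * x) eq) (lem y o)
  where
  lem : ∀ y o → 1 + 5 * (2 * y + o) ≡ 2 * (5 * y + 2 * o) + suc o
  lem = solve-∀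

-- By parity o = 2 o'. With g = geom5 o' one has geom5 o = 2 (1 + 2 g) g, where 1 + 2 g is odd, so
-- every factor 2 of geom5 o is matched by one of o.
2^∣geom5 : ∀ k o → 2 ^ k ∣ geom5 o → 2 ^ k ∣ o
2^∣geom5 zero o _ = Div.1∣ o
2^∣geom5 (suc k) o d with geom5-parity o
... | y , eq with Div.∣m+n∣m⇒∣n (subst (2 ∣_) eq (Div.∣-trans (Div.m∣m*n (2 ^ k)) d)) (Div.m∣m*n y)
... | divides o' refl = subst (2 ^ suc k ∣_) (*-comm 2 o') (Div.*-monoʳ-∣ 2 (2^∣geom5 k o'
      (Cop.coprime-divisor co (Div.*-cancelˡ-∣ 2 (subst (2 ^ suc k ∣_) eq' d)))))
  where
  g = geom5 o'
  co : Coprime (2 ^ k) (1 + 2 * g)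
  co = coprime-^ k (prime∤⇒coprime Pr.prime[2] (λ x → Pr.¬prime[1] (subst Prime (Div.∣1⇒≡1 (Div.∣m+n∣m⇒∣n (subst (2 ∣_) (+-comm 1 (2 * g)) x) (Div.m∣m*n g))) Pr.prime[2])))
  eq' : geom5 (o' * 2) ≡ 2 * ((1 + 2 * g) * g)
  eq' = trans (cong geom5 (lem1 o')) (trans (geom5-+ o' o') (trans (cong (λ x → g + x * g) (5^ o')) (lem g)))
    where
    lem1 : ∀ o → o * 2 ≡ o + o
    lem1 = solve-∀
    lem : ∀ g → g + (1 + 4 * g) * g ≡ 2 * ((1 + 2 * g) * g)
    lem = solve-∀

-- A unit modulo n that is 5 modulo 2 ^ (k + 2) has order o with 2 ^ (k + 2) dividing 5 ^ o - 1 = 4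
-- geom5 o. The factor 4 is why n carries two more powers of 2 than are gained.
2^∣carmichael : ∀ {n k} → 2 ≤ n → 2 ^ (2 + k) ∣ n → 2 ^ k ∣ carmichael n
2^∣carmichael {n} {k} 2≤n P∣n with lift-unit (2 ^ (2 + k)) n {{m^n≢0 2 (2 + k)}} {{>-nonZero (<⇒≤ 2≤n)}} {5} (Cop.sym (coprime-^ (2 + k) (Cop.gcd≡1⇒coprime {2} {5} refl)))
... | b , eqb , cob = primePower∣carmichael {n} {{n≢0}} 2≤n k Pr.prime[2] cob (2^∣geom5 k o (Div.*-cancelˡ-∣ 4 (subst (_∣ 4 * geom5 o) (lem (2 ^ k)) (≡%⇒∣ 1 (4 * geom5 o) P {{P≢0}} eq))))
  where
  n≢0 = >-nonZero (<⇒≤ 2≤n)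
  P = 2 ^ (2 + k)
  P≢0 = m^n≢0 2 (2 + k)
  o = ord n {{n≢0}} b
  lem : ∀ x → 2 * (2 * x) ≡ 4 * x
  lem = solve-∀
  eq : _%_ (1 + 4 * geom5 o) P {{P≢0}} ≡ _%_ 1 P {{P≢0}}
  eq = trans (cong (λ z → _%_ z P {{P≢0}}) (sym (5^ o))) (trans (sym (%-^-cong P {{P≢0}} o eqb)) (%-down {{n≢0}} {{P≢0}} P∣n (^-ord {{n≢0}} 2≤n cob)))

-- 2-dense integers

TwoDense-1 : TwoDense 1
TwoDense-1 a b _ b≤a a<b = ⊥-elim (<⇒≱ (subst (a <_) (*-identityˡ b) a<b) b≤a)

-- Let y = a / b. For y < M a divisor of M serves. For y ≥ M, either y < r ≤ 2 M ≤ 2 y and r itself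
-- serves, or y / r ≥ 1 and r times a divisor of M belonging to y / r serves.
TwoDense-* : ∀ {M r} → TwoDense M → 1 ≤ r → r ≤ 2 * M → TwoDense (M * r)
TwoDense-* {M} {r} td 1≤r r≤2M a b 1≤b b≤a a<Mrb with a <? M * b
... | yes a<Mb = let d , d∣M , p , q = td a b 1≤b b≤a a<Mb in d , Div.∣m⇒∣m*n r d∣M , p , q
... | no a≮Mb with r * b ≤? a
...   | yes rb≤a with td a (r * b) (*-mono-≤ 1≤r 1≤b) rb≤a (subst (a <_) (*-assoc M r b) a<Mrb)
...     | d , d∣M , p , q = d * r , Div.*-monoˡ-∣ r d∣M , subst (a <_) (sym (*-assoc d r b)) p , subst (_≤ 2 * a) (sym (*-assoc d r b)) q
TwoDense-* {M} {r} td 1≤r r≤2M a b 1≤b b≤a a<Mrb | no a≮Mb | no rb≰a = r , Div.n∣m*n M , ≰⇒> rb≰a ,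
  ≤-trans (*-monoˡ-≤ b r≤2M) (≤-trans (≤-reflexive (*-assoc 2 M b)) (*-monoʳ-≤ 2 (≮⇒≥ a≮Mb)))

TwoDense-2^ : ∀ k → TwoDense (2 ^ k)
TwoDense-2^ zero = TwoDense-1
TwoDense-2^ (suc k) = subst TwoDense (*-comm (2 ^ k) 2) (TwoDense-* (TwoDense-2^ k) (s≤s z≤n) (*-monoʳ-≤ 2 (m^n>0 2 k)))

TwoDense-extend : ∀ {M N} → TwoDense M → 1 ≤ N → M ∣ N → (∀ {r} → Prime r → r ∣ N → r ≤ 2 * M) → TwoDense N
TwoDense-extend {M} td 1≤N (divides t refl) h with factorise t {{≢-nonZero λ { refl → <-irrefl refl 1≤N }}}
... | record { factors = rs ; isFactorisation = refl ; factorsPrime = prs } = subst TwoDense (*-comm M (product rs)) (go rs prs M ≤-refl td (λ pr d → h pr (Div.∣m⇒∣m*n M d)))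
  where
  go : ∀ rs → All Prime rs → ∀ M' → M ≤ M' → TwoDense M' → (∀ {r} → Prime r → r ∣ product rs → r ≤ 2 * M) → TwoDense (M' * product rs)
  go [] [] M' _ td' _ = subst TwoDense (sym (*-identityʳ M')) td'
  go (r ∷ rs) (pr ∷ prs) M' M≤M' td' h = subst TwoDense (*-assoc M' r (product rs))
    (go rs prs (M' * r) (≤-trans M≤M' (m≤m*n M' r {{Pr.prime⇒nonZero pr}}))
      (TwoDense-* td' (prime≥1 pr) (≤-trans (h pr (Div.m∣m*n (product rs))) (*-monoʳ-≤ 2 M≤M'))) (λ pr' d → h pr' (Div.∣n⇒∣m*n r d)))

product-∣ : ∀ {k c qs} → 2 ^ k ∣ c → Unique qs → All (λ q → Prime q × 2 < q × q ∣ c) qs → 2 ^ k * product qs ∣ c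
product-∣ {k} {c} {[]} d _ _ = subst (_∣ c) (sym (*-identityʳ (2 ^ k))) d
product-∣ {k} {c} {q ∷ qs} d (nq ∷ u) ((pq , 2<q , q∣c) ∷ al) = subst (_∣ c) (lem q (2 ^ k) (product qs)) (coprime-∣-* (prime∤⇒coprime pq nd) q∣c (product-∣ {k} d u al))
  where
  lem : ∀ q x y → q * (x * y) ≡ x * (q * y)
  lem = solve-∀
  q∤2^ : ∀ k → q ∤ 2 ^ k
  q∤2^ zero x = Pr.¬prime[1] (subst Prime (Div.∣1⇒≡1 x) pq)
  q∤2^ (suc k) x with euclidsLemma 2 (2 ^ k) pq x
  ... | inj₁ y = <⇒≱ 2<q (Div.∣⇒≤ y)
  ... | inj₂ y = q∤2^ k y
  nd : q ∤ 2 ^ k * product qs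
  nd x with euclidsLemma (2 ^ k) (product qs) pq x
  ... | inj₁ y = q∤2^ k y
  ... | inj₂ y = All.lookup nq (factorisationHasAllPrimeFactors pq y (All.map proj₁ al)) refl

Witnessed : ℕ → ℕ → Set
Witnessed n q = ∃ λ p → Prime p × p ∣ n × q ∣ p ∸ 1

dense-criterion : ∀ {n k qs} → 1 ≤ n → 2 ^ (2 + k) ∣ n → Unique qs → All (λ q → Prime q × 2 < q × Witnessed n q) qs →
  TwoDense (2 ^ k * product qs) → (∀ {p} → Prime p → p ∣ n → p ≤ 2 * (2 ^ k * product qs)) →
  TwoDense (totient n) × TwoDense (carmichael n)
dense-criterion {n} {k} {qs} 1≤n P∣n u al td hp =
  TwoDense-extend td (1≤totient 1≤n) (Div.∣-trans M∣λ λ∣φ) smooth ,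
  TwoDense-extend td (n≢0⇒n>0 λ z → <-irrefl (sym (Div.0∣⇒≡0 (subst (_∣ totient n) z λ∣φ))) (1≤totient 1≤n)) M∣λ (λ pr d → smooth pr (Div.∣-trans d λ∣φ))
  where
  2≤n : 2 ≤ n
  2≤n = ≤-trans (≤-trans (s≤s (s≤s z≤n)) (*-monoʳ-≤ 2 (*-monoʳ-≤ 2 (m^n>0 2 k)))) (Div.∣⇒≤ {{>-nonZero 1≤n}} P∣n)
  λ∣φ : carmichael n ∣ totient n
  λ∣φ = carmichael∣totient {{>-nonZero 1≤n}} 2≤n
  M∣λ : 2 ^ k * product qs ∣ carmichael n
  M∣λ = product-∣ {k} (2^∣carmichael {n} {k} 2≤n P∣n) u (All.map (λ (pq , 2<q , p , pp , p∣n , q∣) → pq , 2<q , prime∣p-1⇒∣carmichael 2≤n pp p∣n pq q∣) al)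
  smooth : ∀ {r} → Prime r → r ∣ totient n → r ≤ 2 * (2 ^ k * product qs)
  smooth = prime∣totient⇒≤ 1≤n hp

-- Sums over initial segments, periodic functions and the Chinese remainder theorem

S : ℕ → (ℕ → ℚ) → ℚ
S zero f = 0ℚ
S (suc n) f = f 0 ⊕ S n (f ∘ suc)

Σ-applyUpTo : ∀ (h : ℕ → ℕ) f n → Σ (applyUpTo h n) f ≡ S n (f ∘ h)
Σ-applyUpTo h f zero = refl
Σ-applyUpTo h f (suc n) = cong (f (h 0) ⊕_) (Σ-applyUpTo (h ∘ suc) f n)

Σ-upTo : ∀ f n → Σ (upTo n) f ≡ S n f
Σ-upTo = Σ-applyUpTo id

S-cong : ∀ n {f g} → (∀ i → f i ≡ g i) → S n f ≡ S n g
S-cong zero h = refl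
S-cong (suc n) h = cong₂ _⊕_ (h 0) (S-cong n (λ i → h (suc i)))

S-mono : ∀ n {f g} → (∀ i → f i ⊑ g i) → S n f ⊑ S n g
S-mono zero h = ⊑-refl
S-mono (suc n) h = ⊕-mono-⊑ (h 0) (S-mono n (λ i → h (suc i)))

S-const : ∀ n c → S n (λ _ → c) ≡ ι n ⊗ c
S-const zero c = sym (⊗-zeroˡ c)
S-const (suc n) c = trans (cong₂ _⊕_ (sym (⊗-identityˡ c)) (S-const n c)) (sym (⊗-distribʳ-⊕ c 1ℚ (ι n)))

S-split : ∀ f a b → S (a + b) f ≡ S a f ⊕ S b (λ i → f (a + i))
S-split f zero b = sym (⊕-identityˡ _)
S-split f (suc a) b = trans (cong (f 0 ⊕_) (S-split (f ∘ suc) a b)) (sym (⊕-assoc (f 0) _ _))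

S-blocks : ∀ f m p → S (m * p) f ≡ S m (λ j → S p (λ i → f (j * p + i)))
S-blocks f zero p = refl
S-blocks f (suc m) p = trans (S-split f p (m * p)) (cong (S p f ⊕_) (trans (S-blocks (λ i → f (p + i)) m p)
  (S-cong m (λ j → S-cong p (λ i → cong f (sym (+-assoc p (j * p) i)))))))

S-swap : ∀ m n (f : ℕ → ℕ → ℚ) → S m (λ j → S n (f j)) ≡ S n (λ i → S m (λ j → f j i))
S-swap m n f = trans (sym (Σ-upTo _ m)) (trans (Σ-cong (upTo m) (λ {j} _ → sym (Σ-upTo (f j) n))) (trans (Σ-swap (upTo m) (upTo n) f)
  (trans (Σ-cong (upTo n) (λ {i} _ → Σ-upTo (λ j → f j i) m)) (Σ-upTo _ n))))

S-*ˡ : ∀ n c f → S n (λ i → c ⊗ f i) ≡ c ⊗ S n f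
S-*ˡ n c f = trans (sym (Σ-upTo _ n)) (trans (Σ-*ˡ (upTo n) c f) (cong (c ⊗_) (Σ-upTo f n)))

S-*ʳ : ∀ n c f → S n (λ i → f i ⊗ c) ≡ S n f ⊗ c
S-*ʳ n c f = trans (sym (Σ-upTo _ n)) (trans (Σ-*ʳ (upTo n) c f) (cong (_⊗ c) (Σ-upTo f n)))

Periodic : ℕ → (ℕ → ℚ) → Set
Periodic r f = ∀ n → f (r + n) ≡ f n

periodic-* : ∀ {r f} → Periodic r f → ∀ j n → f (j * r + n) ≡ f n
periodic-* per zero n = refl
periodic-* {r} {f} per (suc j) n = trans (cong f (+-assoc r (j * r) n)) (trans (per (j * r + n)) (periodic-* per j n))

periodic-% : ∀ {r f} .{{_ : NonZero r}} → Periodic r f → ∀ n → f (n % r) ≡ f n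
periodic-% {r} {f} per n = sym (trans (cong f (trans (DivMod.m≡m%n+[m/n]*n n r) (+-comm (n % r) _))) (periodic-* per (n / r) (n % r)))

%-+-cancelˡ : ∀ i {x y} b .{{_ : NonZero b}} → (i + x) % b ≡ (i + y) % b → x % b ≡ y % b
%-+-cancelˡ i {x} {y} b eq with ≤-total x y
... | inj₁ x≤y with m≤n⇒∃[o]m+o≡n x≤y
...   | t , refl = sym (DivMod.%-remove-+ʳ x (≡%⇒∣ (i + x) t b (trans (cong (_% b) (+-assoc i x t)) (sym eq))))
%-+-cancelˡ i {x} {y} b eq | inj₂ y≤x with m≤n⇒∃[o]m+o≡n y≤x
...   | t , refl = DivMod.%-remove-+ʳ y (≡%⇒∣ (i + y) t b (trans (cong (_% b) (+-assoc i y t)) eq))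

-- The map j ↦ j a + i permutes the residue classes modulo b.
S-affine : ∀ {a b g} .{{_ : NonZero b}} → Coprime a b → Periodic b g → ∀ i → S b (λ j → g (j * a + i)) ≡ S b g
S-affine {a} {b} {g} co per i = trans (sym (Σ-upTo _ b)) (trans (Σ-cong (upTo b) (λ {j} _ → trans (cong g (trans (cong (_+ i) (*-comm j a)) (+-comm (a * j) i))) (sym (periodic-% per (i + a * j)))))
  (trans (sym (Σ-map (upTo b) f g)) (trans (sym (Σ-↭ g perm)) (Σ-upTo g b))))
  where
  f : ℕ → ℕ
  f j = (i + a * j) % b
  inj : ∀ {x y} → x ∈ upTo b → y ∈ upTo b → f x ≡ f y → x ≡ y
  inj x∈ y∈ eq = trans (sym (DivMod.m<n⇒m%n≡m (Mem.∈-upTo⁻ x∈))) (trans (%-*-cancel a b co (%-+-cancelˡ i b eq)) (DivMod.m<n⇒m%n≡m (Mem.∈-upTo⁻ y∈)))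
  sub : ∀ {z} → z ∈ map f (upTo b) → z ∈ upTo b
  sub z∈ with Mem.∈-map⁻ f z∈
  ... | j , _ , refl = Mem.∈-upTo⁺ (DivMod.m%n<n (i + a * j) b)
  perm : upTo b ↭ map f (upTo b)
  perm = unique-⊆-length-↭ (unique-map-∈ f inj (Uniq.upTo⁺ b)) sub (≤-reflexive (sym (Listₚ.length-map f (upTo b))))

-- Writing n = j a + i with i < a, f depends only on i, and for fixed i the argument of g runs
-- through a full period.
S-crt : ∀ {a b f g} .{{_ : NonZero b}} → Coprime a b → Periodic a f → Periodic b g → S (a * b) (λ n → f n ⊗ g n) ≡ S a f ⊗ S b g
S-crt {a} {b} {f} {g} co pf pg = trans (cong (λ x → S x (λ n → f n ⊗ g n)) (*-comm a b)) (trans (S-blocks _ b a)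
  (trans (S-swap b a (λ j i → f (j * a + i) ⊗ g (j * a + i)))
  (trans (S-cong a (λ i → trans (S-cong b (λ j → cong (_⊗ g (j * a + i)) (periodic-* pf j i))) (trans (S-*ˡ b (f i) (λ j → g (j * a + i))) (cong (f i ⊗_) (S-affine co pg i)))))
   (S-*ʳ a (S b g) f))))

-- Complete periods contribute at most their length times β, the incomplete one at most r.
S-partial : ∀ {r u β} .{{_ : NonZero r}} → Periodic r u → (∀ n → u n ⊑ 1ℚ) → 0ℚ ⊑ β → S r u ⊑ ι r ⊗ β → ∀ N → S N u ⊑ ι N ⊗ β ⊕ ι r
S-partial {r} {u} {β} per u≤1 0≤β h N = begin
  S N u ≡⟨ cong (λ x → S x u) N≡ ⟩
  S (k * r + s) u ≡⟨ S-split u (k * r) s ⟩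
  S (k * r) u ⊕ S s (λ i → u (k * r + i)) ≤⟨ ⊕-mono-⊑ first second ⟩
  ι N ⊗ β ⊕ ι r ∎
  where
  open ℚₚ.≤-Reasoning
  k = N / r
  s = N % r
  N≡ : N ≡ k * r + s
  N≡ = trans (DivMod.m≡m%n+[m/n]*n N r) (+-comm s (k * r))
  first : S (k * r) u ⊑ ι N ⊗ β
  first = begin
    S (k * r) u ≡⟨ S-blocks u k r ⟩
    S k (λ j → S r (λ i → u (j * r + i))) ≡⟨ S-cong k (λ j → S-cong r (λ i → periodic-* per j i)) ⟩
    S k (λ _ → S r u) ≤⟨ S-mono k (λ _ → h) ⟩
    S k (λ _ → ι r ⊗ β) ≡⟨ S-const k _ ⟩
    ι k ⊗ (ι r ⊗ β) ≡⟨ sym (⊗-assoc (ι k) (ι r) β) ⟩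
    ι k ⊗ ι r ⊗ β ≡⟨ cong (_⊗ β) (sym (ι-* k r)) ⟩
    ι (k * r) ⊗ β ≤⟨ ⊗-monoʳ 0≤β (ι-mono (DivMod.m/n*n≤m N r)) ⟩
    ι N ⊗ β ∎
  second : S s (λ i → u (k * r + i)) ⊑ ι r
  second = begin
    S s (λ i → u (k * r + i)) ≤⟨ S-mono s (λ i → u≤1 _) ⟩
    S s (λ _ → 1ℚ) ≡⟨ S-const s 1ℚ ⟩
    ι s ⊗ 1ℚ ≡⟨ ⊗-identityʳ (ι s) ⟩
    ι s ≤⟨ ι-mono (DivMod.m%n≤n N r) ⟩
    ι r ∎

-- Finite products, and products over the primes dividing d

ΠQ : List ℕ → (ℕ → ℚ) → ℚ
ΠQ [] f = 1ℚ
ΠQ (x ∷ xs) f = f x ⊗ ΠQ xs f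

ΠN : List ℕ → (ℕ → ℕ) → ℕ
ΠN [] f = 1
ΠN (x ∷ xs) f = f x * ΠN xs f

ΠQ-cong : ∀ xs {f g} → (∀ {x} → x ∈ xs → f x ≡ g x) → ΠQ xs f ≡ ΠQ xs g
ΠQ-cong [] h = refl
ΠQ-cong (x ∷ xs) h = cong₂ _⊗_ (h (here refl)) (ΠQ-cong xs (λ m → h (there m)))

ΠN-cong : ∀ xs {f g} → (∀ {x} → x ∈ xs → f x ≡ g x) → ΠN xs f ≡ ΠN xs g
ΠN-cong [] h = refl
ΠN-cong (x ∷ xs) h = cong₂ _*_ (h (here refl)) (ΠN-cong xs (λ m → h (there m)))

ΠQ-* : ∀ xs f g → ΠQ xs f ⊗ ΠQ xs g ≡ ΠQ xs (λ x → f x ⊗ g x)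
ΠQ-* [] f g = ⊗-identityˡ 1ℚ
ΠQ-* (x ∷ xs) f g = trans (solve 4 (λ a b c d → (a :* b) :* (c :* d) := (a :* c) :* (b :* d)) refl (f x) (ΠQ xs f) (g x) (ΠQ xs g)) (cong (f x ⊗ g x ⊗_) (ΠQ-* xs f g))

ΠQ-nonneg : ∀ xs {f} → (∀ {x} → x ∈ xs → 0ℚ ⊑ f x) → 0ℚ ⊑ ΠQ xs f
ΠQ-nonneg [] h = 0≤1
ΠQ-nonneg (x ∷ xs) h = ⊗-nonneg (h (here refl)) (ΠQ-nonneg xs (λ m → h (there m)))

ΠQ-mono : ∀ xs {f g} → (∀ {x} → x ∈ xs → 0ℚ ⊑ f x) → (∀ {x} → x ∈ xs → f x ⊑ g x) → ΠQ xs f ⊑ ΠQ xs g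
ΠQ-mono [] h0 h = ⊑-refl
ΠQ-mono (x ∷ xs) h0 h = ⊗-mono (h0 (here refl)) (ΠQ-nonneg xs (λ m → ⊑-trans (h0 (there m)) (h (there m)))) (h (here refl)) (ΠQ-mono xs (λ m → h0 (there m)) (λ m → h (there m)))

ΠQ-zero : ∀ {xs x f} → x ∈ xs → f x ≡ 0ℚ → ΠQ xs f ≡ 0ℚ
ΠQ-zero {_ ∷ xs} {f = f} (here refl) e = trans (cong (_⊗ ΠQ xs f) e) (⊗-zeroˡ (ΠQ xs f))
ΠQ-zero {y ∷ xs} {f = f} (there m) e = trans (cong (f y ⊗_) (ΠQ-zero m e)) (⊗-zeroʳ (f y))

ΠQ-ι : ∀ xs f → ΠQ xs (ι ∘ f) ≡ ι (ΠN xs f)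
ΠQ-ι [] f = sym ι-1
ΠQ-ι (x ∷ xs) f = trans (cong (ι (f x) ⊗_) (ΠQ-ι xs f)) (sym (ι-* (f x) (ΠN xs f)))

ΠN-pos : ∀ xs {f} → (∀ {x} → x ∈ xs → 1 ≤ f x) → 1 ≤ ΠN xs f
ΠN-pos [] h = s≤s z≤n
ΠN-pos (x ∷ xs) h = *-mono-≤ (h (here refl)) (ΠN-pos xs (λ m → h (there m)))

ΠN-mono : ∀ xs {f g} → (∀ {x} → x ∈ xs → f x ≤ g x) → ΠN xs f ≤ ΠN xs g
ΠN-mono [] h = ≤-refl
ΠN-mono (x ∷ xs) h = *-mono-≤ (h (here refl)) (ΠN-mono xs (λ m → h (there m)))

ΠN-* : ∀ xs f g → ΠN xs (λ x → f x * g x) ≡ ΠN xs f * ΠN xs g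
ΠN-* [] f g = refl
ΠN-* (x ∷ xs) f g = trans (cong (f x * g x *_) (ΠN-* xs f g)) (lem (f x) (g x) (ΠN xs f) (ΠN xs g))
  where
  lem : ∀ a b c d → a * b * (c * d) ≡ a * c * (b * d)
  lem = solve-∀

∣ΠQ∣≤1 : ∀ xs {f} → (∀ {x} → x ∈ xs → ℚ.∣ f x ∣ ⊑ 1ℚ) → ℚ.∣ ΠQ xs f ∣ ⊑ 1ℚ
∣ΠQ∣≤1 [] h = ⊑-refl
∣ΠQ∣≤1 (x ∷ xs) {f} h = subst (_⊑ 1ℚ) (sym (ℚₚ.∣p*q∣≡∣p∣*∣q∣ (f x) (ΠQ xs f)))
  (⊗-mono (ℚₚ.0≤∣p∣ (f x)) 0≤1 (h (here refl)) (∣ΠQ∣≤1 xs (λ m → h (there m))))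

p≤∣p∣ : ∀ p → p ⊑ ℚ.∣ p ∣
p≤∣p∣ p with ⊑-total 0ℚ p
... | inj₁ h = ⊑-reflexive (sym (ℚₚ.0≤p⇒∣p∣≡p h))
... | inj₂ h = ⊑-trans h (ℚₚ.0≤∣p∣ p)

0≤square : ∀ p → 0ℚ ⊑ p ⊗ p
0≤square p with ⊑-total 0ℚ p
... | inj₁ h = ⊗-nonneg h h
... | inj₂ h = subst (_⊑ p ⊗ p) (⊗-zeroʳ p) (ℚₚ.*-monoˡ-≤-nonPos p {{ℚ.nonPositive h}} h)

pick : {X : Set} → X → ℕ → ℕ → X → X
pick one d p x = if does (p ∣? d) then x else one

Πpick : List ℕ → (ℕ → ℚ) → ℕ → ℚ
Πpick ps f d = ΠQ ps (λ p → pick 1ℚ d p (f p))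

-- For distinct primes ps: d is squarefree and all its prime factors are in ps. In this form d is
-- itself a product over ps, like the functions attached to it.
SqIn : List ℕ → ℕ → Set
SqIn ps d = ΠN ps (λ p → pick 1 d p p) ≡ d

coprime-ΠN : ∀ xs {f a} → (∀ {x} → x ∈ xs → Coprime a (f x)) → Coprime a (ΠN xs f)
coprime-ΠN [] h = Cop.sym (Cop.1-coprimeTo _)
coprime-ΠN (x ∷ xs) h = Cop.sym (coprime-* (Cop.sym (h (here refl))) (Cop.sym (coprime-ΠN xs (λ m → h (there m)))))

primes-coprime : ∀ {p q} → Prime p → Prime q → p ≢ q → Coprime p q
primes-coprime pp pq ne = prime∤⇒coprime pp (λ d → ne (prime∣prime pp pq d))

-- Functions with pairwise coprime periods are independent over the product of the periods. The
-- local period is 1 at primes that do not occur.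
S-ΠQ : ∀ ps (ρ : ℕ → ℕ) (h : ℕ → ℕ → ℚ) → Unique ps → (∀ {p} → p ∈ ps → Prime p) → (∀ {p} → p ∈ ps → ρ p ≡ 1 ⊎ ρ p ≡ p) →
  (∀ {p} → p ∈ ps → Periodic (ρ p) (h p)) →
  Periodic (ΠN ps ρ) (λ n → ΠQ ps (λ p → h p n)) × S (ΠN ps ρ) (λ n → ΠQ ps (λ p → h p n)) ≡ ΠQ ps (λ p → S (ρ p) (h p))
S-ΠQ [] ρ h u pr hρ per = (λ n → refl) , ⊕-identityʳ 1ℚ
S-ΠQ (p ∷ ps) ρ h (np ∷ u) pr hρ per with S-ΠQ ps ρ h u (λ m → pr (there m)) (λ m → hρ (there m)) (λ m → per (there m))
... | perT , eqT = perA , trans (S-crt {ρ p} {ΠN ps ρ} {{>-nonZero (ΠN-pos ps (λ m → ρ≥1 (there m)))}} co (per (here refl)) perT) (cong (S (ρ p) (h p) ⊗_) eqT)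
  where
  ρ≥1 : ∀ {q} → q ∈ p ∷ ps → 1 ≤ ρ q
  ρ≥1 m with hρ m
  ... | inj₁ e = ≤-reflexive (sym e)
  ... | inj₂ e = subst (1 ≤_) (sym e) (prime≥1 (pr m))
  co : Coprime (ρ p) (ΠN ps ρ)
  co = coprime-ΠN ps λ {x} m → pair m
    where
    pair : ∀ {x} → x ∈ ps → Coprime (ρ p) (ρ x)
    pair {x} m with hρ (here refl) | hρ (there m)
    ... | inj₁ e | _ = subst (λ z → Coprime z (ρ x)) (sym e) (Cop.1-coprimeTo _)
    ... | inj₂ _ | inj₁ e = subst (Coprime (ρ p)) (sym e) (Cop.sym (Cop.1-coprimeTo _))
    ... | inj₂ e | inj₂ e' = subst₂ Coprime (sym e) (sym e') (primes-coprime (pr (here refl)) (pr (there m)) (All.lookup np m))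
  perA : Periodic (ρ p * ΠN ps ρ) (λ n → h p n ⊗ ΠQ ps (λ q → h q n))
  perA n = cong₂ _⊗_ (trans (cong (λ z → h p (z + n)) (*-comm (ρ p) (ΠN ps ρ))) (periodic-* {ρ p} {h p} (per (here refl)) (ΠN ps ρ) n)) (periodic-* perT (ρ p) n)

-- A sieve by second moments

when : {P : Set} → Dec P → ℚ → ℚ
when (yes _) x = x
when (no _) x = 0ℚ

Σ-delta : ∀ {D : List ℕ} d x → Unique D → 0ℚ ⊑ x → Σ D (λ d' → when (d ≟ d') x) ⊑ x
Σ-delta {[]} d x u 0≤x = 0≤x
Σ-delta {d' ∷ D} d x (nd ∷ u) 0≤x with d ≟ d'
... | yes refl = ⊑-reflexive (trans (cong (x ⊕_) (trans (Σ-cong D zero') (trans (Σ-const D 0ℚ) (⊗-zeroʳ (ι (length D)))))) (⊕-identityʳ x))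
  where
  zero' : ∀ {e} → e ∈ D → when (d ≟ e) x ≡ 0ℚ
  zero' {e} m with d ≟ e
  ... | yes eq = ⊥-elim (All.lookup nd m eq)
  ... | no _ = refl
... | no _ = subst (_⊑ x) (sym (⊕-identityˡ _)) (Σ-delta d x u 0≤x)

-- The functions Φ d are orthogonal over a common period, and on the sifted set Φ d equals its weight;
-- hence the second moment of Σ Φ d bounds the size of the sifted set.
module _ (Ps : List ℕ) (uP : Unique Ps) (prime : ∀ {p} → p ∈ Ps → Prime p) (a : ℕ → ℕ → ℚ) (β : ℕ → ℚ)
         (per : ∀ {p} → p ∈ Ps → Periodic p (a p)) (bdd : ∀ {p} → p ∈ Ps → ∀ n → ℚ.∣ a p n ∣ ⊑ 1ℚ)
         (mean : ∀ {p} → p ∈ Ps → S p (a p) ≡ 0ℚ) (0≤β : ∀ {p} → p ∈ Ps → 0ℚ ⊑ β p)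
         (var : ∀ {p} → p ∈ Ps → S p (λ n → a p n ⊗ a p n) ⊑ ι p ⊗ β p) where

  Φ : ℕ → ℕ → ℚ
  Φ d n = ΠQ Ps (λ p → pick 1ℚ d p (a p n))

  private
    βs : ℕ → ℚ
    βs = Πpick Ps β

  0≤βs : ∀ d → 0ℚ ⊑ βs d
  0≤βs d = ΠQ-nonneg Ps nn
    where
    nn : ∀ {p} → p ∈ Ps → 0ℚ ⊑ pick 1ℚ d p (β p)
    nn {p} m with does (p ∣? d)
    ... | true = 0≤β m
    ... | false = 0≤1

  private
    differ : ∀ d d' ps → (∃ λ p → p ∈ ps × does (p ∣? d) ≢ does (p ∣? d')) ⊎ (∀ {p} → p ∈ ps → does (p ∣? d) ≡ does (p ∣? d'))
    differ d d' [] = inj₂ λ ()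
    differ d d' (p ∷ ps) with does (p ∣? d) Boolₚ.≟ does (p ∣? d') | differ d d' ps
    ... | no ne | _ = inj₁ (p , here refl , ne)
    ... | yes _ | inj₁ (q , m , ne) = inj₁ (q , there m , ne)
    ... | yes e | inj₂ f = inj₂ λ { (here refl) → e ; (there m) → f m }

  correlation : ∀ {d d' Q} N → SqIn Ps d → SqIn Ps d' → d ≤ Q → d' ≤ Q →
    S N (λ n → Φ d n ⊗ Φ d' n) ⊑ when (d ≟ d') (ι N ⊗ βs d) ⊕ ι (Q * Q)
  correlation {d} {d'} {Q} N sd sd' d≤Q d'≤Q = ⊑-trans (⊑-reflexive (S-cong N (λ n → ΠQ-* Ps _ _))) bound
    where
    h : ℕ → ℕ → ℚ
    h p n = pick 1ℚ d p (a p n) ⊗ pick 1ℚ d' p (a p n)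
    -- The product r of these local periods is the least common multiple of d and d', hence at most
    -- Q².
    ρ : ℕ → ℕ
    ρ p = pick (pick 1 d' p p) d p p
    ρ-or : ∀ {p} → p ∈ Ps → ρ p ≡ 1 ⊎ ρ p ≡ p
    ρ-or {p} _ with does (p ∣? d) | does (p ∣? d')
    ... | true | _ = inj₂ refl
    ... | false | true = inj₂ refl
    ... | false | false = inj₁ refl
    hper : ∀ {p} → p ∈ Ps → Periodic (ρ p) (h p)
    hper {p} m n with does (p ∣? d) | does (p ∣? d')
    ... | true | true = cong₂ _⊗_ (per m n) (per m n)
    ... | true | false = cong (_⊗ 1ℚ) (per m n)
    ... | false | true = cong (1ℚ ⊗_) (per m n)
    ... | false | false = refl
    r = ΠN Ps ρ
    ρ≤ : ∀ {p} → p ∈ Ps → ρ p ≤ pick 1 d p p * pick 1 d' p p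
    ρ≤ {p} m with does (p ∣? d) | does (p ∣? d')
    ... | true | true = m≤m*n p p {{Pr.prime⇒nonZero (prime m)}}
    ... | true | false = ≤-reflexive (sym (*-identityʳ p))
    ... | false | true = ≤-reflexive (sym (+-identityʳ p))
    ... | false | false = ≤-refl
    r≤ : r ≤ Q * Q
    r≤ = ≤-trans (ΠN-mono Ps ρ≤) (≤-trans (≤-reflexive (trans (ΠN-* Ps _ _) (cong₂ _*_ sd sd'))) (*-mono-≤ d≤Q d'≤Q))
    r≥1 : 1 ≤ r
    r≥1 = ΠN-pos Ps ρ≥1
      where
      ρ≥1 : ∀ {q} → q ∈ Ps → 1 ≤ ρ q
      ρ≥1 m with ρ-or m
      ... | inj₁ e = ≤-reflexive (sym e)
      ... | inj₂ e = subst (1 ≤_) (sym e) (prime≥1 (prime m))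
    u : ℕ → ℚ
    u n = ΠQ Ps (λ p → h p n)
    u≤1 : ∀ n → u n ⊑ 1ℚ
    u≤1 n = ⊑-trans (p≤∣p∣ (u n)) (∣ΠQ∣≤1 Ps hb)
      where
      hb : ∀ {p} → p ∈ Ps → ℚ.∣ h p n ∣ ⊑ 1ℚ
      hb {p} m with does (p ∣? d) | does (p ∣? d')
      ... | true | true = subst (_⊑ 1ℚ) (sym (ℚₚ.∣p*q∣≡∣p∣*∣q∣ (a p n) (a p n))) (⊗-mono (ℚₚ.0≤∣p∣ (a p n)) 0≤1 (bdd m n) (bdd m n))
      ... | true | false = subst (λ z → ℚ.∣ z ∣ ⊑ 1ℚ) (sym (⊗-identityʳ (a p n))) (bdd m n)
      ... | false | true = subst (λ z → ℚ.∣ z ∣ ⊑ 1ℚ) (sym (⊗-identityˡ (a p n))) (bdd m n)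
      ... | false | false = ⊑-refl
    all = S-ΠQ Ps ρ h uP prime ρ-or hper
    fin : ∀ {B} → 0ℚ ⊑ B → ΠQ Ps (λ p → S (ρ p) (h p)) ⊑ ι r ⊗ B → S N u ⊑ ι N ⊗ B ⊕ ι (Q * Q)
    fin {B} 0≤B le = ⊑-trans (S-partial {r} {u} {{>-nonZero r≥1}} (proj₁ all) u≤1 0≤B (subst (_⊑ ι r ⊗ B) (sym (proj₂ all)) le) N)
       (⊕-monoʳ-⊑ (ι N ⊗ B) (ι-mono r≤))
    bound : S N u ⊑ when (d ≟ d') (ι N ⊗ βs d) ⊕ ι (Q * Q)
    bound with d ≟ d'
    ... | yes refl = fin (0≤βs d) (subst (ΠQ Ps (λ p → S (ρ p) (h p)) ⊑_) (trans (sym (ΠQ-* Ps (ι ∘ ρ) (λ p → pick 1ℚ d p (β p)))) (cong (_⊗ βs d) (ΠQ-ι Ps ρ)))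
                       (ΠQ-mono Ps nn le))
      where
      nn : ∀ {p} → p ∈ Ps → 0ℚ ⊑ S (ρ p) (h p)
      nn {p} m = subst (_⊑ S (ρ p) (h p)) (trans (S-const (ρ p) 0ℚ) (⊗-zeroʳ (ι (ρ p)))) (S-mono (ρ p) (λ i → 0≤square (pick 1ℚ d p (a p i))))
      le : ∀ {p} → p ∈ Ps → S (ρ p) (h p) ⊑ ι (ρ p) ⊗ pick 1ℚ d p (β p)
      le {p} m with does (p ∣? d)
      ... | true = var m
      ... | false = ⊑-refl
    ... | no d≢d' with differ d d' Ps
    ...   | inj₂ same = ⊥-elim (d≢d' (trans (sym sd) (trans (ΠN-cong Ps (λ {p} m → cong (λ b → if b then p else 1) (same m))) sd')))
    -- A prime dividing exactly one of d, d' leaves a single factor `a p`, whose sum over a period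
    -- is 0.
    ...   | inj₁ (p , m , ne) = ⊑-trans (fin {0ℚ} ⊑-refl (⊑-reflexive (trans (ΠQ-zero m z) (sym (⊗-zeroʳ (ι r)))))) (⊑-reflexive (cong (_⊕ ι (Q * Q)) (⊗-zeroʳ (ι N))))
      where
      z : S (ρ p) (h p) ≡ 0ℚ
      z with does (p ∣? d) | does (p ∣? d')
      ... | true | true = ⊥-elim (ne refl)
      ... | true | false = trans (S-cong p (λ i → ⊗-identityʳ (a p i))) (mean m)
      ... | false | true = trans (S-cong p (λ i → ⊗-identityˡ (a p i))) (mean m)
      ... | false | false = ⊥-elim (ne refl)

  -- In the expanded second moment the diagonal gives N Σ βs. Each of at most Q² pairs also has an
  -- error of at most Q² from the incomplete period, which makes Q⁴.
  sieve : ∀ {Q N} (D xs : List ℕ) → Unique D → length D ≤ Q → (∀ {d} → d ∈ D → SqIn Ps d × d ≤ Q) →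
    Unique xs → (∀ {n} → n ∈ xs → n < N × (∀ {p} → p ∈ Ps → a p n ≡ β p)) →
    ι (length xs) ⊗ (Σ D βs ⊗ Σ D βs) ⊑ ι N ⊗ Σ D βs ⊕ ι (Q * Q * (Q * Q))
  sieve {Q} {N} D xs uD lenD hD uxs hxs = begin
    ι (length xs) ⊗ (A ⊗ A) ≡⟨ sym (Σ-const xs (A ⊗ A)) ⟩
    Σ xs (λ _ → A ⊗ A) ≡⟨ Σ-cong xs (λ m → sym (cong₂ _⊗_ (F≡A m) (F≡A m))) ⟩
    Σ xs (λ n → F n ⊗ F n) ≤⟨ Σ-⊆ uxs (λ m → Mem.∈-upTo⁺ (proj₁ (hxs m))) (λ n → 0≤square (F n)) ⟩
    Σ (upTo N) (λ n → F n ⊗ F n) ≡⟨ Σ-cong (upTo N) (λ {n} _ → expand n) ⟩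
    Σ (upTo N) (λ n → Σ D (λ d → Σ D (λ d' → Φ d n ⊗ Φ d' n))) ≡⟨ Σ-swap (upTo N) D _ ⟩
    Σ D (λ d → Σ (upTo N) (λ n → Σ D (λ d' → Φ d n ⊗ Φ d' n))) ≡⟨ Σ-cong D (λ _ → trans (Σ-swap (upTo N) D _) (Σ-cong D (λ _ → Σ-upTo _ N))) ⟩
    Σ D (λ d → Σ D (λ d' → S N (λ n → Φ d n ⊗ Φ d' n))) ≤⟨ Σ-mono D (λ m → row m) ⟩
    Σ D (λ d → ι N ⊗ βs d ⊕ ι Q ⊗ ι (Q * Q)) ≡⟨ Σ-+ D _ _ ⟩
    Σ D (λ d → ι N ⊗ βs d) ⊕ Σ D (λ _ → ι Q ⊗ ι (Q * Q)) ≡⟨ cong₂ _⊕_ (Σ-*ˡ D (ι N) βs) (Σ-const D _) ⟩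
    ι N ⊗ A ⊕ ι (length D) ⊗ (ι Q ⊗ ι (Q * Q)) ≤⟨ ⊕-monoʳ-⊑ (ι N ⊗ A) (⊗-monoʳ (⊗-nonneg (0≤ι Q) (0≤ι (Q * Q))) (ι-mono lenD)) ⟩
    ι N ⊗ A ⊕ ι Q ⊗ (ι Q ⊗ ι (Q * Q)) ≡⟨ cong (ι N ⊗ A ⊕_) (trans (sym (⊗-assoc (ι Q) (ι Q) (ι (Q * Q)))) (trans (cong (_⊗ ι (Q * Q)) (sym (ι-* Q Q))) (sym (ι-* (Q * Q) (Q * Q))))) ⟩
    ι N ⊗ A ⊕ ι (Q * Q * (Q * Q)) ∎
    where
    open ℚₚ.≤-Reasoning
    A = Σ D βs
    F : ℕ → ℚ
    F n = Σ D (λ d → Φ d n)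
    F≡A : ∀ {n} → n ∈ xs → F n ≡ A
    F≡A {n} m = Σ-cong D (λ {d} _ → ΠQ-cong Ps (λ {p} mp → cong (pick 1ℚ d p) (proj₂ (hxs m) mp)))
    expand : ∀ n → F n ⊗ F n ≡ Σ D (λ d → Σ D (λ d' → Φ d n ⊗ Φ d' n))
    expand n = trans (sym (Σ-*ʳ D (F n) (λ d → Φ d n))) (Σ-cong D (λ {d} _ → sym (Σ-*ˡ D (Φ d n) (λ d' → Φ d' n))))
    row : ∀ {d} → d ∈ D → Σ D (λ d' → S N (λ n → Φ d n ⊗ Φ d' n)) ⊑ ι N ⊗ βs d ⊕ ι Q ⊗ ι (Q * Q)
    row {d} m = begin
      Σ D (λ d' → S N (λ n → Φ d n ⊗ Φ d' n)) ≤⟨ Σ-mono D (λ m' → correlation N (proj₁ (hD m)) (proj₁ (hD m')) (proj₂ (hD m)) (proj₂ (hD m'))) ⟩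
      Σ D (λ d' → when (d ≟ d') (ι N ⊗ βs d) ⊕ ι (Q * Q)) ≡⟨ Σ-+ D _ _ ⟩
      Σ D (λ d' → when (d ≟ d') (ι N ⊗ βs d)) ⊕ Σ D (λ _ → ι (Q * Q)) ≤⟨ ⊕-mono-⊑ (Σ-delta d _ uD (⊗-nonneg (0≤ι N) (0≤βs d)))
          (⊑-trans (⊑-reflexive (Σ-const D _)) (⊗-monoʳ (0≤ι (Q * Q)) (ι-mono lenD))) ⟩
      ι N ⊗ βs d ⊕ ι Q ⊗ ι (Q * Q) ∎

-- Squarefree numbers and harmonic sums

primesTo : ℕ → List ℕ
primesTo n = filter prime? (range1 n)

∈-primesTo⁺ : ∀ {p n} → Prime p → p ≤ n → p ∈ primesTo n
∈-primesTo⁺ pr p≤n = Mem.∈-filter⁺ prime? (∈-range1⁺ (prime≥1 pr) p≤n) pr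

∈-primesTo⁻ : ∀ {p n} → p ∈ primesTo n → Prime p × p ≤ n
∈-primesTo⁻ {p} {n} m with Mem.∈-filter⁻ prime? {xs = range1 n} m
... | r , pr = pr , proj₂ (∈-range1⁻ r)

unique-primesTo : ∀ n → Unique (primesTo n)
unique-primesTo n = Uniq.filter⁺ prime? (unique-range1 n)

product-filter : ∀ ps d → product (filter (_∣? d) ps) ≡ ΠN ps (λ p → pick 1 d p p)
product-filter [] d = refl
product-filter (p ∷ ps) d with does (p ∣? d)
... | true = cong (p *_) (product-filter ps d)
... | false = trans (product-filter ps d) (sym (+-identityʳ _))

unique-≈-↭ : ∀ {xs ys : List ℕ} → Unique xs → Unique ys → (∀ {z} → z ∈ xs → z ∈ ys) → (∀ {z} → z ∈ ys → z ∈ xs) → ys ↭ xs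
unique-≈-↭ ux uy s t = unique-⊆-length-↭ ux s (unique-⊆-length uy t)

sq-product : ∀ {ps T} → Unique ps → (∀ {p} → p ∈ ps → Prime p) → Unique T → (∀ {p} → p ∈ T → p ∈ ps) → SqIn ps (product T)
sq-product {ps} {T} ups pr uT sub = trans (sym (product-filter ps (product T))) (ListAct.product-↭ (unique-≈-↭ uT (Uniq.filter⁺ (_∣? product T) ups) to from))
  where
  prT : All Prime T
  prT = All.tabulate (λ m → pr (sub m))
  to : ∀ {z} → z ∈ T → z ∈ filter (_∣? product T) ps
  to m = Mem.∈-filter⁺ (_∣? product T) (sub m) (ListAct.∈⇒∣product m)
  from : ∀ {z} → z ∈ filter (_∣? product T) ps → z ∈ T
  from m with Mem.∈-filter⁻ (_∣? product T) {xs = ps} m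
  ... | a , b = factorisationHasAllPrimeFactors (pr a) b prT

sq-factors : ∀ {ps d} → Unique ps → SqIn ps d → ∃ λ T → Unique T × (∀ {p} → p ∈ T → p ∈ ps × p ∣ d) × product T ≡ d
sq-factors {ps} {d} u sq = filter (_∣? d) ps , Uniq.filter⁺ (_∣? d) u , (λ m → Mem.∈-filter⁻ (_∣? d) {xs = ps} m) , trans (product-filter ps d) sq

sq-* : ∀ {ps p e} → Unique ps → (∀ {p} → p ∈ ps → Prime p) → p ∈ ps → p ∤ e → SqIn ps e → SqIn ps (p * e)
sq-* {ps} {p} {e} u pr p∈ p∤e sq with sq-factors u sq
... | T , uT , hT , refl = sq-product {T = p ∷ T} u pr (All.tabulate (λ m → λ { refl → p∤e (ListAct.∈⇒∣product m) }) ∷ uT) (λ { (here refl) → p∈ ; (there m) → proj₁ (hT m) })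

-- T collects the primes of odd multiplicity: a second occurrence removes the prime from T and moves
-- the pair into the square.
product-square : ∀ rs → All Prime rs → ∃₂ λ T k → Unique T × (∀ {p} → p ∈ T → p ∈ rs) × product rs ≡ product T * (k * k)
product-square [] [] = [] , 1 , [] , (λ ()) , refl
product-square (r ∷ rs) (pr ∷ prs) with product-square rs prs
... | T , k , uT , sub , eq with Any.any? (r ≟_) T
...   | no r∉T = r ∷ T , k , All.tabulate (λ m e → r∉T (subst (_∈ T) (sym e) m)) ∷ uT , (λ { (here e) → here e ; (there m) → there (sub m) }) ,
                 trans (cong (r *_) eq) (sym (*-assoc r (product T) (k * k)))
...   | yes r∈T with ∈-↭-∷ r∈T
...     | T' , p with SPermₚ.Unique-resp-↭ (setoid ℕ) (Perm.↭⇒↭ₛ p) uT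
...       | _ ∷ uT' = T' , r * k , uT' , (λ m → there (sub (Permₚ.∈-resp-↭ (↭-sym p) (there m)))) ,
            trans (cong (r *_) (trans eq (cong (_* (k * k)) (ListAct.product-↭ p)))) (lem r (product T') k)
  where
  lem : ∀ r t k → r * (r * t * (k * k)) ≡ t * (r * k * (r * k))
  lem = solve-∀

decompose : ∀ {n q} → 1 ≤ n → Prime q → ∃₂ λ T ε → ∃ λ k → Unique T × All Prime T × (∀ {p} → p ∈ T → p ∣ n) × q ∉ T × (ε ≡ 1 ⊎ ε ≡ q) × n ≡ product T * ε * (k * k)
decompose {n} {q} 1≤n pq with factorise n {{>-nonZero 1≤n}}
... | record { factors = rs ; isFactorisation = refl ; factorsPrime = prs } with product-square rs prs
... | T , k , uT , sub , eq with Any.any? (q ≟_) T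
...   | no q∉T = T , 1 , k , uT , All.tabulate (λ m → All.lookup prs (sub m)) , (λ m → ListAct.∈⇒∣product (sub m)) , q∉T , inj₁ refl , trans eq (cong (_* (k * k)) (sym (*-identityʳ (product T))))
...   | yes q∈T with ∈-↭-∷ q∈T
...     | T' , p with SPermₚ.Unique-resp-↭ (setoid ℕ) (Perm.↭⇒↭ₛ p) uT
...       | nq ∷ uT' = T' , q , k , uT' , All.tabulate (λ m → All.lookup prs (sub' m)) , (λ m → ListAct.∈⇒∣product (sub' m)) , (λ m → All.lookup nq m refl) , inj₂ refl ,
            trans eq (cong (_* (k * k)) (trans (ListAct.product-↭ p) (*-comm q (product T'))))
  where
  sub' : ∀ {x} → x ∈ T' → x ∈ rs
  sub' m = sub (Permₚ.∈-resp-↭ (↭-sym p) (there m))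

H : ℕ → ℚ
H n = Σ (range1 n) rc

Σ-range1 : ∀ f n → Σ (range1 n) f ≡ S n (f ∘ suc)
Σ-range1 f n = trans (Σ-map (upTo n) suc f) (Σ-upTo (f ∘ suc) n)

S-snoc : ∀ f n → S (suc n) f ≡ S n f ⊕ f n
S-snoc f zero = ⊕-comm (f 0) 0ℚ
S-snoc f (suc n) = trans (cong (f 0 ⊕_) (S-snoc (f ∘ suc) n)) (sym (⊕-assoc (f 0) _ _))

2ℚ : ℚ
2ℚ = ι 2

4ℚ : ℚ
4ℚ = ι 4

rc-step : ∀ n → rc (suc n) ≡ rc (suc (suc n)) ⊕ rc (suc (suc n)) ⊗ rc (suc n)
rc-step n = sym (trans (solve 2 (λ x y → x :+ x :* y := x :* (con 1ℚ :+ y)) refl x y)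
  (trans (cong (λ z → x ⊗ (z ⊕ y)) (sym (ι-rc {suc n} (s≤s z≤n))))
  (trans (solve 3 (λ x y m → x :* (m :* y :+ y) := ((con 1ℚ :+ m) :* x) :* y) refl x y (ι (suc n)))
  (trans (cong (_⊗ y) (ι-rc {suc (suc n)} (s≤s z≤n))) (⊗-identityˡ y)))))
  where
  x = rc (suc (suc n))
  y = rc (suc n)

Σrc² : ∀ n → Σ (range1 n) (λ k → rc (k * k)) ⊑ 2ℚ
Σrc² zero = 0≤ι 2
Σrc² (suc n) = ⊑-trans (≤-+ʳ (0≤rc (suc n))) (go n)
  where
  f : ℕ → ℚ
  f k = rc (k * k)
  -- The reciprocal is added to make the induction telescope: 1 / (m + 1)² ≤ 1 / m - 1 / (m + 1).
  go : ∀ n → Σ (range1 (suc n)) f ⊕ rc (suc n) ⊑ 2ℚ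
  go zero = ⊑-reflexive (trans (cong₂ (λ x y → (x ⊕ 0ℚ) ⊕ y) rc-1 rc-1) refl)
  go (suc n) = begin
    Σ (range1 (suc (suc n))) f ⊕ x ≡⟨ cong (_⊕ x) (trans (Σ-range1 f (suc (suc n))) (trans (S-snoc (f ∘ suc) (suc n)) (cong (_⊕ f (suc (suc n))) (sym (Σ-range1 f (suc n)))))) ⟩
    (Σ (range1 (suc n)) f ⊕ f (suc (suc n))) ⊕ x ≡⟨ ⊕-assoc (Σ (range1 (suc n)) f) (f (suc (suc n))) x ⟩
    Σ (range1 (suc n)) f ⊕ (f (suc (suc n)) ⊕ x) ≤⟨ ⊕-monoʳ-⊑ (Σ (range1 (suc n)) f) step ⟩
    Σ (range1 (suc n)) f ⊕ rc (suc n) ≤⟨ go n ⟩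
    2ℚ ∎
    where
    open ℚₚ.≤-Reasoning
    x = rc (suc (suc n))
    step : f (suc (suc n)) ⊕ x ⊑ rc (suc n)
    step = begin
      f (suc (suc n)) ⊕ x ≡⟨ cong (_⊕ x) (rc-* (suc (suc n)) (suc (suc n))) ⟩
      x ⊗ x ⊕ x ≤⟨ ⊕-monoˡ-⊑ x (⊗-monoˡ (0≤rc (suc (suc n))) (rc-anti (s≤s z≤n) (n≤1+n (suc n)))) ⟩
      x ⊗ rc (suc n) ⊕ x ≡⟨ trans (⊕-comm _ x) (sym (rc-step n)) ⟩
      rc (suc n) ∎

sqfrees : ℕ → ℕ → List ℕ
sqfrees Q n = filter (λ d → ΠN (primesTo Q) (λ p → pick 1 d p p) ≟ d) (range1 n)

∈-sqfrees⁺ : ∀ {Q n d} → 1 ≤ d → d ≤ n → SqIn (primesTo Q) d → d ∈ sqfrees Q n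
∈-sqfrees⁺ {Q} 1≤d d≤n sq = Mem.∈-filter⁺ (λ d → ΠN (primesTo Q) (λ p → pick 1 d p p) ≟ d) (∈-range1⁺ 1≤d d≤n) sq

∈-sqfrees⁻ : ∀ {Q n d} → d ∈ sqfrees Q n → (1 ≤ d × d ≤ n) × SqIn (primesTo Q) d
∈-sqfrees⁻ {Q} {n} m with Mem.∈-filter⁻ (λ d → ΠN (primesTo Q) (λ p → pick 1 d p p) ≟ d) {xs = range1 n} m
... | a , b = ∈-range1⁻ a , b

unique-sqfrees : ∀ Q n → Unique (sqfrees Q n)
unique-sqfrees Q n = Uniq.filter⁺ (λ d → ΠN (primesTo Q) (λ p → pick 1 d p p) ≟ d) (unique-range1 n)

sqfreesAvoiding : ℕ → ℕ → ℕ → List ℕ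
sqfreesAvoiding Q n q = filter (λ e → ¬? (q ∣? e)) (sqfrees Q n)

-- Every z ≤ n is e ε k² with e squarefree and prime to q, and ε either 1 or q. The two values of ε
-- and Σ 1 / k² ≤ 2 give the factor 4. The condition on q allows squarefree multiples q e to be
-- formed later.
harmonic≤sqfree : ∀ {Q n q} → n ≤ Q → Prime q → H n ⊑ 4ℚ ⊗ Σ (sqfreesAvoiding Q n q) rc
harmonic≤sqfree {Q} {n} {q} n≤Q pq = begin
  H n ≤⟨ Σ-⊆ (unique-range1 n) cover 0≤rc ⟩
  Σ (concatMap row E) rc ≡⟨ Σ-concatMap E row rc ⟩
  Σ E (λ e → Σ (row e) rc) ≤⟨ Σ-mono E (λ {e} _ → rowBound e) ⟩
  Σ E (λ e → 4ℚ ⊗ rc e) ≡⟨ Σ-*ˡ E 4ℚ rc ⟩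
  4ℚ ⊗ Σ E rc ∎
  where
  open ℚₚ.≤-Reasoning
  E = sqfreesAvoiding Q n q
  cell : ℕ → ℕ → List ℕ
  cell e ε = map (λ k → e * ε * (k * k)) (range1 n)
  row : ℕ → List ℕ
  row e = cell e 1 ++ cell e q
  cellBound : ∀ e ε → 1 ≤ ε → Σ (cell e ε) rc ⊑ rc e ⊗ 2ℚ
  cellBound e ε 1≤ε = begin
    Σ (cell e ε) rc ≡⟨ Σ-map (range1 n) (λ k → e * ε * (k * k)) rc ⟩
    Σ (range1 n) (λ k → rc (e * ε * (k * k))) ≡⟨ Σ-cong (range1 n) (λ {k} _ → trans (rc-* (e * ε) (k * k)) (cong (_⊗ rc (k * k)) (rc-* e ε))) ⟩
    Σ (range1 n) (λ k → rc e ⊗ rc ε ⊗ rc (k * k)) ≡⟨ Σ-*ˡ (range1 n) (rc e ⊗ rc ε) _ ⟩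
    rc e ⊗ rc ε ⊗ Σ (range1 n) (λ k → rc (k * k)) ≤⟨ ⊗-monoˡ (⊗-nonneg (0≤rc e) (0≤rc ε)) (Σrc² n) ⟩
    rc e ⊗ rc ε ⊗ 2ℚ ≤⟨ ⊗-monoʳ (0≤ι 2) (⊗-monoˡ (0≤rc e) (subst (rc ε ⊑_) rc-1 (rc-anti ≤-refl 1≤ε))) ⟩
    rc e ⊗ 1ℚ ⊗ 2ℚ ≡⟨ cong (_⊗ 2ℚ) (⊗-identityʳ (rc e)) ⟩
    rc e ⊗ 2ℚ ∎
  rowBound : ∀ e → Σ (row e) rc ⊑ 4ℚ ⊗ rc e
  rowBound e = begin
    Σ (row e) rc ≡⟨ Σ-++ (cell e 1) (cell e q) rc ⟩
    Σ (cell e 1) rc ⊕ Σ (cell e q) rc ≤⟨ ⊕-mono-⊑ (cellBound e 1 ≤-refl) (cellBound e q (prime≥1 pq)) ⟩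
    rc e ⊗ 2ℚ ⊕ rc e ⊗ 2ℚ ≡⟨ solve 1 (λ x → x :* con 2ℚ :+ x :* con 2ℚ := con 4ℚ :* x) refl (rc e) ⟩
    4ℚ ⊗ rc e ∎
  cover : ∀ {z} → z ∈ range1 n → z ∈ concatMap row E
  cover {z} z∈ with ∈-range1⁻ z∈
  ... | 1≤z , z≤N with decompose {z} {q} 1≤z pq
  ... | T , ε , k , uT , prT , divT , q∉T , hε , eq = Mem.∈-concatMap⁺ row {xs = E} (Any.map (λ { refl → inRow }) e∈)
    where
    e = product T
    nz : ∀ {m} → m ∣ z → 1 ≤ m
    nz {m} m∣z = n≢0⇒n>0 λ { refl → <-irrefl (sym (Div.0∣⇒≡0 m∣z)) 1≤z }
    e∣z : e ∣ z
    e∣z = subst (e ∣_) (sym (trans eq (*-assoc e ε (k * k)))) (Div.m∣m*n (ε * (k * k)))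
    k∣z : k ∣ z
    k∣z = subst (k ∣_) (sym eq) (Div.∣n⇒∣m*n (e * ε) (Div.m∣m*n k))
    z≢0 = >-nonZero 1≤z
    le : ∀ {m} → m ∣ z → m ≤ n
    le m∣z = ≤-trans (Div.∣⇒≤ {{z≢0}} m∣z) z≤N
    q∤e : q ∤ e
    q∤e d = q∉T (factorisationHasAllPrimeFactors pq d prT)
    e∈ : e ∈ E
    e∈ = Mem.∈-filter⁺ (λ e → ¬? (q ∣? e)) (∈-sqfrees⁺ {Q} {n} (nz e∣z) (le e∣z)
      (sq-product (unique-primesTo Q) (λ m → proj₁ (∈-primesTo⁻ {n = Q} m)) uT (λ m → ∈-primesTo⁺ (All.lookup prT m) (≤-trans (le (divT m)) n≤Q)))) q∤e
    inCell : z ∈ cell e ε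
    inCell = subst (_∈ cell e ε) (sym eq) (Mem.∈-map⁺ (λ k → e * ε * (k * k)) (∈-range1⁺ (nz k∣z) (le k∣z)))
    inRow : z ∈ row e
    inRow = [ (λ ε≡1 → Mem.∈-++⁺ˡ (subst (λ x → z ∈ cell e x) ε≡1 inCell)) , (λ ε≡q → Mem.∈-++⁺ʳ (cell e 1) (subst (λ x → z ∈ cell e x) ε≡q inCell)) ]′ hε

-- Sieving primes n, with n - 1 free of selected primes

γ : (ℕ → Bool) → ℕ → ℚ
γ w p = if w p then 1ℚ else 0ℚ

0≤γ : ∀ w p → 0ℚ ⊑ γ w p
0≤γ w p with w p
... | true = 0≤1
... | false = ⊑-refl

γ≤1 : ∀ w p → γ w p ⊑ 1ℚ
γ≤1 w p with w p
... | true = ⊑-refl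
... | false = 0≤1

-- The proportion of forbidden classes modulo p: the class 0 always, the class 1 when p is selected
-- by w.
weight : (ℕ → Bool) → ℕ → ℚ
weight w p = (1ℚ ⊕ γ w p) ⊗ rc p

0≤weight : ∀ w p → 0ℚ ⊑ weight w p
0≤weight w p = ⊗-nonneg (⊕-nonneg 0≤1 (0≤γ w p)) (0≤rc p)

Πpick-rc : ∀ ps d → Πpick ps rc d ≡ rc (ΠN ps (λ p → pick 1 d p p))
Πpick-rc [] d = sym rc-1
Πpick-rc (p ∷ ps) d with does (p ∣? d)
... | true = trans (cong (rc p ⊗_) (Πpick-rc ps d)) (sym (rc-* p _))
... | false = trans (⊗-identityˡ _) (trans (Πpick-rc ps d) (cong rc (sym (+-identityʳ (ΠN ps (λ p → pick 1 d p p))))))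

0≤Πpick-rc : ∀ ps d → 0ℚ ⊑ Πpick ps rc d
0≤Πpick-rc ps d = subst (0ℚ ⊑_) (sym (Πpick-rc ps d)) (0≤rc (ΠN ps (λ p → pick 1 d p p)))

0≤pick0 : ∀ {x} d p → 0ℚ ⊑ x → 0ℚ ⊑ pick 0ℚ d p x
0≤pick0 d p h with does (p ∣? d)
... | true = h
... | false = ⊑-refl

-- This is ∏ (1 + γ) ≥ 1 + Σ γ over the primes dividing d, multiplied by ∏ 1 / p. The weight of d is
-- therefore at least 1 / d, and also at least the number of its selected prime factors divided by
-- d.
weierstrass : ∀ w ps d → (1ℚ ⊕ Σ ps (λ p → pick 0ℚ d p (γ w p))) ⊗ Πpick ps rc d ⊑ Πpick ps (weight w) d
weierstrass w [] d = ⊑-refl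
weierstrass w (p ∷ ps) d with weierstrass w ps d | does (p ∣? d)
... | ih | true = begin
  (1ℚ ⊕ (g ⊕ s)) ⊗ (r ⊗ P) ≤⟨ ≤-+ʳ (⊗-nonneg (⊗-nonneg (0≤γ w p) 0≤s) (⊗-nonneg (0≤rc p) (0≤Πpick-rc ps d))) ⟩
  (1ℚ ⊕ (g ⊕ s)) ⊗ (r ⊗ P) ⊕ g ⊗ s ⊗ (r ⊗ P) ≡⟨ solve 4 (λ g s r P → (con 1ℚ :+ (g :+ s)) :* (r :* P) :+ g :* s :* (r :* P) := ((con 1ℚ :+ g) :* r) :* ((con 1ℚ :+ s) :* P)) refl g s r P ⟩
  weight w p ⊗ ((1ℚ ⊕ s) ⊗ P) ≤⟨ ⊗-monoˡ (0≤weight w p) ih ⟩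
  weight w p ⊗ Πpick ps (weight w) d ∎
  where
  open ℚₚ.≤-Reasoning
  g = γ w p
  r = rc p
  P = Πpick ps rc d
  s = Σ ps (λ p → pick 0ℚ d p (γ w p))
  0≤s : 0ℚ ⊑ s
  0≤s = Σ-nonneg ps (λ q → 0≤pick0 d q (0≤γ w q))
... | ih | false = subst₂ _⊑_ (solve 2 (λ s P → (con 1ℚ :+ s) :* P := (con 1ℚ :+ (con 0ℚ :+ s)) :* (con 1ℚ :* P)) refl (Σ ps (λ p → pick 0ℚ d p (γ w p))) (Πpick ps rc d)) (sym (⊗-identityˡ _)) ih

module _ (w : ℕ → Bool) (Q : ℕ) where
  private
    Ps = primesTo Q
    D = sqfrees Q Q
    A = Σ D (Πpick Ps (weight w))
    prime : ∀ {p} → p ∈ Ps → Prime p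
    prime m = proj₁ (∈-primesTo⁻ {n = Q} m)

    ω : ℕ → ℚ
    ω d = Σ Ps (λ p → pick 0ℚ d p (γ w p))

    summand : ∀ {d} → d ∈ D → (1ℚ ⊕ ω d) ⊗ rc d ⊑ Πpick Ps (weight w) d
    summand {d} m = subst (λ x → (1ℚ ⊕ ω d) ⊗ x ⊑ Πpick Ps (weight w) d)
      (trans (Πpick-rc Ps d) (cong rc (proj₂ (∈-sqfrees⁻ {Q} {Q} m)))) (weierstrass w Ps d)

    sum₁ : Σ D rc ⊑ A
    sum₁ = Σ-mono D λ {d} m → ⊑-trans (subst (_⊑ (1ℚ ⊕ ω d) ⊗ rc d) (⊗-identityˡ (rc d))
      (⊗-monoʳ {1ℚ} {1ℚ ⊕ ω d} (0≤rc d) (≤-+ʳ (Σ-nonneg Ps (λ q → 0≤pick0 d q (0≤γ w q)))))) (summand m)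

    sum₂ : Σ D (λ d → Σ Ps (λ p → γ w p ⊗ pick 0ℚ d p (rc d))) ⊑ A
    sum₂ = Σ-mono D λ {d} m → ⊑-trans (⊑-reflexive (trans (Σ-cong Ps (λ {p} _ → comm d p)) (Σ-*ʳ Ps (rc d) (λ p → pick 0ℚ d p (γ w p)))))
       (⊑-trans (⊗-monoʳ {ω d} {1ℚ ⊕ ω d} (0≤rc d) (≤-+ˡ 0≤1)) (summand m))
      where
      comm : ∀ d p → γ w p ⊗ pick 0ℚ d p (rc d) ≡ pick 0ℚ d p (γ w p) ⊗ rc d
      comm d p with does (p ∣? d)
      ... | true = refl
      ... | false = trans (⊗-zeroʳ (γ w p)) (sym (⊗-zeroˡ (rc d)))

    -- The numbers p e, with e ≤ Q₁ squarefree and prime to p, are distinct squarefree multiples of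
    -- p up to Q.
    multiples : ∀ {p Q₁} → p ∈ Ps → p * Q₁ ≤ Q → rc p ⊗ Σ (sqfreesAvoiding Q Q₁ p) rc ⊑ Σ D (λ d → pick 0ℚ d p (rc d))
    multiples {p} {Q₁} p∈ le = ⊑-trans (⊑-reflexive (trans (sym (Σ-*ˡ E (rc p) rc)) (trans (Σ-cong E (λ {e} _ → trans (sym (rc-* p e)) (sym (picked e)))) (sym (Σ-map E (p *_) _)))))
      (Σ-⊆ (Uniq.map⁺ (λ {x} {y} → *-cancelˡ-≡ x y p {{Pr.prime⇒nonZero (prime p∈)}}) (Uniq.filter⁺ (λ e → ¬? (p ∣? e)) (unique-sqfrees Q Q₁))) sub (λ d → 0≤pick0 d p (0≤rc d)))
      where
      E = sqfreesAvoiding Q Q₁ p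
      picked : ∀ e → pick 0ℚ (p * e) p (rc (p * e)) ≡ rc (p * e)
      picked e with does (p ∣? (p * e)) in eq
      ... | true = refl
      ... | false with p ∣? (p * e)
      ...   | no ¬d = ⊥-elim (¬d (Div.m∣m*n e))
      ...   | yes _ = case eq of λ ()
      sub : ∀ {z} → z ∈ map (p *_) E → z ∈ D
      sub z∈ with Mem.∈-map⁻ (p *_) z∈
      ... | e , e∈ , refl with Mem.∈-filter⁻ (λ e → ¬? (p ∣? e)) {xs = sqfrees Q Q₁} e∈
      ... | e∈' , p∤e with ∈-sqfrees⁻ {Q} {Q₁} e∈'
      ... | (1≤e , e≤) , sq = ∈-sqfrees⁺ {Q} {Q} (*-mono-≤ (prime≥1 (prime p∈)) 1≤e) (≤-trans (*-monoʳ-≤ p e≤) le) (sq-* (unique-primesTo Q) prime p∈ p∤e sq)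

  harmonic≤weights : H Q ⊑ 4ℚ ⊗ A
  harmonic≤weights = ⊑-trans (harmonic≤sqfree {Q} {Q} {2} ≤-refl Pr.prime[2]) (⊗-monoˡ (0≤ι 4) (⊑-trans (Σ-filter-≤ (λ e → ¬? (2 ∣? e)) D 0≤rc) sum₁))

  -- Counting each squarefree d once for every selected prime in it bounds the left side by the
  -- second estimate behind `weierstrass`. Compared with `harmonic≤weights` this gains the factor Σ
  -- 1 / p, which makes primes without a prime factor of p - 1 in a wide window rare.
  reciprocals*harmonic≤weights : ∀ {Q₁} → Q₁ ≤ Q → (∀ {p} → Prime p → w p ≡ true → p ≤ Q → p * Q₁ ≤ Q) → Σ Ps (λ p → γ w p ⊗ rc p) ⊗ H Q₁ ⊑ 4ℚ ⊗ A
  reciprocals*harmonic≤weights {Q₁} Q₁≤Q hw = begin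
    Σ Ps (λ p → γ w p ⊗ rc p) ⊗ H Q₁ ≡⟨ sym (Σ-*ʳ Ps (H Q₁) _) ⟩
    Σ Ps (λ p → γ w p ⊗ rc p ⊗ H Q₁) ≤⟨ Σ-mono Ps term ⟩
    Σ Ps (λ p → 4ℚ ⊗ (γ w p ⊗ Σ D (λ d → pick 0ℚ d p (rc d)))) ≡⟨ Σ-*ˡ Ps 4ℚ _ ⟩
    4ℚ ⊗ Σ Ps (λ p → γ w p ⊗ Σ D (λ d → pick 0ℚ d p (rc d))) ≡⟨ cong (4ℚ ⊗_) (trans (Σ-cong Ps (λ {p} _ → sym (Σ-*ˡ D (γ w p) _))) (Σ-swap Ps D _)) ⟩
    4ℚ ⊗ Σ D (λ d → Σ Ps (λ p → γ w p ⊗ pick 0ℚ d p (rc d))) ≤⟨ ⊗-monoˡ (0≤ι 4) sum₂ ⟩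
    4ℚ ⊗ A ∎
    where
    open ℚₚ.≤-Reasoning
    term : ∀ {p} → p ∈ Ps → γ w p ⊗ rc p ⊗ H Q₁ ⊑ 4ℚ ⊗ (γ w p ⊗ Σ D (λ d → pick 0ℚ d p (rc d)))
    term {p} m with w p in eq
    ... | false = ⊑-reflexive (solve 3 (λ a b c → con 0ℚ :* a :* b := con 4ℚ :* (con 0ℚ :* c)) refl (rc p) (H Q₁) (Σ D (λ d → pick 0ℚ d p (rc d))))
    ... | true = begin
      1ℚ ⊗ rc p ⊗ H Q₁ ≡⟨ cong (_⊗ H Q₁) (⊗-identityˡ (rc p)) ⟩
      rc p ⊗ H Q₁ ≤⟨ ⊗-monoˡ (0≤rc p) (harmonic≤sqfree {Q} {Q₁} {p} Q₁≤Q (prime m)) ⟩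
      rc p ⊗ (4ℚ ⊗ E) ≡⟨ solve 2 (λ a b → a :* (con 4ℚ :* b) := con 4ℚ :* (con 1ℚ :* (a :* b))) refl (rc p) E ⟩
      4ℚ ⊗ (1ℚ ⊗ (rc p ⊗ E)) ≤⟨ ⊗-monoˡ (0≤ι 4) (⊗-monoˡ 0≤1 (multiples m (hw (prime m) eq (proj₂ (∈-primesTo⁻ {n = Q} m))))) ⟩
      4ℚ ⊗ (1ℚ ⊗ Σ D (λ d → pick 0ℚ d p (rc d))) ∎
      where E = Σ (sqfreesAvoiding Q Q₁ p) rc

  1≤weights : 1 ≤ Q → 1ℚ ⊑ A
  1≤weights 1≤Q = ⊑-trans (⊑-reflexive (sym (trans (⊕-identityʳ (rc 1)) rc-1)))
    (⊑-trans (Σ-⊆ {xs = 1 ∷ []} {f = rc} ([] ∷ []) (λ { (here refl) → ∈-sqfrees⁺ {Q} {Q} ≤-refl 1≤Q (sq-product {T = []} (unique-primesTo Q) prime [] (λ ())) }) 0≤rc) sum₁)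

residueIndicator : ℚ → ℕ → ℚ
residueIndicator g 0 = 1ℚ
residueIndicator g 1 = g
residueIndicator g _ = 0ℚ

-- The indicator of n ≡ 0, or n ≡ 1 for a selected p, modulo p; 0 is a default value at p = 0.
forbidden : (ℕ → Bool) → ℕ → ℕ → ℚ
forbidden w zero n = 0ℚ
forbidden w (suc p) n = residueIndicator (γ w (suc p)) (n % suc p)

S-cong< : ∀ n {f g} → (∀ i → i < n → f i ≡ g i) → S n f ≡ S n g
S-cong< zero h = refl
S-cong< (suc n) h = cong₂ _⊕_ (h 0 (s≤s z≤n)) (S-cong< n (λ i i<n → h (suc i) (s≤s i<n)))

S-forbidden : ∀ w {p} → Prime p → S p (forbidden w p) ≡ 1ℚ ⊕ γ w p
S-forbidden w {zero} pr = ⊥-elim (Pr.¬prime[0] pr)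
S-forbidden w {suc zero} pr = ⊥-elim (Pr.¬prime[1] pr)
S-forbidden w {p@(suc (suc p'))} pr = trans (S-cong< p {g = residueIndicator (γ w p)} (λ i i<p → cong (residueIndicator (γ w p)) (DivMod.m<n⇒m%n≡m i<p)))
  (cong (1ℚ ⊕_) (trans (cong (γ w p ⊕_) (trans (S-const p' 0ℚ) (⊗-zeroʳ (ι p')))) (⊕-identityʳ (γ w p))))

S-⊝ : ∀ n c f → S n (λ i → c ⊝ f i) ≡ ι n ⊗ c ⊝ S n f
S-⊝ zero c f = solve 1 (λ c → con 0ℚ := con 0ℚ :* c :- con 0ℚ) refl c
S-⊝ (suc n) c f = trans (cong (c ⊝ f 0 ⊕_) (S-⊝ n c (f ∘ suc))) (solve 4 (λ c x m s → (c :- x) :+ (m :* c :- s) := (con 1ℚ :+ m) :* c :- (x :+ s)) refl c (f 0) (ι n) (S n (f ∘ suc)))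

S-⊝² : ∀ n c f → (∀ i → f i ⊗ f i ≡ f i) → S n (λ i → (c ⊝ f i) ⊗ (c ⊝ f i)) ≡ (ι n ⊗ c ⊗ c ⊝ (c ⊕ c) ⊗ S n f) ⊕ S n f
S-⊝² zero c f idem = solve 1 (λ c → con 0ℚ := (con 0ℚ :* c :* c :- (c :+ c) :* con 0ℚ) :+ con 0ℚ) refl c
S-⊝² (suc n) c f idem = trans (cong₂ _⊕_ (trans (solve 2 (λ c x → (c :- x) :* (c :- x) := (c :* c :- (c :+ c) :* x) :+ x :* x) refl c (f 0)) (cong ((c ⊗ c ⊝ (c ⊕ c) ⊗ f 0) ⊕_) (idem 0))) (S-⊝² n c (f ∘ suc) (λ i → idem (suc i))))
  (solve 4 (λ c x m s → ((c :* c :- (c :+ c) :* x) :+ x) :+ ((m :* c :* c :- (c :+ c) :* s) :+ s) := ((con 1ℚ :+ m) :* c :* c :- (c :+ c) :* (x :+ s)) :+ (x :+ s)) refl c (f 0) (ι n) (S n (f ∘ suc)))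

residueIndicator-idem : ∀ w p k → residueIndicator (γ w p) k ⊗ residueIndicator (γ w p) k ≡ residueIndicator (γ w p) k
residueIndicator-idem w p 0 = refl
residueIndicator-idem w p 1 with w p
... | true = refl
... | false = refl
residueIndicator-idem w p (suc (suc k)) = refl

forbidden-idem : ∀ w p n → forbidden w p n ⊗ forbidden w p n ≡ forbidden w p n
forbidden-idem w zero n = refl
forbidden-idem w (suc p) n = residueIndicator-idem w (suc p) (n % suc p)

0≤forbidden≤1 : ∀ w p n → 0ℚ ⊑ forbidden w p n × forbidden w p n ⊑ 1ℚ
0≤forbidden≤1 w zero n = ⊑-refl , 0≤1
0≤forbidden≤1 w (suc p) n = go (n % suc p)
  where
  go : ∀ k → 0ℚ ⊑ residueIndicator (γ w (suc p)) k × residueIndicator (γ w (suc p)) k ⊑ 1ℚ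
  go 0 = 0≤1 , ⊑-refl
  go 1 = 0≤γ w (suc p) , γ≤1 w (suc p)
  go (suc (suc k)) = ⊑-refl , 0≤1

⊝-≤ : ∀ {x y} → 0ℚ ⊑ y → x ⊑ 1ℚ → x ⊝ y ⊑ 1ℚ
⊝-≤ {x} {y} 0≤y x≤1 = subst₂ _⊑_ refl (⊕-identityʳ 1ℚ) (⊕-mono-⊑ x≤1 (ℚₚ.neg-antimono-≤ 0≤y))

∣⊝∣≤1 : ∀ {x y} → 0ℚ ⊑ x → x ⊑ 1ℚ → 0ℚ ⊑ y → y ⊑ 1ℚ → ℚ.∣ x ⊝ y ∣ ⊑ 1ℚ
∣⊝∣≤1 {x} {y} 0≤x x≤1 0≤y y≤1 with ℚₚ.∣p∣≡p∨∣p∣≡-p (x ⊝ y)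
... | inj₁ e = subst (_⊑ 1ℚ) (sym e) (⊝-≤ 0≤y x≤1)
... | inj₂ e = subst (_⊑ 1ℚ) (sym (trans e (solve 2 (λ x y → :- (x :- y) := y :- x) refl x y))) (⊝-≤ 0≤x y≤1)
  where open +-*-Solver using (:-_)

weight≤1 : ∀ w {p} → Prime p → weight w p ⊑ 1ℚ
weight≤1 w {p} pr = begin
  (1ℚ ⊕ γ w p) ⊗ rc p ≤⟨ ⊗-mono (⊕-nonneg 0≤1 (0≤γ w p)) (0≤rc 2) (⊕-monoʳ-⊑ 1ℚ (⊑-trans (γ≤1 w p) (⊑-reflexive (sym ι-1)))) (rc-anti (s≤s z≤n) (prime≥2 pr)) ⟩
  ι 2 ⊗ rc 2 ≡⟨ ι-rc {2} (s≤s z≤n) ⟩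
  1ℚ ∎
  where open ℚₚ.≤-Reasoning

ι-weight : ∀ w {p} → Prime p → ι p ⊗ weight w p ≡ 1ℚ ⊕ γ w p
ι-weight w {p} pr = trans (solve 3 (λ a b c → a :* (b :* c) := b :* (a :* c)) refl (ι p) (1ℚ ⊕ γ w p) (rc p)) (trans (cong ((1ℚ ⊕ γ w p) ⊗_) (ι-rc (prime≥1 pr))) (⊗-identityʳ _))

-- The function `a p` is the proportion c of forbidden classes minus their indicator: it has mean 0,
-- variance c - c² ≤ c, and value c on the sifted n. As the total weight A is at least 1, the error
-- Q⁴ ≤ N is absorbed into N A and one factor A cancels.
sieve-primes : ∀ w {Q N} xs → 1 ≤ Q → Q * Q * (Q * Q) ≤ N → Unique xs →
  (∀ {n} → n ∈ xs → n < N × Prime n × Q < n × (∀ {p} → Prime p → p ≤ Q → w p ≡ true → p ∤ n ∸ 1)) →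
  ι (length xs) ⊗ Σ (sqfrees Q Q) (Πpick (primesTo Q) (weight w)) ⊑ 2ℚ ⊗ ι N
sieve-primes w {Q} {N} xs 1≤Q Q⁴≤N uxs hxs = ℚₚ.*-cancelʳ-≤-pos A {{ℚ.positive (⊏-⊑-trans 0<1 1≤A)}} (begin
  ι (length xs) ⊗ A ⊗ A ≡⟨ ⊗-assoc (ι (length xs)) A A ⟩
  ι (length xs) ⊗ (A ⊗ A) ≤⟨ sieve Ps (unique-primesTo Q) prime a (weight w) per bdd mean (λ {p} _ → 0≤weight w p) var {Q} {N} D xs (unique-sqfrees Q Q) lenD
        (λ m → let (_ , le) , sq = ∈-sqfrees⁻ {Q} {Q} m in sq , le) uxs (λ m → proj₁ (hxs m) , λ mp → avoid m mp) ⟩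
  ι N ⊗ A ⊕ ι (Q * Q * (Q * Q)) ≤⟨ ⊕-monoʳ-⊑ (ι N ⊗ A) (ι-mono Q⁴≤N) ⟩
  ι N ⊗ A ⊕ ι N ≤⟨ ⊕-monoʳ-⊑ (ι N ⊗ A) (subst (_⊑ ι N ⊗ A) (⊗-identityʳ (ι N)) (⊗-monoˡ (0≤ι N) 1≤A)) ⟩
  ι N ⊗ A ⊕ ι N ⊗ A ≡⟨ solve 2 (λ n a → n :* a :+ n :* a := con 2ℚ :* n :* a) refl (ι N) A ⟩
  2ℚ ⊗ ι N ⊗ A ∎)
  where
  open ℚₚ.≤-Reasoning
  Ps = primesTo Q
  D = sqfrees Q Q
  A = Σ D (Πpick Ps (weight w))
  1≤A = 1≤weights w Q 1≤Q
  a : ℕ → ℕ → ℚ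
  a p n = weight w p ⊝ forbidden w p n
  prime : ∀ {p} → p ∈ Ps → Prime p
  prime m = proj₁ (∈-primesTo⁻ {n = Q} m)
  per : ∀ {p} → p ∈ Ps → Periodic p (a p)
  per {zero} m n = refl
  per {suc p} m n = cong (λ k → weight w (suc p) ⊝ residueIndicator (γ w (suc p)) k) (trans (cong (_% suc p) (+-comm (suc p) n)) (DivMod.[m+n]%n≡m%n n (suc p)))
  bdd : ∀ {p} → p ∈ Ps → ∀ n → ℚ.∣ a p n ∣ ⊑ 1ℚ
  bdd {p} m n = ∣⊝∣≤1 (0≤weight w p) (weight≤1 w (prime m)) (proj₁ (0≤forbidden≤1 w p n)) (proj₂ (0≤forbidden≤1 w p n))
  mean : ∀ {p} → p ∈ Ps → S p (a p) ≡ 0ℚ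
  mean {p} m = trans (S-⊝ p (weight w p) (forbidden w p)) (trans (cong₂ _⊝_ (ι-weight w (prime m)) (S-forbidden w (prime m))) (⊕-inverseʳ (1ℚ ⊕ γ w p)))
  var : ∀ {p} → p ∈ Ps → S p (λ n → a p n ⊗ a p n) ⊑ ι p ⊗ weight w p
  var {p} m = begin
    S p (λ n → a p n ⊗ a p n) ≡⟨ S-⊝² p c (forbidden w p) (forbidden-idem w p) ⟩
    (ι p ⊗ c ⊗ c ⊝ (c ⊕ c) ⊗ S p (forbidden w p)) ⊕ S p (forbidden w p) ≡⟨ cong₂ (λ x y → (x ⊗ c ⊝ (c ⊕ c) ⊗ y) ⊕ y) (ι-weight w (prime m)) (S-forbidden w (prime m)) ⟩
    (E ⊗ c ⊝ (c ⊕ c) ⊗ E) ⊕ E ≤⟨ ≤-+ʳ (⊗-nonneg (0≤weight w p) (⊕-nonneg 0≤1 (0≤γ w p))) ⟩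
    ((E ⊗ c ⊝ (c ⊕ c) ⊗ E) ⊕ E) ⊕ c ⊗ E ≡⟨ solve 2 (λ E c → ((E :* c :- (c :+ c) :* E) :+ E) :+ c :* E := E) refl E c ⟩
    E ≡⟨ sym (ι-weight w (prime m)) ⟩
    ι p ⊗ c ∎
    where
    c = weight w p
    E = 1ℚ ⊕ γ w p
  lenD : length D ≤ Q
  lenD = ≤-trans (Listₚ.length-filter (λ d → ΠN (primesTo Q) (λ p → pick 1 d p p) ≟ d) (range1 Q)) (≤-reflexive (length-range1 Q))
  avoid : ∀ {n p} → n ∈ xs → p ∈ Ps → a p n ≡ weight w p
  avoid {n} {zero} m mp = ⊥-elim (Pr.¬prime[0] (prime mp))
  avoid {n} {suc p'} m mp with hxs m
  ... | n<N , pn , Q<n , nd = trans (cong (weight w (suc p') ⊝_) (go (n % suc p') refl)) (solve 1 (λ x → x :- con 0ℚ := x) refl (weight w (suc p')))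
    where
    p = suc p'
    p≤Q = proj₂ (∈-primesTo⁻ {n = Q} mp)
    go : ∀ k → n % p ≡ k → residueIndicator (γ w p) k ≡ 0ℚ
    go 0 e = ⊥-elim (<⇒≱ Q<n (subst (_≤ Q) (prime∣prime (prime mp) pn (Div.m%n≡0⇒n∣m n p e)) p≤Q))
    go 1 e with w p in eq
    ... | false = refl
    ... | true = ⊥-elim (nd (prime mp) p≤Q eq (subst (p ∣_) (cong (_∸ 1) (trans (cong (_+ n / p * p) (sym e)) (sym (DivMod.m≡m%n+[m/n]*n n p)))) (Div.n∣m*n (n / p))))
    go (suc (suc k)) e = refl

8ℚ : ℚ
8ℚ = ι 8

private
  combine : ∀ {l} X A N → 0ℚ ⊑ l → X ⊑ 4ℚ ⊗ A → l ⊗ A ⊑ 2ℚ ⊗ N → l ⊗ X ⊑ 8ℚ ⊗ N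
  combine {l} X A N 0≤l hX hA = begin
    l ⊗ X ≤⟨ ⊗-monoˡ 0≤l hX ⟩
    l ⊗ (4ℚ ⊗ A) ≡⟨ solve 2 (λ l a → l :* (con 4ℚ :* a) := con 4ℚ :* (l :* a)) refl l A ⟩
    4ℚ ⊗ (l ⊗ A) ≤⟨ ⊗-monoˡ (0≤ι 4) hA ⟩
    4ℚ ⊗ (2ℚ ⊗ N) ≡⟨ solve 1 (λ n → con 4ℚ :* (con 2ℚ :* n) := con 8ℚ :* n) refl N ⟩
    8ℚ ⊗ N ∎
    where open ℚₚ.≤-Reasoning

primes-upper : ∀ {Q N} xs → 1 ≤ Q → Q * Q * (Q * Q) ≤ N → Unique xs → (∀ {n} → n ∈ xs → n < N × Prime n × Q < n) →
  ι (length xs) ⊗ H Q ⊑ 8ℚ ⊗ ι N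
primes-upper {Q} {N} xs 1≤Q le u h = combine (H Q) (Σ (sqfrees Q Q) (Πpick (primesTo Q) (weight (λ _ → false)))) (ι N) (0≤ι (length xs)) (harmonic≤weights (λ _ → false) Q)
  (sieve-primes (λ _ → false) {Q} {N} xs 1≤Q le u (λ m → let a , b , c = h m in a , b , c , λ _ _ ()))

shifted-primes-upper : ∀ w {Q Q₁ N} xs → 1 ≤ Q → Q * Q * (Q * Q) ≤ N → Q₁ ≤ Q → (∀ {p} → Prime p → w p ≡ true → p ≤ Q → p * Q₁ ≤ Q) → Unique xs →
  (∀ {n} → n ∈ xs → n < N × Prime n × Q < n × (∀ {p} → Prime p → p ≤ Q → w p ≡ true → p ∤ n ∸ 1)) →
  ι (length xs) ⊗ (Σ (primesTo Q) (λ p → γ w p ⊗ rc p) ⊗ H Q₁) ⊑ 8ℚ ⊗ ι N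
shifted-primes-upper w {Q} {Q₁} {N} xs 1≤Q le Q₁≤Q hw u h = combine (Σ (primesTo Q) (λ p → γ w p ⊗ rc p) ⊗ H Q₁) (Σ (sqfrees Q Q) (Πpick (primesTo Q) (weight w))) (ι N) (0≤ι (length xs)) (reciprocals*harmonic≤weights w Q Q₁≤Q hw) (sieve-primes w {Q} {N} xs 1≤Q le u h)

-- Chebyshev's lower bound

-- The binomial coefficient (k + m)! / (k! m!), indexed symmetrically so that no subtraction occurs.
bin : ℕ → ℕ → ℕ
bin zero m = 1
bin (suc k) zero = 1
bin (suc k) (suc m) = bin k (suc m) + bin (suc k) m

bin-0 : ∀ k → bin k 0 ≡ 1
bin-0 zero = refl
bin-0 (suc k) = refl

bin-sym : ∀ k m → bin k m ≡ bin m k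
bin-sym zero m = sym (bin-0 m)
bin-sym (suc k) zero = refl
bin-sym (suc k) (suc m) = trans (+-comm (bin k (suc m)) (bin (suc k) m)) (cong₂ _+_ (bin-sym (suc k) m) (bin-sym k (suc m)))

bin-suc : ∀ k m → suc k * bin (suc k) m ≡ suc (k + m) * bin k m
bin-suc k zero = cong₂ (λ x y → suc x * y) (sym (+-identityʳ k)) (sym (bin-0 k))
bin-suc k (suc m) = trans (lem₁ k (bin k (suc m)) (bin (suc k) m)) (trans (cong (suc k * bin k (suc m) +_) (trans (bin-suc k m) (sym J))) (lem₂ k m (bin k (suc m))))
  where
  J : suc m * bin k (suc m) ≡ suc (k + m) * bin k m
  J = trans (cong (suc m *_) (bin-sym k (suc m))) (trans (bin-suc m k) (cong₂ (λ x y → suc x * y) (+-comm m k) (bin-sym m k)))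
  lem₁ : ∀ k x y → suc k * (x + y) ≡ suc k * x + suc k * y
  lem₁ = solve-∀
  lem₂ : ∀ k m x → suc k * x + suc m * x ≡ suc (k + suc m) * x
  lem₂ = solve-∀

bin-sucʳ : ∀ k m → suc m * bin k (suc m) ≡ suc (k + m) * bin k m
bin-sucʳ k m = trans (cong (suc m *_) (bin-sym k (suc m))) (trans (bin-suc m k) (cong₂ (λ x y → suc x * y) (+-comm m k) (bin-sym m k)))

bin-mono : ∀ k m → bin k m ≤ bin k (suc m)
bin-mono zero m = ≤-refl
bin-mono (suc k) m = m≤n+m (bin (suc k) m) (bin k (suc m))

2^≤bin : ∀ n → 2 ^ n ≤ bin n n
2^≤bin zero = ≤-refl
2^≤bin (suc n) = ≤-trans (≤-reflexive (cong (2 ^ n +_) (+-identityʳ (2 ^ n))))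
  (+-mono-≤ (≤-trans (2^≤bin n) (bin-mono n n)) (≤-trans (2^≤bin n) (≤-trans (bin-mono n n) (≤-reflexive (bin-sym n (suc n))))))

-- Leibniz' harmonic triangle: 1/c = 1/a - 1/b for neighbouring entries a, b, c
leibniz : ∀ {L N} → (∀ {j} → 1 ≤ j → j ≤ N → j ∣ L) → ∀ k m → suc k + m ≤ N → suc k * bin (suc k) m ∣ L
leibniz {L} h zero m le = subst (_∣ L) (sym (trans (*-identityˡ (bin 1 m)) (b1 m))) (h {suc m} (s≤s z≤n) le)
  where
  b1 : ∀ m → bin 1 m ≡ suc m
  b1 zero = refl
  b1 (suc m) = cong suc (b1 m)
leibniz {L} {N} h (suc k) m le with leibniz {L} h k m (≤-trans (n≤1+n _) le) | leibniz {L} h k (suc m) (subst (_≤ N) (sym (+-suc (suc k) m)) le)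
... | divides x ex | divides y ey = Div.∣m+n∣m⇒∣n (subst (c ∣_) eq (Div.m∣m*n x)) (Div.m∣m*n y)
  where
  K = suc k
  c = suc K * bin (suc K) m
  a = K * bin K m
  b = K * bin K (suc m)
  r₁ : K * c ≡ suc (K + m) * a
  r₁ = trans (cong (K *_) (bin-suc K m)) (l K (suc (K + m)) (bin K m))
    where
    l : ∀ K s x → K * (s * x) ≡ s * (K * x)
    l = solve-∀
  r₂ : suc m * b ≡ suc (K + m) * a
  r₂ = trans (l K (suc m) (bin K (suc m))) (trans (cong (K *_) (bin-sucʳ K m)) (sym (l K (suc (K + m)) (bin K m))))
    where
    l : ∀ K s x → s * (K * x) ≡ K * (s * x)
    l = solve-∀
  eq : c * x ≡ c * y + L
  eq = *-cancelˡ-≡ (c * x) (c * y + L) K (trans e₁ (sym e₂))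
    where
    e₁ : K * (c * x) ≡ suc (K + m) * L
    e₁ = trans (sym (*-assoc K c x)) (trans (cong (_* x) r₁) (trans (*-assoc (suc (K + m)) a x) (cong (suc (K + m) *_) (trans (*-comm a x) (sym ex)))))
    e₂ : K * (c * y + L) ≡ suc (K + m) * L
    e₂ = trans (*-distribˡ-+ K (c * y) L) (trans (cong (_+ K * L) (trans (sym (*-assoc K c y)) (trans (cong (_* y) (trans r₁ (sym r₂))) (trans (*-assoc (suc m) b y) (cong (suc m *_) (trans (*-comm b y) (sym ey)))))))
      (l K m L))
      where
      l : ∀ K m L → suc m * L + K * L ≡ suc (K + m) * L
      l = solve-∀

n<b^n : ∀ {b} → 2 ≤ b → ∀ n → n < b ^ n
n<b^n 2≤b zero = s≤s z≤n
n<b^n {b} 2≤b (suc n) = ≤-trans (s≤s (n<b^n 2≤b n)) (≤-trans (≤-trans (+-monoˡ-≤ (b ^ n) (m^n>0 b {{>-nonZero (<⇒≤ 2≤b)}} n)) (≤-reflexive (cong (b ^ n +_) (sym (+-identityʳ (b ^ n)))))) (*-monoˡ-≤ (b ^ n) 2≤b))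

log-bracket : ∀ b N → 2 ≤ b → 1 ≤ N → ∃ λ e → b ^ e ≤ N × N < b ^ suc e
log-bracket b N 2≤b 1≤N = go N (n<b^n 2≤b N)
  where
  go : ∀ k → N < b ^ k → ∃ λ e → b ^ e ≤ N × N < b ^ suc e
  go zero lt = ⊥-elim (<⇒≱ lt 1≤N)
  go (suc k) lt with b ^ k ≤? N
  ... | yes le = k , le , lt
  ... | no nle = go k (≰⇒> nle)

ΠN-∣ : ∀ {xs x f} → x ∈ xs → f x ∣ ΠN xs f
ΠN-∣ {_ ∷ xs} {f = f} (here refl) = Div.m∣m*n (ΠN xs f)
ΠN-∣ {y ∷ xs} {f = f} (there m) = Div.∣n⇒∣m*n (f y) (ΠN-∣ {xs} m)

ΠN-≤ : ∀ xs {f c} → (∀ {x} → x ∈ xs → f x ≤ c) → ΠN xs f ≤ c ^ length xs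
ΠN-≤ [] h = ≤-refl
ΠN-≤ (x ∷ xs) h = *-mono-≤ (h (here refl)) (ΠN-≤ xs (λ m → h (there m)))

∣-from-prime-powers : ∀ L k → 1 ≤ k → (∀ {p a} → Prime p → p ^ a ∣ k → p ^ a ∣ L) → k ∣ L
∣-from-prime-powers L = <-rec _ go
  where
  go : ∀ k → (∀ {j} → j < k → 1 ≤ j → (∀ {p a} → Prime p → p ^ a ∣ j → p ^ a ∣ L) → j ∣ L) → 1 ≤ k → (∀ {p a} → Prime p → p ^ a ∣ k → p ^ a ∣ L) → k ∣ L
  go k rec 1≤k h with 2 ≤? k
  ... | no ¬2≤k = subst (_∣ L) (≤-antisym 1≤k (≮⇒≥ ¬2≤k)) (Div.1∣ L)
  ... | yes 2≤k with prime-divisor 2≤k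
  ...   | r , pr , r∣k with prime-power-split r (prime≥2 pr) k 1≤k
  ...     | zero , k' , refl , nd = ⊥-elim (nd (subst (r ∣_) (+-identityʳ k') r∣k))
  ...     | suc f , k' , refl , nd = coprime-∣-* (coprime-^ (suc f) (prime∤⇒coprime pr nd)) (h {r} {suc f} pr (Div.m∣m*n k')) (rec k'<k 1≤k' (λ {p} {a} pp d → h {p} {a} pp (Div.∣n⇒∣m*n (r ^ suc f) d)))
    where
    1≤k' : 1 ≤ k'
    1≤k' = n≢0⇒n>0 λ { refl → nd (_ Div.∣0) }
    k'<k : k' < r ^ suc f * k'
    k'<k = subst (k' <_) (*-comm k' (r ^ suc f)) (m<m*n k' (r ^ suc f) {{>-nonZero 1≤k'}} (≤-trans (prime≥2 pr) (m≤m*n r (r ^ f) {{m^n≢0 r f {{Pr.prime⇒nonZero pr}}}})))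

-- L is the least common multiple of 1, ..., 2 n, written as a product of one prime power at most 2
-- n for each prime. The entry n * bin n n of the harmonic triangle divides it and is at least 2 ^
-- n.
primesTo-lower : ∀ n → 1 ≤ n → 2 ^ n ≤ (n + n) ^ length (primesTo (n + n))
primesTo-lower n@(suc n') 1≤n = ≤-trans (2^≤bin n) (≤-trans (m≤n*m (bin n n) n) (≤-trans (Div.∣⇒≤ {{>-nonZero 1≤L}} (leibniz {L} {N} allDiv n' n ≤-refl)) L≤))
  where
  N = n + n
  1≤N : 1 ≤ N
  1≤N = s≤s z≤n
  Ps = primesTo N
  pow : ℕ → ℕ
  pow p with 2 ≤? p
  ... | yes 2≤p = p ^ proj₁ (log-bracket p N 2≤p 1≤N)
  ... | no _ = 1
  pow-spec : ∀ {p} → Prime p → ∃ λ e → pow p ≡ p ^ e × p ^ e ≤ N × N < p ^ suc e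
  pow-spec {p} pr with 2 ≤? p
  ... | yes 2≤p = let e , a , b = log-bracket p N 2≤p 1≤N in e , refl , a , b
  ... | no ¬2≤p = ⊥-elim (¬2≤p (prime≥2 pr))
  prime : ∀ {p} → p ∈ Ps → Prime p
  prime m = proj₁ (∈-primesTo⁻ {n = N} m)
  L = ΠN Ps pow
  1≤L : 1 ≤ L
  1≤L = ΠN-pos Ps λ {p} m → let e , eq , _ = pow-spec (prime m) in subst (1 ≤_) (sym eq) (m^n>0 p {{Pr.prime⇒nonZero (prime m)}} e)
  L≤ : L ≤ N ^ length Ps
  L≤ = ΠN-≤ Ps λ {p} m → let e , eq , le , _ = pow-spec (prime m) in subst (_≤ N) (sym eq) le
  allDiv : ∀ {j} → 1 ≤ j → j ≤ N → j ∣ L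
  allDiv {j} 1≤j j≤N = ∣-from-prime-powers L j 1≤j (λ {p} {a} → pp {p} {a})
    where
    pp : ∀ {p a} → Prime p → p ^ a ∣ j → p ^ a ∣ L
    pp {p} {zero} pr d = Div.1∣ L
    pp {p} {suc a} pr d with pow-spec pr
    ... | e , eq , le , lt = Div.∣-trans (subst (p ^ suc a ∣_) (sym eq) p∣) (ΠN-∣ {Ps} (∈-primesTo⁺ pr (≤-trans (m≤m*n p (p ^ a) {{m^n≢0 p a {{p≢0}}}}) p≤N)))
      where
      p≢0 = Pr.prime⇒nonZero pr
      p≤N : p ^ suc a ≤ N
      p≤N = ≤-trans (Div.∣⇒≤ {{>-nonZero 1≤j}} d) j≤N
      a<e : suc a ≤ e
      a<e = ≮⇒≥ λ e<a → <⇒≱ lt (≤-trans (^-monoʳ-≤ p {{p≢0}} e<a) p≤N)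
      p∣ : p ^ suc a ∣ p ^ e
      p∣ with m≤n⇒∃[o]m+o≡n a<e
      ... | t , refl = subst (p ^ suc a ∣_) (sym (^-distribˡ-+-* p (suc a) t)) (Div.m∣m*n (p ^ t))

chebyshev-lower : ∀ ν → 2 ^ ν ≤ suc ν * length (primesTo (2 ^ suc ν))
chebyshev-lower ν = ≮⇒≥ λ lt → <⇒≱ (^-monoʳ-< 2 (s≤s (s≤s z≤n)) lt)
  (subst (2 ^ 2 ^ ν ≤_) (trans (cong (λ z → z ^ length (primesTo z)) eq) (^-*-assoc 2 (suc ν) (length (primesTo (2 ^ suc ν))))) (primesTo-lower (2 ^ ν) (m^n>0 2 ν)))
  where
  eq : 2 ^ ν + 2 ^ ν ≡ 2 ^ suc ν
  eq = cong (2 ^ ν +_) (sym (+-identityʳ (2 ^ ν)))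

-- Harmonic sums at powers of 2, and primes in intervals

S-mono< : ∀ n {f g} → (∀ i → i < n → f i ⊑ g i) → S n f ⊑ S n g
S-mono< zero h = ⊑-refl
S-mono< (suc n) h = ⊕-mono-⊑ (h 0 (s≤s z≤n)) (S-mono< n (λ i i<n → h (suc i) (s≤s i<n)))

H-double : ∀ n → H (n + n) ≡ H n ⊕ S n (λ i → rc (suc (n + i)))
H-double n = trans (Σ-range1 rc (n + n)) (trans (S-split (rc ∘ suc) n n) (cong (_⊕ S n (λ i → rc (suc (n + i)))) (sym (Σ-range1 rc n))))

2^suc : ∀ l → 2 ^ suc l ≡ 2 ^ l + 2 ^ l
2^suc l = cong (2 ^ l +_) (+-identityʳ (2 ^ l))

H-upper : ∀ l → H (2 ^ l) ⊑ ι (suc l)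
H-upper zero = ⊑-reflexive (cong (_⊕ 0ℚ) rc-1)
H-upper (suc l) = begin
  H (2 ^ suc l) ≡⟨ cong H (2^suc l) ⟩
  H (n + n) ≡⟨ H-double n ⟩
  H n ⊕ S n (λ i → rc (suc (n + i))) ≤⟨ ⊕-mono-⊑ (H-upper l) tail ⟩
  ι (suc l) ⊕ 1ℚ ≡⟨ ⊕-comm (ι (suc l)) 1ℚ ⟩
  ι (suc (suc l)) ∎
  where
  open ℚₚ.≤-Reasoning
  n = 2 ^ l
  1≤n = m^n>0 2 l
  tail : S n (λ i → rc (suc (n + i))) ⊑ 1ℚ
  tail = begin
    S n (λ i → rc (suc (n + i))) ≤⟨ S-mono n (λ i → rc-anti 1≤n (m≤n⇒m≤1+n (m≤m+n n i))) ⟩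
    S n (λ _ → rc n) ≡⟨ S-const n (rc n) ⟩
    ι n ⊗ rc n ≡⟨ ι-rc 1≤n ⟩
    1ℚ ∎

H-lower : ∀ l → ι l ⊑ 2ℚ ⊗ H (2 ^ l)
H-lower zero = ⊗-nonneg (0≤ι 2) (Σ-nonneg (range1 1) 0≤rc)
H-lower (suc l) = begin
  1ℚ ⊕ ι l ≤⟨ ⊕-mono-⊑ tail (H-lower l) ⟩
  2ℚ ⊗ T ⊕ 2ℚ ⊗ H n ≡⟨ trans (⊕-comm (2ℚ ⊗ T) (2ℚ ⊗ H n)) (sym (⊗-distribˡ-⊕ 2ℚ (H n) T)) ⟩
  2ℚ ⊗ (H n ⊕ T) ≡⟨ cong (2ℚ ⊗_) (sym (H-double n)) ⟩
  2ℚ ⊗ H (n + n) ≡⟨ cong (λ z → 2ℚ ⊗ H z) (sym (2^suc l)) ⟩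
  2ℚ ⊗ H (2 ^ suc l) ∎
  where
  open ℚₚ.≤-Reasoning
  n = 2 ^ l
  1≤n = m^n>0 2 l
  T = S n (λ i → rc (suc (n + i)))
  tail : 1ℚ ⊑ 2ℚ ⊗ T
  tail = begin
    1ℚ ≡⟨ sym (ι-rc {n + n} (≤-trans 1≤n (m≤m+n n n))) ⟩
    ι (n + n) ⊗ rc (n + n) ≡⟨ cong (_⊗ rc (n + n)) (ι-+ n n) ⟩
    (ι n ⊕ ι n) ⊗ rc (n + n) ≡⟨ solve 2 (λ a b → (a :+ a) :* b := con 2ℚ :* (a :* b)) refl (ι n) (rc (n + n)) ⟩
    2ℚ ⊗ (ι n ⊗ rc (n + n)) ≡⟨ cong (2ℚ ⊗_) (sym (S-const n (rc (n + n)))) ⟩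
    2ℚ ⊗ S n (λ _ → rc (n + n)) ≤⟨ ⊗-monoˡ (0≤ι 2) (S-mono< n (λ i i<n → rc-anti (s≤s z≤n) (subst (_≤ n + n) (+-suc n i) (+-monoʳ-≤ n i<n)))) ⟩
    2ℚ ⊗ T ∎

variable
  G : ℕ → Set

primesIn : Decidable G → ℕ → ℕ → List ℕ
primesIn G? lo hi = filter (λ p → (lo <? p) ×-dec G? p) (primesTo hi)

∈-primesIn⁺ : ∀ (G? : Decidable G) {lo hi p} → Prime p → lo < p → p ≤ hi → G p → p ∈ primesIn G? lo hi
∈-primesIn⁺ G? {lo} pr lo<p p≤hi g = Mem.∈-filter⁺ (λ p → (lo <? p) ×-dec G? p) (∈-primesTo⁺ pr p≤hi) (lo<p , g)

∈-primesIn⁻ : ∀ (G? : Decidable G) {lo hi p} → p ∈ primesIn G? lo hi → Prime p × lo < p × p ≤ hi × G p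
∈-primesIn⁻ G? {lo} {hi} m with Mem.∈-filter⁻ (λ p → (lo <? p) ×-dec G? p) {xs = primesTo hi} m
... | m' , lt , g with ∈-primesTo⁻ {n = hi} m'
... | pr , le = pr , lt , le , g

unique-primesIn : ∀ (G? : Decidable G) lo hi → Unique (primesIn G? lo hi)
unique-primesIn G? lo hi = Uniq.filter⁺ (λ p → (lo <? p) ×-dec G? p) (unique-primesTo hi)

any⊤? : Decidable (λ (_ : ℕ) → ⊤)
any⊤? _ = yes tt

Shifted : List ℕ → ℕ → Set
Shifted W p = Any (λ q → q ∣ p ∸ 1) W

shifted? : ∀ W → Decidable (Shifted W)
shifted? W p = Any.any? (λ q → q ∣? (p ∸ 1)) W

-- Primes p such that p - 1 has a prime factor in a given set

module Blocks (c K₀ : ℕ) (2≤c : 2 ≤ c) (K₀-large : 32 * 128 ≤ K₀) where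
  b : ℕ
  b = c * 8

  private
    1≤c : 1 ≤ c
    1≤c = <⇒≤ 2≤c

    -- Here Q ^ 4 = 2 ^ (b l), so the plain sieve bounds the primes in question by 32 * 2 ^ (b l) /
    -- log Q. The block above ends at 2 ^ b times this range, and 2 ^ b ≥ 2 ^ 12 = 32 * 128 pays for
    -- all constants.
    mid-bound : ∀ l → 1 ≤ l → ∀ xs → Unique xs → (∀ {p} → p ∈ xs → Prime p × 2 ^ (c * (l * 2)) < p × p ≤ 2 ^ (b * l)) → 16 * (b * suc l) * length xs ≤ 2 ^ (b * suc l)
    mid-bound l 1≤l xs u h = begin
      16 * (b * suc l) * m ≤⟨ *-monoˡ-≤ m (*-monoʳ-≤ 16 (*-monoʳ-≤ b l+1≤2l)) ⟩
      16 * (b * (l * 2)) * m ≡⟨ lem₁ c (l * 2) m ⟩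
      128 * (m * (c * (l * 2))) ≤⟨ *-monoʳ-≤ 128 step ⟩
      128 * (32 * 2 ^ (b * l)) ≡⟨ lem₂ (2 ^ (b * l)) ⟩
      2 ^ 12 * 2 ^ (b * l) ≡⟨ sym (^-distribˡ-+-* 2 12 (b * l)) ⟩
      2 ^ (12 + b * l) ≤⟨ ^-monoʳ-≤ 2 (≤-trans (+-monoˡ-≤ (b * l) 12≤b) (≤-reflexive (sym (*-suc b l)))) ⟩
      2 ^ (b * suc l) ∎
      where
      open ℕₚ.≤-Reasoning
      m = length xs
      e = c * (l * 2)
      Q = 2 ^ e
      N = suc (2 ^ (b * l))
      12≤b : 12 ≤ b
      12≤b = ≤-trans (m≤m+n 12 4) (*-monoˡ-≤ 8 2≤c)
      l+1≤2l : suc l ≤ l * 2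
      l+1≤2l = ≤-trans (+-monoˡ-≤ l 1≤l) (≤-reflexive (lem l))
        where
        lem : ∀ l → l + l ≡ l * 2
        lem = solve-∀
      lem₁ : ∀ c x m → 16 * (c * 8 * x) * m ≡ 128 * (m * (c * x))
      lem₁ = solve-∀
      lem₂ : ∀ x → 128 * (32 * x) ≡ 4096 * x
      lem₂ = solve-∀
      Q⁴ : Q * Q * (Q * Q) ≤ N
      Q⁴ = ≤-trans (≤-reflexive (trans (sym (trans (^-distribˡ-+-* 2 (e + e) (e + e)) (cong₂ _*_ (^-distribˡ-+-* 2 e e) (^-distribˡ-+-* 2 e e)))) (cong (2 ^_) (lem c l)))) (n≤1+n _)
        where
        lem : ∀ c l → c * (l * 2) + c * (l * 2) + (c * (l * 2) + c * (l * 2)) ≡ c * 8 * l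
        lem = solve-∀
      step : m * e ≤ 32 * 2 ^ (b * l)
      step = ≤-trans (ι-cancel-≤ (⊑-trans (⊑-reflexive (ι-* m e)) (⊑-trans (⊗-monoˡ (0≤ι m) (H-lower e))
         (⊑-trans (⊑-reflexive (solve 2 (λ m h → m :* (con 2ℚ :* h) := con 2ℚ :* (m :* h)) refl (ι m) (H Q)))
         (⊑-trans (⊗-monoˡ (0≤ι 2) (primes-upper {Q} {N} xs (m^n>0 2 e) Q⁴ u (λ m → let a , b , c = h m in s≤s c , a , b)))
          (⊑-reflexive (trans (cong (2ℚ ⊗_) (sym (ι-* 8 N))) (sym (ι-* 2 (8 * N))))))))))
          (≤-trans (*-monoʳ-≤ 2 (*-monoʳ-≤ 8 (+-monoˡ-≤ (2 ^ (b * l)) (m^n>0 2 (b * l))))) (≤-reflexive (lem₃ (2 ^ (b * l)))))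
        where
        lem₃ : ∀ x → 2 * (8 * (x + x)) ≡ 32 * x
        lem₃ = solve-∀

    small-bound : ∀ l → 1 ≤ l → 16 * (b * suc l) * 2 ^ (c * (l * 2)) ≤ 2 ^ (b * suc l)
    small-bound l 1≤l = begin
      16 * (b * suc l) * 2 ^ (c * (l * 2)) ≤⟨ *-mono-≤ (≤-trans (≤-reflexive (lem₁ c (suc l))) (*-monoʳ-≤ 128 (<⇒≤ (n<b^n {2} ≤-refl y))))
                                              (^-monoʳ-≤ 2 (*-monoʳ-≤ c (*-monoˡ-≤ 2 (n≤1+n l)))) ⟩
      2 ^ 7 * 2 ^ y * 2 ^ (c * (suc l * 2)) ≡⟨ sym (trans (^-distribˡ-+-* 2 (7 + y) (c * (suc l * 2))) (cong (_* 2 ^ (c * (suc l * 2))) (^-distribˡ-+-* 2 7 y))) ⟩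
      2 ^ (7 + y + c * (suc l * 2)) ≤⟨ ^-monoʳ-≤ 2 (≤-trans (+-monoˡ-≤ (c * (suc l * 2)) (+-monoˡ-≤ y 7≤5y)) (≤-reflexive (lem₂ c (suc l)))) ⟩
      2 ^ (b * suc l) ∎
      where
      open ℕₚ.≤-Reasoning
      y = c * suc l
      7≤5y : 7 ≤ 5 * y
      7≤5y = ≤-trans (m≤m+n 7 13) (*-monoʳ-≤ 5 (*-mono-≤ 2≤c (s≤s 1≤l)))
      lem₁ : ∀ c x → 16 * (c * 8 * x) ≡ 128 * (c * x)
      lem₁ = solve-∀
      lem₂ : ∀ c x → 5 * (c * x) + c * x + c * (x * 2) ≡ c * 8 * x
      lem₂ = solve-∀

    -- With Q₁ = 2 ^ (c (l + 1)) bounding W and Q = Q₁², one has q Q₁ ≤ Q, and Q ^ 4 is the upper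
    -- end of the block; this is why b = 8 c. In K₀ ≥ 32 * 128, the 32 collects the sieve constant
    -- 8, the halving in `H-lower` and N ≤ 2 X, while 128 = 16 * 8 turns 16 b into 128 c.
    bad-bound : ∀ l → 1 ≤ l → ∀ W → Unique W → (∀ {q} → q ∈ W → Prime q × q ≤ 2 ^ (c * suc l)) → ι K₀ ⊑ Σ W rc →
      ∀ xs → Unique xs → (∀ {p} → p ∈ xs → Prime p × 2 ^ (b * l) < p × p ≤ 2 ^ (b * suc l) × (∀ {q} → q ∈ W → q ∤ p ∸ 1)) → 16 * (b * suc l) * length xs ≤ 2 ^ (b * suc l)
    bad-bound l 1≤l W uW hW K≤ xs u h = *-cancelˡ-≤ 32 (begin
      32 * (16 * (b * suc l) * m) ≡⟨ lem₁ c (suc l) m ⟩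
      m * (32 * 128 * y) ≤⟨ *-monoʳ-≤ m (*-monoˡ-≤ y K₀-large) ⟩
      m * (K₀ * y) ≤⟨ step ⟩
      2 * (8 * N) ≤⟨ *-monoʳ-≤ 2 (*-monoʳ-≤ 8 (+-monoˡ-≤ X (m^n>0 2 (b * suc l)))) ⟩
      2 * (8 * (X + X)) ≡⟨ lem₃ X ⟩
      32 * X ∎)
      where
      open ℕₚ.≤-Reasoning
      m = length xs
      y = c * suc l
      X = 2 ^ (b * suc l)
      N = suc X
      e = c * (suc l * 2)
      Q = 2 ^ e
      Q₁ = 2 ^ y
      lem₁ : ∀ c x m → 32 * (16 * (c * 8 * x) * m) ≡ m * (32 * 128 * (c * x))
      lem₁ = solve-∀
      lem₃ : ∀ x → 2 * (8 * (x + x)) ≡ 32 * x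
      lem₃ = solve-∀
      Q₁² : Q₁ * Q₁ ≡ Q
      Q₁² = trans (sym (^-distribˡ-+-* 2 y y)) (cong (2 ^_) (lem c (suc l)))
        where
        lem : ∀ c x → c * x + c * x ≡ c * (x * 2)
        lem = solve-∀
      Q₁≤Q : Q₁ ≤ Q
      Q₁≤Q = ≤-trans (m≤m*n Q₁ Q₁ {{m^n≢0 2 y}}) (≤-reflexive Q₁²)
      Q⁴ : Q * Q * (Q * Q) ≤ N
      Q⁴ = ≤-trans (≤-reflexive (trans (sym (trans (^-distribˡ-+-* 2 (e + e) (e + e)) (cong₂ _*_ (^-distribˡ-+-* 2 e e) (^-distribˡ-+-* 2 e e)))) (cong (2 ^_) (lem c (suc l))))) (n≤1+n _)
        where
        lem : ∀ c l → c * (l * 2) + c * (l * 2) + (c * (l * 2) + c * (l * 2)) ≡ c * 8 * l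
        lem = solve-∀
      w : ℕ → Bool
      w q = does (Any.any? (q ≟_) W)
      w⁻ : ∀ {q} → w q ≡ true → q ∈ W
      w⁻ {q} eq with Any.any? (q ≟_) W
      ... | yes m = m
      w⁺ : ∀ {q} → q ∈ W → w q ≡ true
      w⁺ {q} m with Any.any? (q ≟_) W
      ... | yes _ = refl
      ... | no ¬m = ⊥-elim (¬m m)
      K = Σ (primesTo Q) (λ p → γ w p ⊗ rc p)
      K₀≤K : ι K₀ ⊑ K
      K₀≤K = ⊑-trans K≤ (⊑-trans (⊑-reflexive (Σ-cong W (λ {q} m → sym (trans (cong (λ t → (if t then 1ℚ else 0ℚ) ⊗ rc q) (w⁺ m)) (⊗-identityˡ (rc q))))))
        (Σ-⊆ uW (λ m → ∈-primesTo⁺ (proj₁ (hW m)) (≤-trans (proj₂ (hW m)) Q₁≤Q)) (λ p → ⊗-nonneg (0≤γ w p) (0≤rc p))))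
      Q<p : ∀ {p} → 2 ^ (b * l) < p → Q < p
      Q<p lt = ≤-<-trans (^-monoʳ-≤ 2 (≤-trans (*-monoʳ-≤ c (*-monoˡ-≤ 2 (+-monoˡ-≤ l 1≤l))) (≤-trans (≤-reflexive (lem₄ c l)) (*-monoˡ-≤ l (*-monoʳ-≤ c (m≤m+n 4 4)))))) lt
        where
        lem₄ : ∀ c l → c * ((l + l) * 2) ≡ c * 4 * l
        lem₄ = solve-∀
      upper : ι m ⊗ (K ⊗ H Q₁) ⊑ 8ℚ ⊗ ι N
      upper = shifted-primes-upper w {Q} {Q₁} {N} xs (m^n>0 2 e) Q⁴ Q₁≤Q (λ {p} _ eq _ → ≤-trans (*-monoˡ-≤ Q₁ (proj₂ (hW (w⁻ eq)))) (≤-reflexive Q₁²)) u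
        (λ m → let pr , lo , hi , nd = h m in s≤s hi , pr , Q<p lo , λ _ _ eq → nd (w⁻ eq))
      step : m * (K₀ * y) ≤ 2 * (8 * N)
      step = ι-cancel-≤ (⊑-trans (⊑-reflexive (trans (ι-* m (K₀ * y)) (cong (ι m ⊗_) (ι-* K₀ y))))
        (⊑-trans (⊗-monoˡ (0≤ι m) (⊗-mono (0≤ι K₀) (⊗-nonneg (0≤ι 2) (Σ-nonneg (range1 Q₁) 0≤rc)) K₀≤K (H-lower y)))
        (⊑-trans (⊑-reflexive (solve 3 (λ m k h → m :* (k :* (con 2ℚ :* h)) := con 2ℚ :* (m :* (k :* h))) refl (ι m) K (H Q₁)))
        (⊑-trans (⊗-monoˡ (0≤ι 2) upper)
         (⊑-reflexive (trans (cong (2ℚ ⊗_) (sym (ι-* 8 N))) (sym (ι-* 2 (8 * N)))))))))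

    -- Chebyshev gives X ≤ 2 β π(X). The primes up to Q, those in (Q, Y] and the bad ones each
    -- number at most X / (16 β), so 16 X ≤ 6 X + 32 β good.
    count : ∀ l → 1 ≤ l → ∀ {G} (G? : Decidable G) → 16 * (b * suc l) * length (primesIn (¬? ∘ G?) (2 ^ (b * l)) (2 ^ (b * suc l))) ≤ 2 ^ (b * suc l) →
      2 ^ (b * suc l) ≤ 4 * (b * suc l) * length (primesIn G? (2 ^ (b * l)) (2 ^ (b * suc l)))
    count l 1≤l {G} G? badBound = *-cancelˡ-≤ 8 (+-cancelˡ-≤ (6 * X) _ _ (begin
      6 * X + 8 * X ≤⟨ ≤-trans (m≤m+n (6 * X + 8 * X) (2 * X)) (≤-reflexive (l₀ X)) ⟩
      16 * X ≤⟨ *-monoʳ-≤ 16 cheb ⟩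
      16 * (2 * (β * π)) ≤⟨ *-monoʳ-≤ 16 (*-monoʳ-≤ 2 (*-monoʳ-≤ β π≤)) ⟩
      16 * (2 * (β * (Q + (mid + (bad + good))))) ≡⟨ l₁ β Q mid bad good ⟩
      2 * (16 * β * Q) + 2 * (16 * β * mid) + 2 * (16 * β * bad) + 8 * (4 * β * good) ≤⟨ +-monoˡ-≤ (8 * (4 * β * good))
          (+-mono-≤ (+-mono-≤ (*-monoʳ-≤ 2 (small-bound l 1≤l)) (*-monoʳ-≤ 2 (mid-bound l 1≤l midL (Uniq.filter⁺ (Q <?_) (unique-primesTo Y)) midP))) (*-monoʳ-≤ 2 badBound)) ⟩
      2 * X + 2 * X + 2 * X + 8 * (4 * β * good) ≡⟨ l₂ X (8 * (4 * β * good)) ⟩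
      6 * X + 8 * (4 * β * good) ∎))
      where
      open ℕₚ.≤-Reasoning
      X = 2 ^ (b * suc l)
      β = b * suc l
      π = length (primesTo X)
      Q = 2 ^ (c * (l * 2))
      Y = 2 ^ (b * l)
      midL = filter (Q <?_) (primesTo Y)
      mid = length midL
      midP : ∀ {p} → p ∈ midL → Prime p × Q < p × p ≤ Y
      midP m with Mem.∈-filter⁻ (Q <?_) {xs = primesTo Y} m
      ... | a , lt with ∈-primesTo⁻ {n = Y} a
      ... | pr , le = pr , lt , le
      badL = primesIn (¬? ∘ G?) Y X
      bad = length badL
      goodL = primesIn G? Y X
      good = length goodL
      l₀ : ∀ x → 6 * x + 8 * x + 2 * x ≡ 16 * x
      l₀ = solve-∀
      l₁ : ∀ β q m b g → 16 * (2 * (β * (q + (m + (b + g))))) ≡ 2 * (16 * β * q) + 2 * (16 * β * m) + 2 * (16 * β * b) + 8 * (4 * β * g)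
      l₁ = solve-∀
      l₂ : ∀ x y → 2 * x + 2 * x + 2 * x + y ≡ 6 * x + y
      l₂ = solve-∀
      1≤β : 1 ≤ β
      1≤β = *-mono-≤ (*-mono-≤ 1≤c (s≤s {n = 7} z≤n)) (s≤s {n = l} z≤n)
      cheb : X ≤ 2 * (β * π)
      cheb = lem β 1≤β
        where
        lem : ∀ β → 1 ≤ β → 2 ^ β ≤ 2 * (β * length (primesTo (2 ^ β)))
        lem (suc ν) _ = *-monoʳ-≤ 2 (chebyshev-lower ν)
      π≤ : π ≤ Q + (mid + (bad + good))
      π≤ = ≤-trans (unique-⊆-length (unique-primesTo X) sub) (≤-reflexive
           (trans (Listₚ.length-++ (range1 Q)) (cong₂ _+_ (length-range1 Q) (trans (Listₚ.length-++ midL) (cong (mid +_) (Listₚ.length-++ badL))))))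
        where
        sub : ∀ {z} → z ∈ primesTo X → z ∈ range1 Q ++ (midL ++ (badL ++ goodL))
        sub {z} z∈ with ∈-primesTo⁻ {n = X} z∈
        ... | pr , z≤X with Q <? z | Y <? z | G? z
        ...   | no ¬lt | _ | _ = Mem.∈-++⁺ˡ (∈-range1⁺ (prime≥1 pr) (≮⇒≥ ¬lt))
        ...   | yes Q<z | no ¬lt | _ = Mem.∈-++⁺ʳ (range1 Q) (Mem.∈-++⁺ˡ (Mem.∈-filter⁺ (Q <?_) (∈-primesTo⁺ pr (≮⇒≥ ¬lt)) Q<z))
        ...   | yes Q<z | yes Y<z | yes g = Mem.∈-++⁺ʳ (range1 Q) (Mem.∈-++⁺ʳ midL (Mem.∈-++⁺ʳ badL (∈-primesIn⁺ G? pr Y<z z≤X g)))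
        ...   | yes Q<z | yes Y<z | no ¬g = Mem.∈-++⁺ʳ (range1 Q) (Mem.∈-++⁺ʳ midL (Mem.∈-++⁺ˡ (∈-primesIn⁺ (¬? ∘ G?) pr Y<z z≤X ¬g)))

  blockOf : Decidable G → ℕ → List ℕ
  blockOf G? l = primesIn G? (2 ^ (b * l)) (2 ^ (b * suc l))

  block-all : ∀ l → 1 ≤ l → 2 ^ (b * suc l) ≤ 4 * (b * suc l) * length (blockOf any⊤? l)
  block-all l 1≤l = count l 1≤l any⊤? (subst (λ n → 16 * (b * suc l) * n ≤ 2 ^ (b * suc l)) (sym (empty _ none)) (subst (_≤ 2 ^ (b * suc l)) (sym (*-zeroʳ (16 * (b * suc l)))) z≤n))
    where
    none : ∀ {z} → z ∉ primesIn (¬? ∘ any⊤?) (2 ^ (b * l)) (2 ^ (b * suc l))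
    none m = proj₂ (proj₂ (proj₂ (∈-primesIn⁻ (¬? ∘ any⊤?) {2 ^ (b * l)} {2 ^ (b * suc l)} m))) tt
    empty : ∀ (xs : List ℕ) → (∀ {z} → z ∉ xs) → length xs ≡ 0
    empty [] h = refl
    empty (x ∷ xs) h = ⊥-elim (h (here refl))

  block-shifted : ∀ l → 1 ≤ l → ∀ W → Unique W → (∀ {q} → q ∈ W → Prime q × q ≤ 2 ^ (c * suc l)) → ι K₀ ⊑ Σ W rc →
    2 ^ (b * suc l) ≤ 4 * (b * suc l) * length (blockOf (shifted? W) l)
  block-shifted l 1≤l W uW hW K≤ = count l 1≤l (shifted? W) (bad-bound l 1≤l W uW hW K≤ (primesIn (¬? ∘ shifted? W) (2 ^ (b * l)) (2 ^ (b * suc l))) (unique-primesIn (¬? ∘ shifted? W) (2 ^ (b * l)) (2 ^ (b * suc l)))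
    (λ m → let pr , lo , hi , ng = ∈-primesIn⁻ (¬? ∘ shifted? W) {2 ^ (b * l)} {2 ^ (b * suc l)} m in pr , lo , hi , λ q∈ q∣ → ng (Any.map (λ { refl → q∣ }) q∈)))

-- Reciprocal sums of primes over ranges of exponents

Σ-primesIn-split : ∀ (G? : Decidable G) {lo mid hi} → lo ≤ mid → mid ≤ hi →
  Σ (primesIn G? lo mid) rc ⊕ Σ (primesIn G? mid hi) rc ⊑ Σ (primesIn G? lo hi) rc
Σ-primesIn-split G? {lo} {mid} {hi} lo≤mid mid≤hi = ⊑-trans (⊑-reflexive (sym (Σ-++ (primesIn G? lo mid) (primesIn G? mid hi) rc)))
  (Σ-⊆ (Uniq.++⁺ (unique-primesIn G? lo mid) (unique-primesIn G? mid hi) disj) sub 0≤rc)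
  where
  disj : ∀ {z} → ¬ (z ∈ primesIn G? lo mid × z ∈ primesIn G? mid hi)
  disj (a , c) = <⇒≱ (proj₁ (proj₂ (∈-primesIn⁻ G? {mid} {hi} c))) (proj₁ (proj₂ (proj₂ (∈-primesIn⁻ G? {lo} {mid} a))))
  sub : ∀ {z} → z ∈ primesIn G? lo mid ++ primesIn G? mid hi → z ∈ primesIn G? lo hi
  sub m with Mem.∈-++⁻ (primesIn G? lo mid) m
  ... | inj₁ a = let pr , l , u , g = ∈-primesIn⁻ G? {lo} {mid} a in ∈-primesIn⁺ G? pr l (≤-trans u mid≤hi) g
  ... | inj₂ a = let pr , l , u , g = ∈-primesIn⁻ G? {mid} {hi} a in ∈-primesIn⁺ G? pr (≤-<-trans lo≤mid l) u g

module Ranges (b : ℕ) where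
  E : ℕ → ℕ
  E e = 2 ^ (b * e)

  E-mono : ∀ {e e'} → e ≤ e' → E e ≤ E e'
  E-mono le = ^-monoʳ-≤ 2 (*-monoʳ-≤ b le)

  1≤E : ∀ e → 1 ≤ E e
  1≤E e = m^n>0 2 (b * e)

  E-+ : ∀ d e → E (d + e) ≡ E d * E e
  E-+ d e = trans (cong (2 ^_) (*-distribˡ-+ b d e)) (^-distribˡ-+-* 2 (b * d) (b * e))

  block-sum : ∀ (G? : Decidable G) k l → E (suc l) ≤ k * length (primesIn G? (E l) (E (suc l))) → 1ℚ ⊑ ι k ⊗ Σ (primesIn G? (E l) (E (suc l))) rc
  block-sum G? k l le = begin
    1ℚ ≡⟨ sym (ι-rc (1≤E (suc l))) ⟩
    ι X ⊗ rc X ≤⟨ ⊗-monoʳ (0≤rc X) (ι-mono le) ⟩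
    ι (k * length L) ⊗ rc X ≡⟨ trans (cong (_⊗ rc X) (ι-* k (length L))) (⊗-assoc (ι k) (ι (length L)) (rc X)) ⟩
    ι k ⊗ (ι (length L) ⊗ rc X) ≡⟨ cong (ι k ⊗_) (sym (Σ-const L (rc X))) ⟩
    ι k ⊗ Σ L (λ _ → rc X) ≤⟨ ⊗-monoˡ (0≤ι k) (Σ-mono L (λ m → let pr , _ , p≤X , _ = ∈-primesIn⁻ G? {E l} {X} m in rc-anti (prime≥1 pr) p≤X)) ⟩
    ι k ⊗ Σ L rc ∎
    where
    open ℚₚ.≤-Reasoning
    X = E (suc l)
    L = primesIn G? (E l) X

  -- Block l contributes at least 1 / (κ (l + 1)) ≥ 1 / (κ (e + d)). This is a discrete form of log
  -- ((e + d) / e) ≥ d / (e + d).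
  range-sum : ∀ (G? : Decidable G) κ e → (∀ l → e ≤ l → E (suc l) ≤ κ * suc l * length (primesIn G? (E l) (E (suc l)))) →
    ∀ d → ι d ⊑ ι (κ * (e + d)) ⊗ Σ (primesIn G? (E e) (E (e + d))) rc
  range-sum G? κ e h zero = ⊗-nonneg (0≤ι (κ * (e + 0))) (Σ-nonneg (primesIn G? (E e) (E (e + 0))) 0≤rc)
  range-sum G? κ e h (suc d) = subst (λ z → ι (suc d) ⊑ ι (κ * z) ⊗ Σ (primesIn G? (E e) (E z)) rc) (sym (+-suc e d)) (begin
    1ℚ ⊕ ι d ≤⟨ ⊕-mono-⊑ (block-sum G? k (e + d) (h (e + d) (m≤m+n e d))) (⊑-trans (range-sum G? κ e h d) (⊗-monoʳ (Σ-nonneg A 0≤rc) (ι-mono (*-monoʳ-≤ κ (n≤1+n (e + d)))))) ⟩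
    ι k ⊗ Σ B rc ⊕ ι k ⊗ Σ A rc ≡⟨ trans (⊕-comm (ι k ⊗ Σ B rc) (ι k ⊗ Σ A rc)) (sym (⊗-distribˡ-⊕ (ι k) (Σ A rc) (Σ B rc))) ⟩
    ι k ⊗ (Σ A rc ⊕ Σ B rc) ≤⟨ ⊗-monoˡ (0≤ι k) (Σ-primesIn-split G? (E-mono (m≤m+n e d)) (E-mono (n≤1+n (e + d)))) ⟩
    ι k ⊗ Σ (primesIn G? (E e) (E (suc (e + d)))) rc ∎)
    where
    open ℚₚ.≤-Reasoning
    k = κ * suc (e + d)
    A = primesIn G? (E e) (E (e + d))
    B = primesIn G? (E (e + d)) (E (suc (e + d)))

  double-sum : ∀ (G? : Decidable G) κ e → 1 ≤ e → (∀ l → e ≤ l → E (suc l) ≤ κ * suc l * length (primesIn G? (E l) (E (suc l)))) →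
    1ℚ ⊑ ι (κ * 2) ⊗ Σ (primesIn G? (E e) (E (e + e))) rc
  double-sum G? κ e 1≤e h = ⊗-cancelˡ 1≤e (begin
    ι e ⊗ 1ℚ ≡⟨ ⊗-identityʳ (ι e) ⟩
    ι e ≤⟨ range-sum G? κ e h e ⟩
    ι (κ * (e + e)) ⊗ s ≡⟨ trans (cong (λ z → ι z ⊗ s) (lem κ e)) (trans (cong (_⊗ s) (ι-* e (κ * 2))) (⊗-assoc (ι e) (ι (κ * 2)) s)) ⟩
    ι e ⊗ (ι (κ * 2) ⊗ s) ∎)
    where
    open ℚₚ.≤-Reasoning
    s = Σ (primesIn G? (E e) (E (e + e))) rc
    lem : ∀ κ e → κ * (e + e) ≡ e * (κ * 2)
    lem = solve-∀

-- Windows, and the analytic input to the construction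

remove : List ℕ → List ℕ → List ℕ
remove used = filter (λ q → ¬? (Any.any? (q ≟_) used))

-- All that the construction needs from prime number theory, with abstract constants. `good-sum`
-- says that primes p with p - 1 divisible by a fresh prime of the window keep a positive share of
-- the reciprocal sum of all primes, from exponent C u on.
record Key : Set where
  field
    b width C κ : ℕ
    1≤b : 1 ≤ b
    2≤width : 2 ≤ width
    1≤C : 1 ≤ C
    1≤κ : 1 ≤ κ
  open Ranges b public
  window : ℕ → List ℕ
  window u = primesIn any⊤? (E u) (E (width * u))
  field
    block-count : ∀ l → 1 ≤ l → E (suc l) ≤ κ * suc l * length (primesIn any⊤? (E l) (E (suc l)))
    good-sum : ∀ u used e d → 1 ≤ u → length used ≤ E u → C * u ≤ e →
      ι d ⊑ ι (κ * (e + d)) ⊗ Σ (primesIn (shifted? (remove used (window u))) (E e) (E (e + d))) rc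

private
  -- Each doubling of the exponent adds at least 1 / (2 κ') to the reciprocal sum, so h = 2 κ' (K₀ +
  -- 1) doublings give a window of sum at least K₀ + 1. C = 8 * width ensures q ≤ 2 ^ (c (l + 1))
  -- for all q in the window and all blocks l ≥ C u.
  key′ : ∀ c K₀ → 2 ≤ c → 32 * 128 ≤ K₀ → Key
  key′ c K₀ 2≤c K₀-large = record
    { b = b ; width = H' ; C = 8 * H' ; κ = κ' ; 1≤b = 1≤b' ; 2≤width = 2≤H' ; 1≤C = *-mono-≤ (s≤s {n = 7} z≤n) (<⇒≤ 2≤H') ; 1≤κ = *-mono-≤ (s≤s {n = 3} z≤n) 1≤b'
    ; block-count = λ l 1≤l → subst (λ z → E (suc l) ≤ z * length (primesIn any⊤? (E l) (E (suc l)))) (sym (*-assoc 4 b (suc l))) (block-all l 1≤l)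
    ; good-sum = good }
    where
    open Blocks c K₀ 2≤c K₀-large using (b; block-all; block-shifted)
    open Ranges b
    1≤b' : 1 ≤ b
    1≤b' = *-mono-≤ (<⇒≤ 2≤c) (s≤s {n = 7} z≤n)
    κ' = 4 * b
    h = κ' * 2 * suc K₀
    H' = 2 ^ h
    2≤H' : 2 ≤ H'
    2≤H' = ^-monoʳ-≤ 2 {1} {h} (*-mono-≤ (*-mono-≤ (*-mono-≤ (s≤s {n = 3} z≤n) 1≤b') (s≤s {n = 1} z≤n)) (s≤s {n = K₀} z≤n))
    win : ℕ → List ℕ
    win u = primesIn any⊤? (E u) (E (H' * u))
    window-sum : ∀ u → 1 ≤ u → ∀ i → ι i ⊑ ι (κ' * 2) ⊗ Σ (primesIn any⊤? (E u) (E (2 ^ i * u))) rc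
    window-sum u 1≤u zero = ⊗-nonneg (0≤ι (κ' * 2)) (Σ-nonneg (primesIn any⊤? (E u) (E (2 ^ 0 * u))) 0≤rc)
    window-sum u 1≤u (suc i) = subst (λ z → ι (suc i) ⊑ ι (κ' * 2) ⊗ Σ (primesIn any⊤? (E u) (E z)) rc) (lem (2 ^ i) u) (begin
      1ℚ ⊕ ι i ≤⟨ ⊕-mono-⊑ (double-sum any⊤? κ' e 1≤e (λ l e≤l → subst (λ z → E (suc l) ≤ z * length (primesIn any⊤? (E l) (E (suc l)))) (sym (*-assoc 4 b (suc l))) (block-all l (≤-trans 1≤e e≤l)))) (window-sum u 1≤u i) ⟩
      k ⊗ s₂ ⊕ k ⊗ s₁ ≡⟨ trans (⊕-comm (k ⊗ s₂) (k ⊗ s₁)) (sym (⊗-distribˡ-⊕ k s₁ s₂)) ⟩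
      k ⊗ (s₁ ⊕ s₂) ≤⟨ ⊗-monoˡ (0≤ι (κ' * 2)) (Σ-primesIn-split any⊤? (E-mono (m≤n*m u (2 ^ i) {{m^n≢0 2 i}})) (E-mono (m≤m+n e e))) ⟩
      k ⊗ Σ (primesIn any⊤? (E u) (E (e + e))) rc ∎)
      where
      open ℚₚ.≤-Reasoning
      e = 2 ^ i * u
      1≤e : 1 ≤ e
      1≤e = *-mono-≤ (m^n>0 2 i) 1≤u
      k = ι (κ' * 2)
      s₁ = Σ (primesIn any⊤? (E u) (E e)) rc
      s₂ = Σ (primesIn any⊤? (E e) (E (e + e))) rc
      lem : ∀ x u → x * u + x * u ≡ 2 * x * u
      lem = solve-∀
    window-large : ∀ u → 1 ≤ u → ι (suc K₀) ⊑ Σ (win u) rc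
    window-large u 1≤u = ⊗-cancelˡ {κ' * 2} (*-mono-≤ (*-mono-≤ (s≤s {n = 3} z≤n) 1≤b') (s≤s {n = 1} z≤n)) (subst (_⊑ ι (κ' * 2) ⊗ Σ (win u) rc) (ι-* (κ' * 2) (suc K₀)) (window-sum u 1≤u h))
    -- At most E u primes are excluded and those in the window exceed E u, so excluding them costs
    -- at most 1 of the K₀ + 1.
    rest-large : ∀ u used → 1 ≤ u → length used ≤ E u → ι K₀ ⊑ Σ (remove used (win u)) rc
    rest-large u used 1≤u len = cancel (begin
      1ℚ ⊕ ι K₀ ≤⟨ window-large u 1≤u ⟩
      Σ (win u) rc ≤⟨ Σ-⊆ (unique-primesIn any⊤? (E u) (E (H' * u))) sub 0≤rc ⟩
      Σ (U ++ R) rc ≡⟨ Σ-++ U R rc ⟩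
      Σ U rc ⊕ Σ R rc ≤⟨ ⊕-monoˡ-⊑ (Σ R rc) usedBound ⟩
      1ℚ ⊕ Σ R rc ∎)
      where
      open ℚₚ.≤-Reasoning
      U = filter (E u <?_) used
      R = remove used (win u)
      cancel : 1ℚ ⊕ ι K₀ ⊑ 1ℚ ⊕ Σ R rc → ι K₀ ⊑ Σ R rc
      cancel le = subst₂ _⊑_ (lem (ι K₀)) (lem (Σ R rc)) (⊕-monoʳ-⊑ (⊖ 1ℚ) le)
        where
        lem : ∀ x → ⊖ 1ℚ ⊕ (1ℚ ⊕ x) ≡ x
        lem x = solve 1 (λ x → con (⊖ 1ℚ) :+ (con 1ℚ :+ x) := x) refl x
      sub : ∀ {z} → z ∈ win u → z ∈ U ++ R
      sub {z} m with Any.any? (z ≟_) used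
      ... | yes z∈ = Mem.∈-++⁺ˡ (Mem.∈-filter⁺ (E u <?_) z∈ (proj₁ (proj₂ (∈-primesIn⁻ any⊤? {E u} {E (H' * u)} m))))
      ... | no z∉ = Mem.∈-++⁺ʳ U (Mem.∈-filter⁺ (λ q → ¬? (Any.any? (q ≟_) used)) m z∉)
      usedBound : Σ U rc ⊑ 1ℚ
      usedBound = begin
        Σ U rc ≤⟨ Σ-mono U (λ m → rc-anti (1≤E u) (<⇒≤ (proj₂ (Mem.∈-filter⁻ (E u <?_) {xs = used} m)))) ⟩
        Σ U (λ _ → rc (E u)) ≡⟨ Σ-const U (rc (E u)) ⟩
        ι (length U) ⊗ rc (E u) ≤⟨ ⊗-monoʳ (0≤rc (E u)) (ι-mono (≤-trans (Listₚ.length-filter (E u <?_) used) len)) ⟩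
        ι (E u) ⊗ rc (E u) ≡⟨ ι-rc (1≤E u) ⟩
        1ℚ ∎
    good : ∀ u used e d → 1 ≤ u → length used ≤ E u → 8 * H' * u ≤ e →
      ι d ⊑ ι (κ' * (e + d)) ⊗ Σ (primesIn (shifted? (remove used (win u))) (E e) (E (e + d))) rc
    good u used e d 1≤u len Cu≤e = range-sum (shifted? W) κ' e (λ l e≤l → subst (λ z → E (suc l) ≤ z * length (primesIn (shifted? W) (E l) (E (suc l)))) (sym (*-assoc 4 b (suc l)))
        (block-shifted l (≤-trans 1≤e e≤l) W (Uniq.filter⁺ (λ q → ¬? (Any.any? (q ≟_) used)) (unique-primesIn any⊤? (E u) (E (H' * u)))) (inW e≤l) (rest-large u used 1≤u len))) d
      where
      W = remove used (win u)
      1≤e : 1 ≤ e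
      1≤e = ≤-trans (*-mono-≤ (*-mono-≤ (s≤s {n = 7} z≤n) (<⇒≤ 2≤H')) 1≤u) Cu≤e
      inW : ∀ {l} → e ≤ l → ∀ {q} → q ∈ W → Prime q × q ≤ 2 ^ (c * suc l)
      inW {l} e≤l m with ∈-primesIn⁻ any⊤? {E u} {E (H' * u)} (proj₁ (Mem.∈-filter⁻ (λ q → ¬? (Any.any? (q ≟_) used)) {xs = win u} m))
      ... | pr , _ , q≤ , _ = pr , ≤-trans q≤ (^-monoʳ-≤ 2 (≤-trans (≤-reflexive (lem c H' u)) (*-monoʳ-≤ c (≤-trans Cu≤e (m≤n⇒m≤1+n e≤l)))))
        where
        lem : ∀ c H u → c * 8 * (H * u) ≡ c * (8 * H * u)
        lem = solve-∀

key : Key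
key = key′ 2 (32 * 128) ≤-refl ≤-refl

-- Distinct products, and the density of integers failing a window

unique-products : ∀ {X : Set} (τ : X → ℕ) (f : X → List ℕ) (xs : List X) → Unique (map τ xs) → (∀ {x} → x ∈ xs → 1 ≤ τ x × Unique (f x)) →
  (∀ {x x' p p'} → x ∈ xs → x' ∈ xs → p ∈ f x → p' ∈ f x' → τ x * p ≡ τ x' * p' → τ x ≡ τ x') →
  Unique (concatMap (λ x → map (τ x *_) (f x)) xs)
unique-products τ f [] _ _ _ = []
unique-products τ f (x ∷ xs) (nx ∷ u) h inj = Uniq.++⁺
  (Uniq.map⁺ (λ {a} {b} → *-cancelˡ-≡ a b (τ x) {{>-nonZero (proj₁ (h (here refl)))}}) (proj₂ (h (here refl))))
  (unique-products τ f xs u (λ m → h (there m)) (λ a b → inj (there a) (there b)))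
  disj
  where
  disj : ∀ {z} → ¬ (z ∈ map (τ x *_) (f x) × z ∈ concatMap (λ x → map (τ x *_) (f x)) xs)
  disj {z} (a , c) with Mem.∈-map⁻ (τ x *_) a | find (Mem.∈-concatMap⁻ (λ x → map (τ x *_) (f x)) {xs = xs} c)
  ... | p , p∈ , refl | x' , x'∈ , c' with Mem.∈-map⁻ (τ x' *_) c'
  ... | p' , p'∈ , eq = All.lookup (Allₚ.map⁻ nx) x'∈ (inj (here refl) (there x'∈) p∈ p'∈ eq)

∈-products⁻ : ∀ {X : Set} (τ : X → ℕ) (f : X → List ℕ) (xs : List X) {z} → z ∈ concatMap (λ x → map (τ x *_) (f x)) xs → ∃₂ λ x p → x ∈ xs × p ∈ f x × z ≡ τ x * p
∈-products⁻ τ f xs c with find (Mem.∈-concatMap⁻ (λ x → map (τ x *_) (f x)) {xs = xs} c)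
... | x , x∈ , c' with Mem.∈-map⁻ (τ x *_) c'
... | p , p∈ , eq = x , p , x∈ , p∈ , eq

Σ-products : ∀ {X : Set} (τ : X → ℕ) (f : X → List ℕ) (xs : List X) → Σ (concatMap (λ x → map (τ x *_) (f x)) xs) rc ≡ Σ xs (λ x → rc (τ x) ⊗ Σ (f x) rc)
Σ-products τ f xs = trans (Σ-concatMap xs _ rc) (Σ-cong xs (λ {x} _ → trans (Σ-map (f x) (τ x *_) rc) (trans (Σ-cong (f x) (λ {p} _ → rc-* (τ x) p)) (Σ-*ˡ (f x) (rc (τ x)) rc))))

-- The factor p is recognised as the only prime factor above y.
largePrime-inj : ∀ {t t' p p' y} → Prime p → Prime p' → y < p → y < p' → (∀ {r} → Prime r → r ∣ t → r ≤ y) → (∀ {r} → Prime r → r ∣ t' → r ≤ y) → t * p ≡ t' * p' → t ≡ t'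
largePrime-inj {t} {t'} {p} {p'} pp pp' y<p y<p' ht ht' eq with euclidsLemma t' p' pp (subst (p ∣_) eq (Div.n∣m*n t))
... | inj₁ d = ⊥-elim (<⇒≱ y<p (ht' pp d))
... | inj₂ d with prime∣prime pp pp' d
... | refl = *-cancelʳ-≡ t t' p {{Pr.prime⇒nonZero pp}} eq

filter-⇔ : ∀ {P Q : ℕ → Set} (P? : Decidable P) (Q? : Decidable Q) xs → (∀ {x} → P x → Q x) → (∀ {x} → Q x → P x) → filter P? xs ≡ filter Q? xs
filter-⇔ P? Q? [] f g = refl
filter-⇔ P? Q? (x ∷ xs) f g with P? x | Q? x
... | yes _ | yes _ = cong (x ∷_) (filter-⇔ P? Q? xs f g)
... | yes p | no ¬q = ⊥-elim (¬q (f p))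
... | no ¬p | yes q = ⊥-elim (¬p (g q))
... | no _ | no _ = filter-⇔ P? Q? xs f g

doubling : ℕ → ℕ → ℕ
doubling e zero = e
doubling e (suc i) = doubling e i + doubling e i

doubling-≡ : ∀ e i → doubling e i ≡ e * 2 ^ i
doubling-≡ e zero = sym (*-identityʳ e)
doubling-≡ e (suc i) = trans (cong₂ _+_ (doubling-≡ e i) (doubling-≡ e i)) (lem e (2 ^ i))
  where
  lem : ∀ e x → e * x + e * x ≡ e * (2 * x)
  lem = solve-∀

doubling-≥ : ∀ e i → e ≤ doubling e i
doubling-≥ e zero = ≤-refl
doubling-≥ e (suc i) = ≤-trans (doubling-≥ e i) (m≤m+n _ _)

module Fail (key : Key) where
  open Key key

  θ : ℕ
  θ = κ * 2

  module _ (W : List ℕ) (e₀ : ℕ) where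
    block : ℕ → List ℕ
    block i = primesIn (shifted? W) (E (doubling e₀ i)) (E (doubling e₀ (suc i)))

    -- Products of at most one prime from each of the first i blocks.
    multipliers : ℕ → List ℕ
    multipliers zero = 1 ∷ []
    multipliers (suc i) = multipliers i ++ concatMap (λ t → map (t *_) (block i)) (multipliers i)

    private
      new : ∀ i {z} → z ∈ concatMap (λ t → map (t *_) (block i)) (multipliers i) → _
      new i = ∈-products⁻ id (λ _ → block i) (multipliers i)

      prime-block : ∀ i {p} → p ∈ block i → _
      prime-block i = ∈-primesIn⁻ (shifted? W) {E (doubling e₀ i)} {E (doubling e₀ (suc i))}

    multipliers-size : ∀ i {t} → t ∈ multipliers i → 1 ≤ t × t ≤ E (doubling e₀ (suc i))
    multipliers-size zero (here refl) = ≤-refl , 1≤E _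
    multipliers-size (suc i) m with Mem.∈-++⁻ (multipliers i) m
    ... | inj₁ a = let x , y = multipliers-size i a in x , ≤-trans y (E-mono (m≤m+n _ _))
    ... | inj₂ a with new i a
    ...   | t , p , t∈ , p∈ , refl = let x , y = multipliers-size i t∈ ; pr , _ , p≤ , _ = prime-block i p∈ in
            *-mono-≤ x (prime≥1 pr) , ≤-trans (*-mono-≤ y p≤) (≤-reflexive (sym (E-+ (doubling e₀ (suc i)) (doubling e₀ (suc i)))))

    multipliers-prime : ∀ i {t r} → t ∈ multipliers i → Prime r → r ∣ t → E e₀ < r × r ≤ E (doubling e₀ i) × Shifted W r
    multipliers-prime zero (here refl) pr r∣1 = ⊥-elim (Pr.¬prime[1] (subst Prime (Div.∣1⇒≡1 r∣1) pr))
    multipliers-prime (suc i) {r = r} m pr r∣ with Mem.∈-++⁻ (multipliers i) m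
    ... | inj₁ a = let x , y , s = multipliers-prime i a pr r∣ in x , ≤-trans y (E-mono (m≤m+n _ _)) , s
    ... | inj₂ a with new i a
    ...   | t , p , t∈ , p∈ , refl with euclidsLemma t p pr r∣ | prime-block i p∈
    ...     | inj₁ r∣t | _ = let x , y , s = multipliers-prime i t∈ pr r∣t in x , ≤-trans y (E-mono (m≤m+n _ _)) , s
    ...     | inj₂ r∣p | pp , lo , hi , s with prime∣prime pr pp r∣p
    ...       | refl = ≤-<-trans (E-mono (doubling-≥ e₀ i)) lo , hi , s

    unique-multipliers : ∀ i → Unique (multipliers i)
    unique-multipliers zero = [] ∷ []
    unique-multipliers (suc i) = Uniq.++⁺ (unique-multipliers i)
      (unique-products id (λ _ → block i) (multipliers i) (subst Unique (sym (Listₚ.map-id (multipliers i))) (unique-multipliers i))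
        (λ m → proj₁ (multipliers-size i m) , unique-primesIn (shifted? W) (E (doubling e₀ i)) (E (doubling e₀ (suc i))))
        (λ x∈ x'∈ p∈ p'∈ → let pp , lo , _ = prime-block i p∈ ; pp' , lo' , _ = prime-block i p'∈ in
          largePrime-inj pp pp' lo lo' (λ pr d → proj₁ (proj₂ (multipliers-prime i x∈ pr d))) (λ pr d → proj₁ (proj₂ (multipliers-prime i x'∈ pr d)))))
      disj
      where
      disj : ∀ {z} → ¬ (z ∈ multipliers i × z ∈ concatMap (λ t → map (t *_) (block i)) (multipliers i))
      disj (a , c) with new i c
      ... | t , p , t∈ , p∈ , refl = let pp , lo , _ = prime-block i p∈ in <⇒≱ lo (proj₁ (proj₂ (multipliers-prime i a pp (Div.n∣m*n t))))

    -- The reciprocal sum is the product of 1 + Σ 1 / p over the blocks, and each factor is at least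
    -- (θ + 1) / θ.
    multipliers-sum : (∀ i → 1ℚ ⊑ ι θ ⊗ Σ (block i) rc) → ∀ j → ι (suc θ ^ j) ⊑ ι (θ ^ j) ⊗ Σ (multipliers j) rc
    multipliers-sum h zero = ⊑-reflexive (trans ι-1 (sym (trans (cong₂ _⊗_ ι-1 (trans (⊕-identityʳ (rc 1)) rc-1)) (⊗-identityˡ 1ℚ))))
    multipliers-sum h (suc j) = begin
      ι (suc θ * suc θ ^ j) ≡⟨ ι-* (suc θ) (suc θ ^ j) ⟩
      (1ℚ ⊕ ι θ) ⊗ ι (suc θ ^ j) ≤⟨ ⊗-mono (⊕-nonneg 0≤1 (0≤ι θ)) (⊗-nonneg (0≤ι (θ ^ j)) 0≤s) (⊕-monoˡ-⊑ (ι θ) (h j)) (multipliers-sum h j) ⟩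
      (ι θ ⊗ β ⊕ ι θ) ⊗ (ι (θ ^ j) ⊗ s) ≡⟨ solve 4 (λ t b u s → (t :* b :+ t) :* (u :* s) := (t :* u) :* (s :+ s :* b)) refl (ι θ) β (ι (θ ^ j)) s ⟩
      (ι θ ⊗ ι (θ ^ j)) ⊗ (s ⊕ s ⊗ β) ≡⟨ cong₂ _⊗_ (sym (ι-* θ (θ ^ j))) (cong (s ⊕_) (sym (trans (Σ-products id (λ _ → block j) (multipliers j)) (Σ-*ʳ (multipliers j) β rc)))) ⟩
      ι (θ ^ suc j) ⊗ (s ⊕ Σ (concatMap (λ t → map (t *_) (block j)) (multipliers j)) rc) ≡⟨ cong (ι (θ ^ suc j) ⊗_) (sym (Σ-++ (multipliers j) _ rc)) ⟩
      ι (θ ^ suc j) ⊗ Σ (multipliers (suc j)) rc ∎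
      where
      open ℚₚ.≤-Reasoning
      β = Σ (block j) rc
      s = Σ (multipliers j) rc
      0≤s : 0ℚ ⊑ s
      0≤s = Σ-nonneg (multipliers j) 0≤rc

  block-good : ∀ u used e₀ → 1 ≤ u → length used ≤ E u → C * u ≤ e₀ → ∀ i → 1ℚ ⊑ ι θ ⊗ Σ (block (remove used (window u)) e₀ i) rc
  block-good u used e₀ 1≤u len le i = ⊗-cancelˡ {e} 1≤e (begin
    ι e ⊗ 1ℚ ≡⟨ ⊗-identityʳ (ι e) ⟩
    ι e ≤⟨ good-sum u used e e 1≤u len (≤-trans le (doubling-≥ e₀ i)) ⟩
    ι (κ * (e + e)) ⊗ s ≡⟨ trans (cong (λ z → ι z ⊗ s) (lem κ e)) (trans (cong (_⊗ s) (ι-* e θ)) (⊗-assoc (ι e) (ι θ) s)) ⟩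
    ι e ⊗ (ι θ ⊗ s) ∎)
    where
    open ℚₚ.≤-Reasoning
    e = doubling e₀ i
    1≤e : 1 ≤ e
    1≤e = ≤-trans (*-mono-≤ 1≤C 1≤u) (≤-trans le (doubling-≥ e₀ i))
    s = Σ (block (remove used (window u)) e₀ i) rc
    lem : ∀ κ e → κ * (e + e) ≡ e * (κ * 2)
    lem = solve-∀

  -- Multiplying a failing m by products of the primes it lacks gives distinct integers,
  -- because the set of missing primes is determined by the small prime factors of m.
  fail-bound : ∀ {F : ℕ → Set} (F? : Decidable F) (used : ℕ → List ℕ) u e₀ j z → 1 ≤ u → C * u ≤ e₀ → (∀ m → length (used m) ≤ E u) →
    (∀ {m m'} → (∀ {p} → Prime p → p ≤ E e₀ → p ∣ m → p ∣ m') → (∀ {p} → Prime p → p ≤ E e₀ → p ∣ m' → p ∣ m) → used m ≡ used m') →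
    (∀ {m} → F m → ∀ {p} → Prime p → E e₀ < p → p ≤ E (doubling e₀ j) → p ∣ m → ¬ Shifted (remove (used m) (window u)) p) →
    Σ (filter F? (range1 z)) rc ⊗ ι (suc θ ^ j) ⊑ ι (θ ^ j) ⊗ H (z * E (doubling e₀ (suc j)))
  fail-bound {F} F? used u e₀ j z 1≤u le len local fails = begin
    Σ Fs rc ⊗ ι (suc θ ^ j) ≡⟨ sym (Σ-*ʳ Fs (ι (suc θ ^ j)) rc) ⟩
    Σ Fs (λ m → rc m ⊗ ι (suc θ ^ j)) ≤⟨ Σ-mono Fs (λ {m} _ → ⊗-monoˡ (0≤rc m) (multipliers-sum (W m) e₀ (block-good u (used m) e₀ 1≤u (len m) le) j)) ⟩
    Σ Fs (λ m → rc m ⊗ (ι (θ ^ j) ⊗ Σ (bs m) rc)) ≡⟨ Σ-cong Fs (λ {m} _ → solve 3 (λ a b c → a :* (b :* c) := b :* (a :* c)) refl (rc m) (ι (θ ^ j)) (Σ (bs m) rc)) ⟩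
    Σ Fs (λ m → ι (θ ^ j) ⊗ (rc m ⊗ Σ (bs m) rc)) ≡⟨ Σ-*ˡ Fs (ι (θ ^ j)) _ ⟩
    ι (θ ^ j) ⊗ Σ Fs (λ m → rc m ⊗ Σ (bs m) rc) ≡⟨ cong (ι (θ ^ j) ⊗_) (sym (Σ-products id bs Fs)) ⟩
    ι (θ ^ j) ⊗ Σ (concatMap (λ m → map (m *_) (bs m)) Fs) rc ≤⟨ ⊗-monoˡ (0≤ι (θ ^ j)) (Σ-⊆ uniq sub 0≤rc) ⟩
    ι (θ ^ j) ⊗ H (z * E (doubling e₀ (suc j))) ∎
    where
    open ℚₚ.≤-Reasoning
    Fs = filter F? (range1 z)
    W : ℕ → List ℕ
    W m = remove (used m) (window u)
    bs : ℕ → List ℕ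
    bs m = multipliers (W m) e₀ j
    inF : ∀ {m} → m ∈ Fs → (1 ≤ m × m ≤ z) × F m
    inF m∈ = let a , f = Mem.∈-filter⁻ F? {xs = range1 z} m∈ in ∈-range1⁻ a , f
    sub : ∀ {x} → x ∈ concatMap (λ m → map (m *_) (bs m)) Fs → x ∈ range1 (z * E (doubling e₀ (suc j)))
    sub x∈ with ∈-products⁻ id bs Fs x∈
    ... | m , t , m∈ , t∈ , refl = let (1≤m , m≤z) , _ = inF m∈ ; 1≤t , t≤ = multipliers-size (W m) e₀ j t∈ in ∈-range1⁺ (*-mono-≤ 1≤m 1≤t) (*-mono-≤ m≤z t≤)
    -- Multipliers have no prime factor up to E e₀, so a prime in that range dividing the product
    -- divides m'.
    low : ∀ {m t m' t'} → t ∈ bs m → t' ∈ bs m' → m * t ≡ m' * t' → ∀ {p} → Prime p → p ≤ E e₀ → p ∣ m → p ∣ m'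
    low {m} {t} {m'} {t'} t∈ t'∈ eq {p} pr p≤ d with euclidsLemma m' t' pr (subst (p ∣_) eq (Div.∣m⇒∣m*n t d))
    ... | inj₁ x = x
    ... | inj₂ x = ⊥-elim (<⇒≱ (proj₁ (multipliers-prime (W m') e₀ j t'∈ pr x)) p≤)
    cop : ∀ {m m' t} → m' ∈ Fs → used m ≡ used m' → t ∈ bs m → Coprime t m'
    cop {m} {m'} m'∈ eq t∈ = let (1≤m' , _) , f = inF m'∈ in ∣-prime-coprime 1≤m' (λ {r} pr r∣m' r∣t →
      let lo , hi , s = multipliers-prime (W m) e₀ j t∈ pr r∣t in fails f pr lo hi r∣m' (subst (λ U → Shifted (remove U (window u)) r) eq s))
    inj : ∀ {m m' t t'} → m ∈ Fs → m' ∈ Fs → t ∈ bs m → t' ∈ bs m' → m * t ≡ m' * t' → m ≡ m'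
    inj {m} {m'} {t} {t'} m∈ m'∈ t∈ t'∈ eq = *-cancelʳ-≡ m m' t {{>-nonZero (proj₁ (multipliers-size (W m) e₀ j t∈))}} (trans eq (cong (m' *_) (sym t≡t')))
      where
      U≡ : used m ≡ used m'
      U≡ = local (low t∈ t'∈ eq) (low t'∈ t∈ (sym eq))
      t≡t' : t ≡ t'
      -- Since the excluded divisors agree, t is also a product of primes that m' lacks. So t is
      -- prime to m', divides m' t', and hence divides t'; likewise in the other direction.
      t≡t' = Div.∣-antisym (Cop.coprime-divisor (cop m'∈ U≡ t∈) (subst (t ∣_) eq (Div.n∣m*n m))) (Cop.coprime-divisor (cop m∈ (sym U≡) t'∈) (subst (t' ∣_) (sym eq) (Div.n∣m*n m')))
    uniq : Unique (concatMap (λ m → map (m *_) (bs m)) Fs)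
    uniq = unique-products id bs Fs (subst Unique (sym (Listₚ.map-id Fs)) (Uniq.filter⁺ F? (unique-range1 z)))
      (λ {m} m∈ → proj₁ (proj₁ (inF m∈)) , unique-multipliers (W m) e₀ j) inj

  -- One fresh q is sought in each round. Round s uses primes with exponents from e₀ 2 ^ (s j) to e₀
  -- 2 ^ ((s + 1) j), disjoint from the ranges of other rounds, so that `fail-bound` applies with
  -- base s in place of e₀.
  module Search (u e₀ j : ℕ) where
    base : ℕ → ℕ
    base s = doubling e₀ (s * j)

    class : ℕ → List ℕ
    class s = primesIn any⊤? (E (base s)) (E (doubling (base s) j))

    Hit : ℕ → ℕ → ℕ → Set
    Hit s m q = Any (λ p → p ∣ m × q ∣ p ∸ 1) (class s)

    hit? : ∀ s m → Decidable (Hit s m)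
    hit? s m q = Any.any? (λ p → (p ∣? m) ×-dec (q ∣? (p ∸ 1))) (class s)

    candidates : ℕ → ℕ → List ℕ → List ℕ
    candidates s m U = filter (hit? s m) (remove U (window u))

    consHead : List ℕ → List ℕ → List ℕ
    consHead [] U = U
    consHead (q ∷ _) U = q ∷ U

    found : ℕ → ℕ → List ℕ
    found zero m = []
    found (suc s) m = consHead (candidates s m (found s m)) (found s m)

    Fails : ℕ → ℕ → Set
    Fails s m = candidates s m (found s m) ≡ []

    fails? : ∀ s → Decidable (Fails s)
    fails? s m with candidates s m (found s m)
    ... | [] = yes refl
    ... | _ ∷ _ = no λ ()

    length-found : ∀ s m → length (found s m) ≤ s
    length-found zero m = z≤n
    length-found (suc s) m with candidates s m (found s m)
    ... | [] = m≤n⇒m≤1+n (length-found s m)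
    ... | _ ∷ _ = s≤s (length-found s m)

    base-suc : ∀ s → doubling (base s) j ≡ base (suc s)
    base-suc s = trans (doubling-≡ (base s) j) (trans (cong (_* 2 ^ j) (doubling-≡ e₀ (s * j))) (trans (*-assoc e₀ (2 ^ (s * j)) (2 ^ j))
      (trans (cong (e₀ *_) (trans (sym (^-distribˡ-+-* 2 (s * j) j)) (cong (2 ^_) (+-comm (s * j) j)))) (sym (doubling-≡ e₀ (suc s * j))))))

    class⁻ : ∀ s {p} → p ∈ class s → Prime p × E (base s) < p × p ≤ E (base (suc s))
    class⁻ s p∈ = let pr , lo , hi , _ = ∈-primesIn⁻ any⊤? {E (base s)} {E (doubling (base s) j)} p∈ in pr , lo , subst (λ z → _ ≤ E z) (base-suc s) hi

    base-mono : ∀ s → base s ≤ base (suc s)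
    base-mono s = subst (base s ≤_) (base-suc s) (doubling-≥ (base s) j)

    -- Rounds before s inspect only primes up to E (base s). This is what lets `fail-bound` recover
    -- the excluded divisors from a product.
    found-local : ∀ s {m m'} → (∀ {p} → Prime p → p ≤ E (base s) → p ∣ m → p ∣ m') → (∀ {p} → Prime p → p ≤ E (base s) → p ∣ m' → p ∣ m) → found s m ≡ found s m'
    found-local zero _ _ = refl
    found-local (suc s) {m} {m'} f g = trans (cong (λ U → consHead (candidates s m U) U) ih)
      (cong (λ c → consHead c (found s m')) (filter-⇔ (hit? s m) (hit? s m') (remove (found s m') (window u)) (tr f) (tr g)))
      where
      ih : found s m ≡ found s m'
      ih = found-local s (λ pr le → f pr (≤-trans le (E-mono (base-mono s)))) (λ pr le → g pr (≤-trans le (E-mono (base-mono s))))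
      tr : ∀ {m m'} → (∀ {p} → Prime p → p ≤ E (base (suc s)) → p ∣ m → p ∣ m') → ∀ {q} → Hit s m q → Hit s m' q
      tr {m} {m'} f {q} h with find h
      ... | p , p∈ , p∣m , q∣ = let pr , _ , hi = class⁻ s p∈ in Any.map (λ { refl → f pr hi p∣m , q∣ }) p∈

    fails-spec : ∀ s {m} → Fails s m → ∀ {p} → Prime p → E (base s) < p → p ≤ E (doubling (base s) j) → p ∣ m → ¬ Shifted (remove (found s m) (window u)) p
    fails-spec s {m} eq {p} pr lo hi p∣m sh with find sh
    ... | q , q∈ , q∣ = case subst (q ∈_) eq (Mem.∈-filter⁺ (hit? s m) q∈ (Any.map (λ { refl → p∣m , q∣ }) (∈-primesIn⁺ any⊤? pr lo hi tt))) of λ ()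

    Found : ℕ → ℕ → List ℕ → Set
    Found s m qs = Unique qs × length qs ≡ s × All (λ q → q ∈ window u × Witnessed m q) qs

    found-spec : ∀ s {m} → (∀ s' → s' < s → ¬ Fails s' m) → Found s m (found s m)
    found-spec zero _ = [] , refl , []
    found-spec (suc s) {m} nf with found-spec s (λ s' lt → nf s' (m≤n⇒m≤1+n lt)) | candidates s m (found s m) in eq
    ... | _ | [] = ⊥-elim (nf s ≤-refl eq)
    ... | uq , len , al | q ∷ qs = All.tabulate (λ {x} x∈ q≡x → q∉ (subst (_∈ found s m) (sym q≡x) x∈)) ∷ uq , cong suc len , (q∈win , wit) ∷ al
      where
      q∈ : q ∈ candidates s m (found s m)
      q∈ = subst (q ∈_) (sym eq) (here refl)
      q∈r = Mem.∈-filter⁻ (hit? s m) {xs = remove (found s m) (window u)} q∈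
      q∈w = Mem.∈-filter⁻ (λ q → ¬? (Any.any? (q ≟_) (found s m))) {xs = window u} (proj₁ q∈r)
      q∈win = proj₁ q∈w
      q∉ : q ∉ found s m
      q∉ = proj₂ q∈w
      wit : Witnessed m q
      wit with find (proj₂ q∈r)
      ... | p , p∈ , p∣m , q∣ = p , proj₁ (class⁻ s p∈) , p∣m , q∣

    fails-sum : ∀ s z → 1 ≤ u → C * u ≤ e₀ → s ≤ E u → Σ (filter (fails? s) (range1 z)) rc ⊗ ι (suc θ ^ j) ⊑ ι (θ ^ j) ⊗ H (z * E (doubling (base s) (suc j)))
    fails-sum s z 1≤u le s≤ = fail-bound (fails? s) (found s) u (base s) j z 1≤u (≤-trans le (doubling-≥ e₀ (s * j))) (λ m → ≤-trans (length-found s m) s≤) (found-local s) (fails-spec s)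

-- Integers that serve all windows well below their size

H-mono : ∀ {m n} → m ≤ n → H m ⊑ H n
H-mono {m} {n} m≤n = Σ-⊆ (unique-range1 m) (λ z∈ → let a , b = ∈-range1⁻ z∈ in ∈-range1⁺ a (≤-trans b m≤n)) 0≤rc

div-out : ∀ {x y n} → 1 ≤ n → x ⊗ ι n ⊑ y → x ⊑ rc n ⊗ y
div-out {x} {y} {n} 1≤n h = ⊗-cancelˡ 1≤n (subst₂ _⊑_ (⊗-comm x (ι n)) (sym (trans (sym (⊗-assoc (ι n) (rc n) y)) (trans (cong (_⊗ y) (ι-rc 1≤n)) (⊗-identityˡ y)))) h)

module GoodM (key : Key) (R J u₀ : ℕ) (1≤R : 1 ≤ R) (1≤u₀ : 1 ≤ u₀) (R≤u₀ : R ≤ u₀)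
             (J-large : Key.κ key * 2 * (12 * (R * R * suc (Key.κ key * 2))) ≤ J) where
  open Key key
  open Fail key

  instance
    R≢0 : NonZero R
    R≢0 = >-nonZero 1≤R

  u : ℕ → ℕ
  u zero = u₀
  u (suc a) = width * u a

  1≤θ : 1 ≤ θ
  1≤θ = *-mono-≤ 1≤κ (s≤s {n = 1} z≤n)

  u-growth : ∀ a d → u a * 2 ^ d ≤ u (d + a)
  u-growth a zero = ≤-reflexive (*-identityʳ (u a))
  u-growth a (suc d) = ≤-trans (≤-reflexive (lem (u a) (2 ^ d))) (*-mono-≤ 2≤width (u-growth a d))
    where
    lem : ∀ x y → x * (2 * y) ≡ 2 * (x * y)
    lem = solve-∀

  u₀≤u : ∀ a → u₀ ≤ u a
  u₀≤u zero = ≤-refl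
  u₀≤u (suc a) = ≤-trans (u₀≤u a) (m≤n*m (u a) width {{>-nonZero (<⇒≤ 2≤width)}})

  1≤u : ∀ a → 1 ≤ u a
  1≤u a = ≤-trans 1≤u₀ (u₀≤u a)

  n≤E : ∀ n → n ≤ E n
  n≤E n = ≤-trans (<⇒≤ (n<b^n {2} ≤-refl n)) (^-monoʳ-≤ 2 (m≤n*m n b {{>-nonZero 1≤b}}))

  R≤Eu : ∀ a → R ≤ E (u a)
  R≤Eu a = ≤-trans R≤u₀ (≤-trans (u₀≤u a) (n≤E (u a)))

  -- The failure ratio (θ / (θ + 1)) ^ j after j doublings.
  ϱ : ℕ → ℚ
  ϱ j = ι (θ ^ j) ⊗ rc (suc θ ^ j)

  0≤ϱ : ∀ j → 0ℚ ⊑ ϱ j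
  0≤ϱ j = ⊗-nonneg (0≤ι (θ ^ j)) (0≤rc (suc θ ^ j))

  ϱ-+ : ∀ i j → ϱ (i + j) ≡ ϱ i ⊗ ϱ j
  ϱ-+ i j = trans (cong₂ (λ x y → ι x ⊗ rc y) (^-distribˡ-+-* θ i j) (^-distribˡ-+-* (suc θ) i j))
    (trans (cong₂ _⊗_ (ι-* (θ ^ i) (θ ^ j)) (rc-* (suc θ ^ i) (suc θ ^ j)))
    (solve 4 (λ a b c d → (a :* b) :* (c :* d) := (a :* c) :* (b :* d)) refl (ι (θ ^ i)) (ι (θ ^ j)) (rc (suc θ ^ i)) (rc (suc θ ^ j))))

  ϱ-0 : ϱ 0 ≡ 1ℚ
  ϱ-0 = trans (cong₂ _⊗_ ι-1 rc-1) (⊗-identityˡ 1ℚ)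

  ϱ1-eq : ϱ 1 ⊗ ι (suc θ) ≡ ι θ
  ϱ1-eq = trans (cong₂ (λ x y → ι x ⊗ rc y ⊗ ι (suc θ)) (*-identityʳ θ) (*-identityʳ (suc θ)))
    (trans (⊗-assoc (ι θ) (rc (suc θ)) (ι (suc θ))) (trans (cong (ι θ ⊗_) (trans (⊗-comm (rc (suc θ)) (ι (suc θ))) (ι-rc {suc θ} (s≤s z≤n)))) (⊗-identityʳ (ι θ))))

  ϱ-geometric : ∀ n → S n ϱ ⊑ ι (suc θ)
  ϱ-geometric zero = 0≤ι (suc θ)
  ϱ-geometric (suc n) = begin
    ϱ 0 ⊕ S n (λ i → ϱ (suc i)) ≡⟨ cong₂ _⊕_ ϱ-0 (trans (S-cong n (λ i → ϱ-+ 1 i)) (S-*ˡ n (ϱ 1) ϱ)) ⟩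
    1ℚ ⊕ ϱ 1 ⊗ S n ϱ ≤⟨ ⊕-monoʳ-⊑ 1ℚ (⊗-monoˡ (0≤ϱ 1) (ϱ-geometric n)) ⟩
    1ℚ ⊕ ϱ 1 ⊗ ι (suc θ) ≡⟨ cong (1ℚ ⊕_) ϱ1-eq ⟩
    ι (suc θ) ∎
    where open ℚₚ.≤-Reasoning

  -- Each quotient i / R is attained R times, so this is R times a geometric series, after extending
  -- the sum from n to n R nonnegative terms.
  ϱ-blocks : ∀ n → S n (λ i → ϱ (i / R)) ⊑ ι R ⊗ ι (suc θ)
  ϱ-blocks n = begin
    S n f ≤⟨ ≤-+ʳ (subst (_⊑ S (n * R ∸ n) (λ i → f (n + i))) (trans (S-const (n * R ∸ n) 0ℚ) (⊗-zeroʳ (ι (n * R ∸ n)))) (S-mono (n * R ∸ n) (λ i → 0≤ϱ ((n + i) / R)))) ⟩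
    S n f ⊕ S (n * R ∸ n) (λ i → f (n + i)) ≡⟨ sym (S-split f n (n * R ∸ n)) ⟩
    S (n + (n * R ∸ n)) f ≡⟨ cong (λ x → S x f) (m+[n∸m]≡n (m≤m*n n R)) ⟩
    S (n * R) f ≡⟨ S-blocks f n R ⟩
    S n (λ j → S R (λ i → f (j * R + i))) ≡⟨ S-cong n (λ j → trans (S-cong< R (λ i i<R → cong ϱ (quot j i i<R))) (S-const R (ϱ j))) ⟩
    S n (λ j → ι R ⊗ ϱ j) ≡⟨ S-*ˡ n (ι R) ϱ ⟩
    ι R ⊗ S n ϱ ≤⟨ ⊗-monoˡ (0≤ι R) (ϱ-geometric n) ⟩
    ι R ⊗ ι (suc θ) ∎
    where
    open ℚₚ.≤-Reasoning
    f : ℕ → ℚ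
    f i = ϱ (i / R)
    quot : ∀ j i → i < R → (j * R + i) / R ≡ j
    quot j i i<R = trans (DivMod.+-distrib-/-∣ˡ {j * R} i (Div.n∣m*n j)) (trans (cong₂ _+_ (DivMod.m*n/n≡m j R) (DivMod.m<n⇒m/n≡0 i<R)) (+-identityʳ j))

  S-reverse : ∀ (f : ℕ → ℚ) n → S n (λ a → f (n ∸ a)) ≡ S n (λ i → f (suc i))
  S-reverse f zero = refl
  S-reverse f (suc n) = trans (cong (f (suc n) ⊕_) (S-reverse f n)) (trans (⊕-comm (f (suc n)) _) (sym (S-snoc (λ i → f (suc i)) n)))

  -- This is (1 + 1 / θ) ^ j ≥ 1 + j / θ, cleared of denominators.
  bernoulli : ∀ j → θ ^ j * (θ + j) ≤ suc θ ^ j * θ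
  bernoulli zero = ≤-reflexive (cong (1 *_) (+-identityʳ θ))
  bernoulli (suc j) = begin
    θ * θ ^ j * (θ + suc j) ≤⟨ m≤m+n _ (θ ^ j * j) ⟩
    θ * θ ^ j * (θ + suc j) + θ ^ j * j ≡⟨ lem₁ θ (θ ^ j) j ⟩
    suc θ * (θ ^ j * (θ + j)) ≤⟨ *-monoʳ-≤ (suc θ) (bernoulli j) ⟩
    suc θ * (suc θ ^ j * θ) ≡⟨ sym (*-assoc (suc θ) (suc θ ^ j) θ) ⟩
    suc θ * suc θ ^ j * θ ∎
    where
    open ℕₚ.≤-Reasoning
    lem₁ : ∀ θ x j → θ * x * (θ + suc j) + x * j ≡ suc θ * (x * (θ + j))
    lem₁ = solve-∀

  ϱJ-small : ι (12 * (R * R * suc θ)) ⊗ ϱ J ⊑ 1ℚ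
  ϱJ-small = begin
    ι Y ⊗ (ι (θ ^ J) ⊗ rc (suc θ ^ J)) ≡⟨ trans (sym (⊗-assoc (ι Y) (ι (θ ^ J)) _)) (cong (_⊗ rc (suc θ ^ J)) (sym (ι-* Y (θ ^ J)))) ⟩
    ι (Y * θ ^ J) ⊗ rc (suc θ ^ J) ≤⟨ ⊗-monoʳ (0≤rc (suc θ ^ J)) (ι-mono large) ⟩
    ι (suc θ ^ J) ⊗ rc (suc θ ^ J) ≡⟨ ι-rc (m^n>0 (suc θ) J) ⟩
    1ℚ ∎
    where
    open ℚₚ.≤-Reasoning
    -- 12 = 3 * 4, with 3 from `h` and 4 from `4fail≤`. R * R * suc θ bounds the sum over windows
    -- and rounds relative to ϱ J.
    Y = 12 * (R * R * suc θ)
    large : Y * θ ^ J ≤ suc θ ^ J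
    large = *-cancelʳ-≤ (Y * θ ^ J) (suc θ ^ J) θ {{>-nonZero 1≤θ}} (≤-trans (≤-reflexive (lem Y (θ ^ J) θ))
      (≤-trans (*-monoʳ-≤ (θ ^ J) (≤-trans J-large (m≤n+m J θ))) (bernoulli J)))
      where
      lem : ∀ y x t → y * x * t ≡ x * (t * y)
      lem = solve-∀

  Win : ℕ → ℕ → ℕ → Set
  Win s a m = ∃ λ qs → Unique qs × length qs ≡ s × All (λ q → q ∈ window (u a) × Witnessed m q) qs

  module _ (A : ℕ) where
    -- Lower windows get more doublings, so that the failure ratios sum to a bounded multiple of ϱ
    -- J. Because of the division by R, the R rounds together spend only A - a doublings beyond R J,
    -- and these are covered by u a * 2 ^ (A - a) ≤ u A.
    j : ℕ → ℕ
    j a = J + (A ∸ a) / R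

    -- Twice a bound for the exponents where the searches end. The doubling leaves room for the
    -- whole multiplier, which is at most E Z.
    Z : ℕ
    Z = 2 * (C * (u A * 2 ^ (R * J)))

    1≤Z : 1 ≤ Z
    1≤Z = *-mono-≤ (s≤s {n = 1} z≤n) (*-mono-≤ 1≤C (*-mono-≤ (1≤u A) (m^n>0 2 (R * J))))

    private
      z = E Z

      module Sr (a : ℕ) = Search (u a) (C * u a) (j a)

      bad? : ∀ m → Dec (Any (λ a → Any (λ s → Sr.Fails a s m) (upTo R)) (upTo A))
      bad? m = Any.any? (λ a → Any.any? (λ s → Sr.fails? a s m) (upTo R)) (upTo A)

    goodM : List ℕ
    goodM = filter (λ m → ¬? (bad? m)) (range1 (E Z))

    unique-goodM : Unique goodM
    unique-goodM = Uniq.filter⁺ (λ m → ¬? (bad? m)) (unique-range1 z)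

    goodM-spec : ∀ {m} → m ∈ goodM → (1 ≤ m × m ≤ E Z) × (∀ a → a < A → Win R a m)
    goodM-spec {m} m∈ with Mem.∈-filter⁻ (λ m → ¬? (bad? m)) {xs = range1 z} m∈
    ... | m∈r , nb = ∈-range1⁻ m∈r , λ a a<A → Sr.found a R m , Sr.found-spec a R (λ s s<R f → nb (Any.map (λ { refl → Any.map (λ { refl → f }) (Mem.∈-upTo⁺ s<R) }) (Mem.∈-upTo⁺ a<A)))

    private
      failList : ℕ → ℕ → List ℕ
      failList a s = filter (Sr.fails? a s) (range1 z)

      exponent : ∀ a s → a ≤ A → s < R → doubling (Sr.base a s) (suc (j a)) ≤ Z
      exponent a s a≤A s<R = begin
        doubling (Sr.base a s) (suc (j a)) ≡⟨ cong (λ x → x + x) (Sr.base-suc a s) ⟩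
        Sr.base a (suc s) + Sr.base a (suc s) ≡⟨ lem₀ (Sr.base a (suc s)) ⟩
        2 * Sr.base a (suc s) ≡⟨ cong (2 *_) (doubling-≡ (C * u a) (suc s * j a)) ⟩
        2 * (C * u a * 2 ^ (suc s * j a)) ≤⟨ *-monoʳ-≤ 2 (*-monoʳ-≤ (C * u a) (^-monoʳ-≤ 2 (*-monoˡ-≤ (j a) s<R))) ⟩
        2 * (C * u a * 2 ^ (R * j a)) ≤⟨ *-monoʳ-≤ 2 (*-monoʳ-≤ (C * u a) (^-monoʳ-≤ 2 expo)) ⟩
        2 * (C * u a * 2 ^ (R * J + (A ∸ a))) ≡⟨ cong (λ x → 2 * (C * u a * x)) (^-distribˡ-+-* 2 (R * J) (A ∸ a)) ⟩
        2 * (C * u a * (2 ^ (R * J) * 2 ^ (A ∸ a))) ≡⟨ lem₁ C (u a) (2 ^ (R * J)) (2 ^ (A ∸ a)) ⟩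
        2 * (C * (u a * 2 ^ (A ∸ a) * 2 ^ (R * J))) ≤⟨ *-monoʳ-≤ 2 (*-monoʳ-≤ C (*-monoˡ-≤ (2 ^ (R * J)) (subst (λ x → u a * 2 ^ (A ∸ a) ≤ u x) (m∸n+n≡m a≤A) (u-growth a (A ∸ a))))) ⟩
        Z ∎
        where
        open ℕₚ.≤-Reasoning
        lem₀ : ∀ x → x + x ≡ 2 * x
        lem₀ = solve-∀
        lem₁ : ∀ c u x y → 2 * (c * u * (x * y)) ≡ 2 * (c * (u * y * x))
        lem₁ = solve-∀
        expo : R * j a ≤ R * J + (A ∸ a)
        expo = ≤-trans (≤-reflexive (*-distribˡ-+ R J ((A ∸ a) / R))) (+-monoʳ-≤ (R * J) (subst (_≤ A ∸ a) (*-comm ((A ∸ a) / R) R) (DivMod.m/n*n≤m (A ∸ a) R)))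

      -- Both m and its multiplier are at most z = 2 ^ (b Z), so the products are counted by H (z *
      -- z), which is at most 2 b Z + 1.
      h : ℚ
      h = ι (3 * (b * Z))

      H-zz : H (z * z) ⊑ h
      H-zz = begin
        H (z * z) ≡⟨ cong H (trans (sym (E-+ Z Z)) refl) ⟩
        H (2 ^ (b * (Z + Z))) ≤⟨ H-upper (b * (Z + Z)) ⟩
        ι (suc (b * (Z + Z))) ≤⟨ ι-mono (≤-trans (+-monoˡ-≤ (b * (Z + Z)) (*-mono-≤ 1≤b 1≤Z)) (≤-reflexive (lem b Z))) ⟩
        h ∎
        where
        open ℚₚ.≤-Reasoning
        lem : ∀ b Z → b * Z + b * (Z + Z) ≡ 3 * (b * Z)
        lem = solve-∀

      fail≤ : ∀ a s → a < A → s < R → Σ (failList a s) rc ⊑ h ⊗ ϱ (j a)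
      fail≤ a s a<A s<R = begin
        Σ (failList a s) rc ≤⟨ div-out (m^n>0 (suc θ) (j a)) (Sr.fails-sum a s z (1≤u a) ≤-refl (≤-trans (<⇒≤ s<R) (R≤Eu a))) ⟩
        rc (suc θ ^ j a) ⊗ (ι (θ ^ j a) ⊗ H (z * E (doubling (Sr.base a s) (suc (j a))))) ≤⟨ ⊗-monoˡ (0≤rc (suc θ ^ j a)) (⊗-monoˡ (0≤ι (θ ^ j a)) (⊑-trans (H-mono (*-monoʳ-≤ z (E-mono (exponent a s (<⇒≤ a<A) s<R)))) H-zz)) ⟩
        rc (suc θ ^ j a) ⊗ (ι (θ ^ j a) ⊗ h) ≡⟨ solve 3 (λ x y h → x :* (y :* h) := h :* (y :* x)) refl (rc (suc θ ^ j a)) (ι (θ ^ j a)) h ⟩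
        h ⊗ ϱ (j a) ∎
        where open ℚₚ.≤-Reasoning

      failAll : List ℕ
      failAll = concatMap (λ a → concatMap (failList a) (upTo R)) (upTo A)

      failAll≤ : Σ failAll rc ⊑ h ⊗ ϱ J ⊗ ι (R * R * suc θ)
      failAll≤ = begin
        Σ failAll rc ≡⟨ trans (Σ-concatMap (upTo A) _ rc) (Σ-cong (upTo A) (λ {a} _ → Σ-concatMap (upTo R) (failList a) rc)) ⟩
        Σ (upTo A) (λ a → Σ (upTo R) (λ s → Σ (failList a s) rc)) ≤⟨ Σ-mono (upTo A) (λ {a} a∈ → Σ-mono (upTo R) (λ {s} s∈ → fail≤ a s (Mem.∈-upTo⁻ a∈) (Mem.∈-upTo⁻ s∈))) ⟩
        Σ (upTo A) (λ a → Σ (upTo R) (λ _ → h ⊗ ϱ (j a))) ≡⟨ Σ-cong (upTo A) (λ {a} _ → trans (trans (Σ-const (upTo R) (h ⊗ ϱ (j a))) (cong (λ x → ι x ⊗ (h ⊗ ϱ (j a))) (Listₚ.length-upTo R)))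
              (trans (cong (λ x → ι R ⊗ (h ⊗ x)) (ϱ-+ J ((A ∸ a) / R))) (solve 4 (λ r h x y → r :* (h :* (x :* y)) := (h :* x :* r) :* y) refl (ι R) h (ϱ J) (ϱ ((A ∸ a) / R))))) ⟩
        Σ (upTo A) (λ a → k ⊗ ϱ ((A ∸ a) / R)) ≡⟨ trans (Σ-*ˡ (upTo A) k _) (cong (k ⊗_) (trans (Σ-upTo _ A) (S-reverse (λ i → ϱ (i / R)) A))) ⟩
        k ⊗ S A (λ i → ϱ (suc i / R)) ≤⟨ ⊗-monoˡ 0≤k (⊑-trans (≤-+ˡ (0≤ϱ (0 / R))) (ϱ-blocks (suc A))) ⟩
        k ⊗ (ι R ⊗ ι (suc θ)) ≡⟨ trans (solve 4 (λ h x r t → (h :* x :* r) :* (r :* t) := h :* x :* (r :* r :* t)) refl h (ϱ J) (ι R) (ι (suc θ))) (cong (h ⊗ ϱ J ⊗_) (sym (trans (ι-* (R * R) (suc θ)) (cong (_⊗ ι (suc θ)) (ι-* R R))))) ⟩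
        h ⊗ ϱ J ⊗ ι (R * R * suc θ) ∎
        where
        open ℚₚ.≤-Reasoning
        k = h ⊗ ϱ J ⊗ ι R
        0≤k : 0ℚ ⊑ k
        0≤k = ⊗-nonneg (⊗-nonneg (0≤ι (3 * (b * Z))) (0≤ϱ J)) (0≤ι R)

      4fail≤ : 4ℚ ⊗ Σ failAll rc ⊑ ι (b * Z)
      4fail≤ = begin
        4ℚ ⊗ Σ failAll rc ≤⟨ ⊗-monoˡ (0≤ι 4) failAll≤ ⟩
        4ℚ ⊗ (h ⊗ ϱ J ⊗ ι (R * R * suc θ)) ≡⟨ cong (λ x → 4ℚ ⊗ (x ⊗ ϱ J ⊗ ι (R * R * suc θ))) (ι-* 3 (b * Z)) ⟩
        4ℚ ⊗ (ι 3 ⊗ ι (b * Z) ⊗ ϱ J ⊗ ι (R * R * suc θ)) ≡⟨ solve 3 (λ z x r → con 4ℚ :* (con (ι 3) :* z :* x :* r) := z :* ((con (ι 12) :* r) :* x)) refl (ι (b * Z)) (ϱ J) (ι (R * R * suc θ)) ⟩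
        ι (b * Z) ⊗ ((ι 12 ⊗ ι (R * R * suc θ)) ⊗ ϱ J) ≡⟨ cong (λ x → ι (b * Z) ⊗ (x ⊗ ϱ J)) (sym (ι-* 12 (R * R * suc θ))) ⟩
        ι (b * Z) ⊗ (ι (12 * (R * R * suc θ)) ⊗ ϱ J) ≤⟨ ⊗-monoˡ (0≤ι (b * Z)) ϱJ-small ⟩
        ι (b * Z) ⊗ 1ℚ ≡⟨ ⊗-identityʳ (ι (b * Z)) ⟩
        ι (b * Z) ∎
        where open ℚₚ.≤-Reasoning

      cover : H z ⊑ Σ goodM rc ⊕ Σ failAll rc
      cover = ⊑-trans (Σ-⊆ (unique-range1 z) sub 0≤rc) (⊑-reflexive (Σ-++ goodM failAll rc))
        where
        sub : ∀ {m} → m ∈ range1 z → m ∈ goodM ++ failAll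
        sub {m} m∈ = go (bad? m)
          where
          go : Dec (Any (λ a → Any (λ s → Sr.Fails a s m) (upTo R)) (upTo A)) → m ∈ goodM ++ failAll
          go (no nb) = Mem.∈-++⁺ˡ (Mem.∈-filter⁺ (λ m → ¬? (bad? m)) m∈ nb)
          go (yes bd) = Mem.∈-++⁺ʳ goodM (Mem.∈-concatMap⁺ (λ a → concatMap (failList a) (upTo R)) {xs = upTo A} (Any.map (λ {a} anyS → Mem.∈-concatMap⁺ (failList a) {xs = upTo R}
            (Any.map (λ {s} f → Mem.∈-filter⁺ (Sr.fails? a s) m∈ f) anyS)) bd))

    -- The harmonic sum to z is at least b Z / 2, and the failing m account for at most half of that
    -- lower bound.
    goodM-sum : ι (b * Z) ⊑ 4ℚ ⊗ Σ goodM rc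
    goodM-sum = cancel (begin
      ι (b * Z) ⊕ ι (b * Z) ≤⟨ ⊕-mono-⊑ (H-lower (b * Z)) (H-lower (b * Z)) ⟩
      2ℚ ⊗ H z ⊕ 2ℚ ⊗ H z ≡⟨ solve 1 (λ x → con 2ℚ :* x :+ con 2ℚ :* x := con 4ℚ :* x) refl (H z) ⟩
      4ℚ ⊗ H z ≤⟨ ⊗-monoˡ (0≤ι 4) cover ⟩
      4ℚ ⊗ (Σ goodM rc ⊕ Σ failAll rc) ≡⟨ ⊗-distribˡ-⊕ 4ℚ (Σ goodM rc) (Σ failAll rc) ⟩
      4ℚ ⊗ Σ goodM rc ⊕ 4ℚ ⊗ Σ failAll rc ≤⟨ ⊕-monoʳ-⊑ (4ℚ ⊗ Σ goodM rc) 4fail≤ ⟩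
      4ℚ ⊗ Σ goodM rc ⊕ ι (b * Z) ∎)
      where
      open ℚₚ.≤-Reasoning
      cancel : ∀ {x y} → x ⊕ x ⊑ y ⊕ x → x ⊑ y
      cancel {x} {y} le = subst₂ _⊑_ (lem x x) (lem y x) (⊕-monoˡ-⊑ (⊖ x) le)
        where
        lem : ∀ a x → (a ⊕ x) ⊕ ⊖ x ≡ a
        lem a x = trans (⊕-assoc a x (⊖ x)) (trans (cong (a ⊕_) (⊕-inverseʳ x)) (⊕-identityʳ a))

-- The remaining windows and the chain of 2-dense divisors

bracket : ∀ (f : ℕ → ℕ) Y n → f 0 ≤ Y → Y < f n → ∃ λ a → f a ≤ Y × Y < f (suc a)
bracket f Y zero lo hi = ⊥-elim (<⇒≱ hi lo)
bracket f Y (suc n) lo hi with f n ≤? Y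
... | yes le = n , le , hi
... | no nle = bracket f Y n lo (≰⇒> nle)

choices : ∀ {P : ℕ → List ℕ → Set} (T : List ℕ) → (∀ {t} → t ∈ T → ∃ (P t)) → ∃ λ (L : List (ℕ × List ℕ)) → map proj₁ L ≡ T × (∀ {x} → x ∈ L → proj₁ x ∈ T × P (proj₁ x) (proj₂ x))
choices [] h = [] , refl , λ ()
choices {P} (t ∷ T) h with h (here refl) | choices {P} T (λ m → h (there m))
... | ps , p | L , eq , al = (t , ps) ∷ L , cong (t ∷_) eq , λ { (here refl) → here refl , p ; (there m) → there (proj₁ (al m)) , proj₂ (al m) }

ι-length-concatMap : ∀ {X : Set} (f : X → List ℕ) (xs : List X) → ι (length (concatMap f xs)) ≡ Σ xs (λ x → ι (length (f x)))
ι-length-concatMap f [] = refl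
ι-length-concatMap f (x ∷ xs) = trans (cong ι (Listₚ.length-++ (f x))) (trans (ι-+ (length (f x)) _) (cong (ι (length (f x)) ⊕_) (ι-length-concatMap f xs)))

module Top (key : Key) (R J : ℕ) (1≤R : 1 ≤ R)
           (J-large : Key.κ key * 2 * (12 * (R * R * suc (Key.κ key * 2))) ≤ J)
           (w²≤R : Key.width key * Key.width key ≤ R) (5Cw≤R : 5 * (Key.C key * Key.width key) ≤ R) where
  open Key key
  open GoodM key R J R 1≤R 1≤R ≤-refl J-large

  -- After g' = R J + 1 further windows C u has overtaken Z, so windows A, ..., A + g' are left over
  -- and need K = g R primes. 2 ^ k = E (width * u 0) exceeds all of window 0. 1 / μ is a lower
  -- bound for the reciprocal sum from which each pᵢ is taken.
  g' g K k c₀ μ : ℕ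
  g' = R * J + 1
  g = suc g'
  K = g * R
  k = b * (width * R)
  c₀ = 2 ^ (2 + k)
  μ = κ * (K * K + K)

  lo : ℕ → ℕ
  lo zero = 0
  lo (suc i) = lo i + (K * K + i)

  E-cancel : ∀ {e e'} → E e < E e' → e < e'
  E-cancel {e} {e'} lt = ≰⇒> λ e'≤e → <⇒≱ lt (E-mono e'≤e)

  E-^ : ∀ e n → E e ^ n ≡ E (n * e)
  E-^ e n = trans (^-*-assoc 2 (b * e) n) (cong (2 ^_) (trans (*-assoc b e n) (cong (b *_) (*-comm e n))))

  2≤E : ∀ {e} → 1 ≤ e → 2 ≤ E e
  2≤E {e} 1≤e = ^-monoʳ-≤ 2 {1} {b * e} (*-mono-≤ 1≤b 1≤e)

  Win-∣ : ∀ {s a t n} → t ∣ n → Win s a t → Win s a n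
  Win-∣ t∣n (qs , uq , len , al) = qs , uq , len , All.map (λ (m , p , pp , p∣t , d) → m , p , pp , Div.∣-trans p∣t t∣n , d) al

  window⁻ : ∀ {a q} → q ∈ window (u a) → Prime q × E (u a) < q × q ≤ E (u (suc a))
  window⁻ {a} m = let pr , l , h , _ = ∈-primesIn⁻ any⊤? {E (u a)} {E (width * u a)} m in pr , l , h

  module _ {n : ℕ} where
    Mq : List ℕ → ℕ
    Mq qs = 2 ^ k * product qs

    -- The last condition puts all primes of window a below M, so any of them may be multiplied on.
    -- The bound E (u a) on the qs separates them from that window.
    Chain : ℕ → List ℕ → Set
    Chain a qs = Unique qs × All (λ q → Prime q × 2 < q × Witnessed n q) qs × All (_≤ E (u a)) qs × TwoDense (Mq qs) × E (width * u a) ≤ Mq qs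

    private
      M-cons : ∀ q qs → Mq (q ∷ qs) ≡ Mq qs * q
      M-cons q qs = lem (2 ^ k) q (product qs)
        where
        lem : ∀ x q p → x * (q * p) ≡ x * p * q
        lem = solve-∀

      extend : ∀ a {qs} → TwoDense (Mq qs) → E (width * u a) ≤ Mq qs → ∀ ns → All (λ q → q ∈ window (u a) × Witnessed n q) ns →
        TwoDense (Mq (ns ++ qs)) × E (width * u a) ≤ Mq (ns ++ qs) × E (u a) ^ length ns ≤ Mq (ns ++ qs)
      extend a {qs} td le [] [] = td , le , ≤-trans (1≤E (width * u a)) le
      extend a {qs} td le (q ∷ ns) ((q∈ , _) ∷ al) with extend a td le ns al | window⁻ {a} q∈
      ... | td' , le' , pw | pr , lw , hi =
        subst TwoDense (sym (M-cons q (ns ++ qs))) (TwoDense-* td' (prime≥1 pr) (≤-trans hi (≤-trans le' (m≤m+n _ _)))) ,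
        subst (E (width * u a) ≤_) (sym (M-cons q (ns ++ qs))) (≤-trans le' (m≤m*n _ q {{Pr.prime⇒nonZero pr}})) ,
        subst (E (u a) * E (u a) ^ length ns ≤_) (trans (*-comm q _) (sym (M-cons q (ns ++ qs)))) (*-mono-≤ (<⇒≤ lw) pw)

    -- R primes above E (u a) raise M to at least E (R * u a), and R ≥ width² brings this above the
    -- end of the next window.
    chain-step : ∀ a {qs} → Chain a qs → Win R a n → ∃ λ qs' → Chain (suc a) qs' × E (R * u a) ≤ Mq qs'
    chain-step a {qs} (uq , al , small , td , le) (ns , un , len , aln) with extend a td le ns aln
    ... | td' , _ , pw = ns ++ qs , (Uniq.++⁺ un uq disj , Allₚ.++⁺ (All.map new aln) al ,
           Allₚ.++⁺ (All.map (λ (m , _) → proj₂ (proj₂ (window⁻ {a} m))) aln) (All.map (λ x → ≤-trans x (E-mono (m≤n*m (u a) width {{>-nonZero (<⇒≤ 2≤width)}}))) small) ,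
           td' , ≤-trans (E-mono (≤-trans (≤-reflexive (sym (*-assoc width width (u a)))) (*-monoˡ-≤ (u a) w²≤R))) large) , large
      where
      large : E (R * u a) ≤ Mq (ns ++ qs)
      large = subst (_≤ Mq (ns ++ qs)) (trans (cong (E (u a) ^_) len) (E-^ (u a) R)) pw
      new : ∀ {q} → q ∈ window (u a) × Witnessed n q → Prime q × 2 < q × Witnessed n q
      new (m , w) = let pr , lw , _ = window⁻ {a} m in pr , ≤-<-trans (2≤E (1≤u a)) lw , w
      disj : ∀ {z} → ¬ (z ∈ ns × z ∈ qs)
      disj (x , y) = <⇒≱ (proj₁ (proj₂ (window⁻ {a} (proj₁ (All.lookup aln x))))) (All.lookup small y)

    chain : ∀ a → (∀ a' → a' < a → Win R a' n) → ∃ (Chain a)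
    chain zero _ = [] , [] , [] , [] , subst TwoDense (sym (*-identityʳ (2 ^ k))) (TwoDense-2^ k) , ≤-reflexive (sym (*-identityʳ (2 ^ k)))
    chain (suc a) h with chain a (λ a' lt → h a' (m≤n⇒m≤1+n lt))
    ... | qs , c with chain-step a c (h a ≤-refl)
    ... | qs' , c' , _ = qs' , c'

  dense : ∀ {n} a → 1 ≤ n → c₀ ∣ n → (∀ a' → a' < suc a → Win R a' n) → (∀ {p} → Prime p → p ∣ n → p ≤ E (R * u a)) → TwoDense (totient n) × TwoDense (carmichael n)
  dense {n} a 1≤n c∣n wins sm with chain {n} a (λ a' lt → wins a' (m≤n⇒m≤1+n lt))
  ... | qs , c with chain-step {n} a c (wins a ≤-refl)
  ... | qs' , (uq , al , _ , td , _) , large = dense-criterion {n} {k} {qs'} 1≤n c∣n uq al td (λ pr d → ≤-trans (sm pr d) (≤-trans large (m≤m+n _ _)))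

  module Stages (A ε : ℕ) (1≤ε : 1 ≤ ε) (Cu≤ : C * u (g' + A) ≤ K * K * ε) where
    -- Steps of ε from K² ε on: short enough that K primes leave an uncertainty of at most K ε in
    -- the exponent of their product, yet a fixed proportion of the exponent, so that each interval
    -- has reciprocal sum at least 1 / μ.
    ee : ℕ → ℕ
    ee i = (K * K + i) * ε

    u-mono : ∀ a d → u a ≤ u (d + a)
    u-mono a d = ≤-trans (m≤m*n (u a) (2 ^ d) {{m^n≢0 2 d}}) (u-growth a d)

    Z≤ : Z A ≤ K * K * ε
    Z≤ = ≤-trans (≤-reflexive (trans (lem C (u A) (2 ^ (R * J))) (cong (λ x → C * (u A * x)) (trans (*-comm (2 ^ (R * J)) 2) (cong (2 ^_) (+-comm 1 (R * J)))))))
      (≤-trans (*-monoʳ-≤ C (u-growth A g')) Cu≤)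
      where
      lem : ∀ c x y → 2 * (c * (x * y)) ≡ c * (x * (y * 2))
      lem = solve-∀

    -- T consists of products m p₁ ⋯ pᵢ. In `bounds`, lo i * ε adds up the lower exponents of the
    -- primes, i * ε their spread, and Z A accounts for m. `mass` loses a factor μ per prime, hence
    -- a constant overall.
    record Stage (i : ℕ) (P : ℕ → Set) (T : List ℕ) : Set where
      field
        unique : Unique T
        bounds : ∀ {t} → t ∈ T → 1 ≤ t × E (lo i * ε) ≤ t × t ≤ E (Z A + (lo i + i) * ε)
        smooth : ∀ {t r} → t ∈ T → Prime r → r ∣ t → r ≤ E (ee i)
        holds  : ∀ {t} → t ∈ T → P t
        mass   : Σ (goodM A) rc ⊑ ι (μ ^ i) ⊗ Σ T rc

    Stage-map : ∀ {i T} {P P' : ℕ → Set} → (∀ {t} → P t → P' t) → Stage i P T → Stage i P' T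
    Stage-map f st = record { Stage st ; holds = λ m → f (Stage.holds st m) }

    -- The set of admissible primes may vary with t. The products are still distinct because the new
    -- prime exceeds E (ee i), and so every prime factor of t.
    stage-step : ∀ i {T} {P P' : ℕ → Set} → Stage i P T →
      (∀ {t} → P t → ∃ λ W → 1ℚ ⊑ ι μ ⊗ Σ (primesIn (shifted? W) (E (ee i)) (E (ee (suc i)))) rc × (∀ {p} → Prime p → Shifted W p → P' (t * p))) →
      ∃ (Stage (suc i) P')
    stage-step i {T} {P} {P'} st ext with choices {λ t ps → Unique ps × 1ℚ ⊑ ι μ ⊗ Σ ps rc × (∀ {p} → p ∈ ps → (Prime p × E (ee i) < p × p ≤ E (ee (suc i))) × P' (t * p))} T pick'
      where
      pick' : ∀ {t} → t ∈ T → ∃ λ ps → Unique ps × 1ℚ ⊑ ι μ ⊗ Σ ps rc × (∀ {p} → p ∈ ps → (Prime p × E (ee i) < p × p ≤ E (ee (suc i))) × P' (t * p))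
      pick' t∈ with ext (Stage.holds st t∈)
      ... | W , sum , h = primesIn (shifted? W) (E (ee i)) (E (ee (suc i))) , unique-primesIn (shifted? W) (E (ee i)) (E (ee (suc i))) , sum ,
            λ p∈ → let pr , l , hh , s = ∈-primesIn⁻ (shifted? W) {E (ee i)} {E (ee (suc i))} p∈ in (pr , l , hh) , h pr s
    ... | L , map≡ , al = T' , record
      { unique = unique-products proj₁ proj₂ L (subst Unique (sym map≡) (Stage.unique st)) (λ m → proj₁ (Stage.bounds st (proj₁ (al m))) , proj₁ (proj₂ (al m)))
          (λ x∈ x'∈ p∈ p'∈ → let (pp , l , _) , _ = spec x∈ p∈ ; (pp' , l' , _) , _ = spec x'∈ p'∈ in
            largePrime-inj pp pp' l l' (λ pr d → Stage.smooth st (proj₁ (al x∈)) pr d) (λ pr d → Stage.smooth st (proj₁ (al x'∈)) pr d))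
      ; bounds = bounds'
      ; smooth = smooth'
      ; holds = holds'
      ; mass = mass' }
      where
      T' = concatMap (λ x → map (proj₁ x *_) (proj₂ x)) L
      spec : ∀ {x p} → x ∈ L → p ∈ proj₂ x → (Prime p × E (ee i) < p × p ≤ E (ee (suc i))) × P' (proj₁ x * p)
      spec x∈ p∈ = proj₂ (proj₂ (proj₂ (al x∈))) p∈
      el : ∀ {z} → z ∈ T' → ∃₂ λ x p → x ∈ L × p ∈ proj₂ x × z ≡ proj₁ x * p
      el = ∈-products⁻ proj₁ proj₂ L
      bounds' : ∀ {t} → t ∈ T' → 1 ≤ t × E (lo (suc i) * ε) ≤ t × t ≤ E (Z A + (lo (suc i) + suc i) * ε)
      bounds' z∈ with el z∈
      ... | x , p , x∈ , p∈ , refl with Stage.bounds st (proj₁ (al x∈)) | spec x∈ p∈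
      ... | 1≤t , l , h | (pr , lp , hp) , _ = *-mono-≤ 1≤t (prime≥1 pr) ,
        ≤-trans (≤-reflexive (trans (cong E (*-distribʳ-+ ε (lo i) (K * K + i))) (E-+ (lo i * ε) (ee i)))) (*-mono-≤ l (<⇒≤ lp)) ,
        ≤-trans (*-mono-≤ h hp) (≤-reflexive (trans (sym (E-+ (Z A + (lo i + i) * ε) (ee (suc i)))) (cong E (lem (Z A) (lo i) i (K * K) ε))))
        where
        lem : ∀ z l i q e → z + (l + i) * e + (q + suc i) * e ≡ z + (l + (q + i) + suc i) * e
        lem = solve-∀
      smooth' : ∀ {t r} → t ∈ T' → Prime r → r ∣ t → r ≤ E (ee (suc i))
      smooth' z∈ pr d with el z∈
      ... | x , p , x∈ , p∈ , refl with euclidsLemma (proj₁ x) p pr d | spec x∈ p∈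
      ... | inj₁ d' | _ = ≤-trans (Stage.smooth st (proj₁ (al x∈)) pr d') (E-mono (*-monoˡ-≤ ε (+-monoʳ-≤ (K * K) (n≤1+n i))))
      ... | inj₂ d' | (pp , _ , hp) , _ = ≤-trans (≤-reflexive (prime∣prime pr pp d')) hp
      holds' : ∀ {t} → t ∈ T' → P' t
      holds' z∈ with el z∈
      ... | x , p , x∈ , p∈ , refl = proj₂ (spec x∈ p∈)
      mass' : Σ (goodM A) rc ⊑ ι (μ ^ suc i) ⊗ Σ T' rc
      mass' = begin
        Σ (goodM A) rc ≤⟨ Stage.mass st ⟩
        ι (μ ^ i) ⊗ Σ T rc ≡⟨ cong (ι (μ ^ i) ⊗_) (trans (cong (λ l → Σ l rc) (sym map≡)) (Σ-map L proj₁ rc)) ⟩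
        ι (μ ^ i) ⊗ Σ L (λ x → rc (proj₁ x)) ≤⟨ ⊗-monoˡ (0≤ι (μ ^ i)) (Σ-mono L λ {x} x∈ → subst₂ _⊑_ (⊗-identityʳ (rc (proj₁ x)))
             (solve 3 (λ a b c → a :* (b :* c) := b :* (a :* c)) refl (rc (proj₁ x)) (ι μ) (Σ (proj₂ x) rc)) (⊗-monoˡ (0≤rc (proj₁ x)) (proj₁ (proj₂ (proj₂ (al x∈)))))) ⟩
        ι (μ ^ i) ⊗ Σ L (λ x → ι μ ⊗ (rc (proj₁ x) ⊗ Σ (proj₂ x) rc)) ≡⟨ cong (ι (μ ^ i) ⊗_) (trans (Σ-*ˡ L (ι μ) _) (cong (ι μ ⊗_) (sym (Σ-products proj₁ proj₂ L)))) ⟩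
        ι (μ ^ i) ⊗ (ι μ ⊗ Σ T' rc) ≡⟨ trans (solve 3 (λ a b c → a :* (b :* c) := (b :* a) :* c) refl (ι (μ ^ i)) (ι μ) (Σ T' rc)) (cong (_⊗ Σ T' rc) (sym (ι-* μ (μ ^ i)))) ⟩
        ι (μ ^ suc i) ⊗ Σ T' rc ∎
        where open ℚₚ.≤-Reasoning

    Done : ℕ → ℕ → Set
    Done a t = ∀ a' → a' < a + A → Win R a' t

    -- Over exponents from e to e + ε ≤ (K² + K) ε, `good-sum` yields at least ε / (κ (K² + K) ε) =
    -- 1 / μ. It applies because C u ≤ K² ε for every window still to be served.
    extension : ∀ a s i → a ≤ g' → s < R → i < K → ∀ {t} → Done a t × Win s (a + A) t →
      ∃ λ W → 1ℚ ⊑ ι μ ⊗ Σ (primesIn (shifted? W) (E (ee i)) (E (ee (suc i)))) rc × (∀ {p} → Prime p → Shifted W p → Done a (t * p) × Win (suc s) (a + A) (t * p))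
    extension a s i a≤ s<R i<K {t} (dn , qs , uq , len , al) = W , sum , next
      where
      U = u (a + A)
      W = remove qs (window U)
      e = ee i
      e≡ : e + ε ≡ ee (suc i)
      e≡ = lem (K * K) i ε
        where
        lem : ∀ q i ε → (q + i) * ε + ε ≡ (q + suc i) * ε
        lem = solve-∀
      U≤ : C * U ≤ e
      U≤ = ≤-trans (*-monoʳ-≤ C (subst (λ x → U ≤ u x) (trans (sym (+-assoc (g' ∸ a) a A)) (cong (_+ A) (m∸n+n≡m a≤))) (u-mono (a + A) (g' ∸ a)))) (≤-trans Cu≤ (*-monoˡ-≤ ε (m≤m+n (K * K) i)))
      ps = primesIn (shifted? W) (E e) (E (ee (suc i)))
      sum : 1ℚ ⊑ ι μ ⊗ Σ ps rc
      sum = ⊗-cancelˡ {ε} 1≤ε (begin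
        ι ε ⊗ 1ℚ ≡⟨ ⊗-identityʳ (ι ε) ⟩
        ι ε ≤⟨ subst (λ x → ι ε ⊑ ι (κ * x) ⊗ Σ (primesIn (shifted? W) (E e) (E x)) rc) e≡ (good-sum U qs e ε (1≤u (a + A)) (≤-trans (≤-reflexive len) (≤-trans (<⇒≤ s<R) (R≤Eu (a + A)))) U≤) ⟩
        ι (κ * ee (suc i)) ⊗ Σ ps rc ≤⟨ ⊗-monoʳ (Σ-nonneg ps 0≤rc) (ι-mono (*-monoʳ-≤ κ (*-monoˡ-≤ ε (+-monoʳ-≤ (K * K) i<K)))) ⟩
        ι (κ * ((K * K + K) * ε)) ⊗ Σ ps rc ≡⟨ cong (_⊗ Σ ps rc) (trans (cong ι (lem κ (K * K + K) ε)) (ι-* ε μ)) ⟩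
        ι ε ⊗ ι μ ⊗ Σ ps rc ≡⟨ ⊗-assoc (ι ε) (ι μ) (Σ ps rc) ⟩
        ι ε ⊗ (ι μ ⊗ Σ ps rc) ∎)
        where
        open ℚₚ.≤-Reasoning
        lem : ∀ κ q ε → κ * (q * ε) ≡ ε * (κ * q)
        lem = solve-∀
      next : ∀ {p} → Prime p → Shifted W p → Done a (t * p) × Win (suc s) (a + A) (t * p)
      next {p} pr sh with find sh
      ... | q , q∈ , q∣ with Mem.∈-filter⁻ (λ q → ¬? (Any.any? (q ≟_) qs)) {xs = window U} q∈
      ... | q∈w , q∉ = (λ a' lt → Win-∣ {R} {a'} (Div.m∣m*n p) (dn a' lt)) ,
            (q ∷ qs , All.tabulate (λ {x} x∈ q≡x → q∉ (subst (_∈ qs) (sym q≡x) x∈)) ∷ uq , cong suc len ,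
             (q∈w , p , pr , Div.n∣m*n t , q∣) ∷ All.map (λ (m , r , pp , r∣t , d) → m , r , pp , Div.∣m⇒∣m*n p r∣t , d) al)

    inner : ∀ a s → a ≤ g' → s ≤ R → ∃ (Stage (a * R) (Done a)) → ∃ (Stage (s + a * R) (λ t → Done a t × Win s (a + A) t))
    inner a zero _ _ (T , st) = T , Stage-map (λ d → d , [] , [] , refl , []) st
    inner a (suc s) a≤ s<R st₀ = stage-step (s + a * R) (proj₂ (inner a s a≤ (<⇒≤ s<R) st₀))
      (extension a s (s + a * R) a≤ s<R (<-≤-trans (+-monoˡ-< (a * R) s<R) (*-monoˡ-≤ R (s≤s a≤))))

    stages : ∀ a → a ≤ g → ∃ (Stage (a * R) (Done a))
    stages zero _ = goodM A , record
      { unique = unique-goodM A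
      ; bounds = λ m → let (l , h) , _ = goodM-spec A m in l , ≤-trans (≤-reflexive (cong (2 ^_) (*-zeroʳ b))) l , ≤-trans h (≤-reflexive (cong E (sym (+-identityʳ (Z A)))))
      ; smooth = λ m pr d → let (l , h) , _ = goodM-spec A m in ≤-trans (Div.∣⇒≤ {{>-nonZero l}} d) (≤-trans h (E-mono (≤-trans Z≤ (≤-reflexive (cong (_* ε) (sym (+-identityʳ (K * K))))))))
      ; holds = λ m → proj₂ (goodM-spec A m)
      ; mass = ⊑-reflexive (sym (trans (cong (_⊗ Σ (goodM A) rc) ι-1) (⊗-identityˡ _))) }
    stages (suc a) (s≤s a≤) with inner a R a≤ ≤-refl (stages a (m≤n⇒m≤1+n a≤))
    ... | T , st = T , Stage-map merge st
      where
      merge : ∀ {t} → Done a t × Win R (a + A) t → Done (suc a) t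
      merge (dn , w) a' (s≤s le) with m≤n⇒m<n∨m≡n le
      ... | inj₁ lt = dn a' lt
      ... | inj₂ refl = w

-- Counting by the last prime

quotient-bounds : ∀ B N L → 1 ≤ B → B * N ≤ L → ∃ λ ε → N ≤ ε × B * ε ≤ L × suc L ≤ B * ε + B
quotient-bounds B@(suc _) N L _ le = L / B , ≤-trans (≤-reflexive (sym (trans (cong (_/ B) (*-comm B N)) (DivMod.m*n/n≡m N B)))) (DivMod./-monoˡ-≤ B le) ,
  subst (_≤ L) (*-comm (L / B) B) (DivMod.m/n*n≤m L B) ,
  subst (suc L ≤_) (trans (+-comm B (L / B * B)) (cong (_+ B) (*-comm (L / B) B)))
    (subst (_≤ B + L / B * B) (cong suc (sym (DivMod.m≡m%n+[m/n]*n L B))) (+-monoˡ-≤ (L / B * B) (DivMod.m%n<n L B)))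

module Count (key : Key) (R J : ℕ) (1≤R : 1 ≤ R)
             (J-large : Key.κ key * 2 * (12 * (R * R * suc (Key.κ key * 2))) ≤ J)
             (w²≤R : Key.width key * Key.width key ≤ R) (5Cw≤R : 5 * (Key.C key * Key.width key) ≤ R) where
  open Key key
  open GoodM key R J R 1≤R 1≤R ≤-refl J-large
  open Top key R J 1≤R J-large w²≤R 5Cw≤R

  -- Bc adds up, in units of ε, the exponents of the cofactor at its largest and of E (ee (suc K)),
  -- which p must be allowed to reach. N₀ collects three lower bounds on ε: for rounding L to a
  -- multiple of Bc, for c₀ ≤ E ε, and for the existence of A.
  Bc N₀ D q₀ : ℕ
  Bc = lo K + (K * K + K) + (K * K + K) + 2
  N₀ = Bc + (width * R + 2) + C * u g'
  D = E 1 * κ * c₀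
  q₀ = 4 * μ ^ K * D * (2 * Bc * width ^ g)

  2≤K : 2 ≤ K
  2≤K = *-mono-≤ {2} {g} {1} {R} (s≤s (m≤n+m 1 (R * J))) 1≤R

  1≤Bc : 1 ≤ Bc
  1≤Bc = ≤-trans (m≤n+m 1 1) (m≤n+m 2 (lo K + (K * K + K) + (K * K + K)))

  instance
    c₀≢0 : NonZero c₀
    c₀≢0 = m^n≢0 2 (2 + k)

  log : ∀ x → 1 ≤ x → ∃ λ L → E L ≤ x × x < E (suc L)
  log x 1≤x with log-bracket (2 ^ b) x (^-monoʳ-≤ 2 {1} {b} 1≤b) 1≤x
  ... | L , l , h = L , subst (_≤ x) (^-*-assoc 2 b L) l , subst (x <_) (^-*-assoc 2 b (suc L)) h

  u-pow : ∀ a d → u (d + a) ≡ width ^ d * u a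
  u-pow a zero = sym (+-identityʳ (u a))
  u-pow a (suc d) = trans (cong (width *_) (u-pow a d)) (sym (*-assoc width (width ^ d) (u a)))

  c₀≤ : c₀ ≤ E (width * R + 2)
  c₀≤ = ^-monoʳ-≤ 2 (≤-trans (+-monoˡ-≤ k (*-monoˡ-≤ 2 1≤b)) (≤-reflexive (lem b (width * R))))
    where
    lem : ∀ b x → b * 2 + b * x ≡ b * (x + 2)
    lem = solve-∀

  -- A is determined by letting C u (g' + A) be the last such value not exceeding K² ε. The top
  -- window is then within a constant factor of the exponents of the large primes.
  choice : ∀ ε → N₀ ≤ ε → ∃ λ A → 1 ≤ ε × C * u (g' + A) ≤ K * K * ε × K * K * ε < C * (width * u (g' + A))
  choice ε N₀≤ε with bracket (λ a → C * u (a + g')) Y Y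
        (≤-trans (m≤n+m (C * u g') (Bc + (width * R + 2))) (≤-trans N₀≤ε (m≤n*m ε (K * K) {{>-nonZero (*-mono-≤ (<⇒≤ 2≤K) (<⇒≤ 2≤K))}})))
        (<-≤-trans (n<b^n {2} ≤-refl Y) (≤-trans (m≤n*m (2 ^ Y) (u g') {{>-nonZero (1≤u g')}})
          (≤-trans (u-growth g' Y) (m≤n*m (u (Y + g')) C {{>-nonZero 1≤C}}))))
    where
    Y : ℕ
    Y = K * K * ε
  ... | A , l , h = A , ≤-trans 1≤Bc (≤-trans (≤-trans (m≤m+n Bc (width * R + 2)) (m≤m+n _ (C * u g'))) N₀≤ε) ,
        subst (λ z → C * u z ≤ K * K * ε) (+-comm A g') l , subst (λ z → K * K * ε < C * (width * u z)) (+-comm A g') h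

  module Counting (x L ε A : ℕ) (EL≤x : E L ≤ x) (x<EL : x < E (suc L)) (N₀≤ε : N₀ ≤ ε) (Bcε≤L : Bc * ε ≤ L) (L<Bcε : suc L ≤ Bc * ε + Bc)
                  (1≤ε : 1 ≤ ε) (Cu≤Y : C * u (g' + A) ≤ K * K * ε) (Y< : K * K * ε < C * (width * u (g' + A)))
                  (T : List ℕ) (st : Stages.Stage A ε 1≤ε Cu≤Y K (Stages.Done A ε 1≤ε Cu≤Y g) T) where
    open Stages A ε 1≤ε Cu≤Y

    Y : ℕ
    Y = K * K * ε

    Bc≤ε : Bc ≤ ε
    Bc≤ε = ≤-trans (≤-trans (m≤m+n Bc (width * R + 2)) (m≤m+n _ (C * u g'))) N₀≤ε

    y : ℕ
    y = E (ee K)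

    -- The source of R ≥ 5 C width: the top window forces M ≥ E (R * u (g' + A)), and every prime
    -- factor of n is at most E (5 * Y).
    5Y≤ : 5 * Y ≤ R * u (g' + A)
    5Y≤ = ≤-trans (*-monoʳ-≤ 5 (<⇒≤ Y<)) (≤-trans (≤-reflexive (l2 C width (u (g' + A)))) (*-monoˡ-≤ (u (g' + A)) 5Cw≤R))
      where
      l2 : ∀ c w z → 5 * (c * (w * z)) ≡ 5 * (c * w) * z
      l2 = solve-∀

    ee≤ : ee K ≤ R * u (g' + A)
    ee≤ = ≤-trans (*-monoˡ-≤ ε (+-monoʳ-≤ (K * K) (m≤m*n K K {{>-nonZero (<⇒≤ 2≤K)}}))) (≤-trans (≤-reflexive (lem (K * K) ε)) (≤-trans (*-monoˡ-≤ Y (m≤m+n 2 3)) 5Y≤))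
      where
      lem : ∀ q e → (q + q) * e ≡ 2 * (q * e)
      lem = solve-∀

    -- junk value at t = 0
    Xof : ℕ → ℕ
    Xof zero = 0
    Xof t@(suc _) = _/_ x (c₀ * t) {{m*n≢0 c₀ t}}

    lastPrimes : ℕ → List ℕ
    lastPrimes t = primesIn any⊤? y (Xof t)

    module Cofactor {t : ℕ} (t∈ : t ∈ T) where
      1≤t = proj₁ (Stage.bounds st t∈)
      t-lo = proj₁ (proj₂ (Stage.bounds st t∈))
      t-hi = proj₂ (proj₂ (Stage.bounds st t∈))
      t' = c₀ * t
      t'≢0 : NonZero t'
      t'≢0 = m*n≢0 c₀ t {{c₀≢0}} {{>-nonZero 1≤t}}
      X = Xof t

      X≡ : ∀ s → t ≡ suc s → X ≡ _/_ x t' {{t'≢0}}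
      X≡ s refl = refl

      X≡' : X ≡ _/_ x t' {{t'≢0}}
      X≡' = X≡ (t ∸ 1) (sym (m+[n∸m]≡n 1≤t))

      Xt≤x : X * t' ≤ x
      Xt≤x = subst (λ z → z * t' ≤ x) (sym X≡') (DivMod.m/n*n≤m x t' {{t'≢0}})

      x<Xt : x < suc X * t'
      x<Xt = subst (λ z → x < suc z * t') (sym X≡') (subst (_< t' + _/_ x t' {{t'≢0}} * t') (sym (DivMod.m≡m%n+[m/n]*n x t' {{t'≢0}})) (+-monoˡ-< _ (DivMod.m%n<n x t' {{t'≢0}})))

      -- The largest possible cofactor still leaves p a range reaching a full step ε beyond y, which
      -- is the reason for the summands of `Bc`.
      big : E (ee (suc K)) ≤ X
      big = ≤-trans (≤-reflexive (sym (DivMod.m*n/n≡m (E (ee (suc K))) t' {{t'≢0}}))) (≤-trans (DivMod./-monoˡ-≤ t' {{t'≢0}} le) (≤-reflexive (sym X≡')))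
        where
        open ℕₚ.≤-Reasoning
        le : E (ee (suc K)) * t' ≤ x
        le = begin
          E (ee (suc K)) * (c₀ * t) ≤⟨ *-monoʳ-≤ (E (ee (suc K))) (*-mono-≤ c₀≤ t-hi) ⟩
          E (ee (suc K)) * (E (width * R + 2) * E (Z A + (lo K + K) * ε)) ≡⟨ sym (trans (E-+ (ee (suc K)) _) (cong (E (ee (suc K)) *_) (E-+ (width * R + 2) _))) ⟩
          E (ee (suc K) + (width * R + 2 + (Z A + (lo K + K) * ε))) ≤⟨ E-mono (+-monoʳ-≤ (ee (suc K)) (+-mono-≤ w≤ε (+-monoˡ-≤ ((lo K + K) * ε) Z≤))) ⟩
          E (ee (suc K) + (ε + (K * K * ε + (lo K + K) * ε))) ≡⟨ cong E (lem (K * K) K (lo K) ε) ⟩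
          E (Bc * ε) ≤⟨ E-mono Bcε≤L ⟩
          E L ≤⟨ EL≤x ⟩
          x ∎
          where
          w≤ε : width * R + 2 ≤ ε
          w≤ε = ≤-trans (≤-trans (m≤n+m (width * R + 2) Bc) (m≤m+n _ (C * u g'))) N₀≤ε
          lem : ∀ q K l ε → (q + suc K) * ε + (ε + (q * ε + (l + K) * ε)) ≡ (l + (q + K) + (q + K) + 2) * ε
          lem = solve-∀

      -- Otherwise the lower bound on t would give X t ≥ E ((5 K² + lo K) ε), beyond x since Bc + 1
      -- ≤ 5 K² + lo K. This is where the small spread K ε against K² ε is needed.
      small : X < E (5 * Y)
      small = ≰⇒> λ le → <⇒≱ x<EL (begin
        E (suc L) ≤⟨ E-mono (≤-trans L<Bcε (≤-trans (+-monoʳ-≤ (Bc * ε) Bc≤ε) (≤-trans (≤-reflexive (lem₁ Bc ε)) (≤-trans (*-monoˡ-≤ ε coef) (≤-reflexive (lem₂ (K * K) (lo K) ε)))))) ⟩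
        E (5 * Y + lo K * ε) ≡⟨ E-+ (5 * Y) (lo K * ε) ⟩
        E (5 * Y) * E (lo K * ε) ≤⟨ *-mono-≤ le (≤-trans t-lo (m≤n*m t c₀)) ⟩
        X * t' ≤⟨ Xt≤x ⟩
        x ∎)
        where
        open ℕₚ.≤-Reasoning
        lem₁ : ∀ B e → B * e + e ≡ (B + 1) * e
        lem₁ = solve-∀
        lem₂ : ∀ q l e → (5 * q + l) * e ≡ 5 * (q * e) + l * e
        lem₂ = solve-∀
        coef : Bc + 1 ≤ 5 * (K * K) + lo K
        coef = ≤-trans (≤-reflexive (l₁ (lo K) (K * K) K)) (≤-trans (+-monoˡ-≤ (lo K) (+-monoʳ-≤ (2 * (K * K)) (≤-trans (+-mono-≤ (*-monoˡ-≤ K 2≤K) (≤-trans (m≤m+n 3 1) (*-mono-≤ 2≤K 2≤K))) (m≤m+n (K * K + K * K) (K * K))))) (≤-reflexive (l₂ (K * K) (lo K))))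
          where
          l₁ : ∀ l q K → l + (q + K) + (q + K) + 2 + 1 ≡ 2 * q + (2 * K + 3) + l
          l₁ = solve-∀
          l₂ : ∀ q l → 2 * q + (q + q + q) + l ≡ 5 * q + l
          l₂ = solve-∀

      -- If E (l + 1) ≤ X < E (l + 2), the whole block from E l to E (l + 1) lies between y and X.
      -- The factor E 1 in D is the loss from this rounding of X.
      many : x ≤ D * L * length (lastPrimes t) * t
      many = go (log X (≤-trans (1≤E (ee (suc K))) big))
        where
        go : (∃ λ e → E e ≤ X × X < E (suc e)) → x ≤ D * L * length (lastPrimes t) * t
        go (zero , _ , h) = ⊥-elim (<⇒≱ h (≤-trans (E-mono (*-mono-≤ {1} {K * K + suc K} (≤-trans (s≤s z≤n) (m≤n+m (suc K) (K * K))) 1≤ε)) big))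
        go (suc l , lX , hX) = begin
          x ≤⟨ <⇒≤ x<Xt ⟩
          suc X * t' ≤⟨ *-monoˡ-≤ t' hX ⟩
          E (suc (suc l)) * t' ≡⟨ cong (_* t') (E-+ 1 (suc l)) ⟩
          E 1 * E (suc l) * t' ≤⟨ *-monoˡ-≤ t' (*-monoʳ-≤ (E 1) (≤-trans (block-count l 1≤l) (*-mono-≤ (*-monoʳ-≤ κ l≤L) sub))) ⟩
          E 1 * (κ * L * length (lastPrimes t)) * (c₀ * t) ≡⟨ lem (E 1) κ L (length (lastPrimes t)) c₀ t ⟩
          D * L * length (lastPrimes t) * t ∎
          where
          open ℕₚ.≤-Reasoning
          lem : ∀ e κ L n c t → e * (κ * L * n) * (c * t) ≡ e * κ * c * L * n * t
          lem = solve-∀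
          eeK< : ee K + ε ≤ suc l
          eeK< = ≤-pred (E-cancel (≤-<-trans (≤-trans (≤-reflexive (cong E (l3 (K * K) K ε))) big) hX))
            where
            l3 : ∀ q K ε → (q + K) * ε + ε ≡ (q + suc K) * ε
            l3 = solve-∀
          eeK≤l : ee K ≤ l
          eeK≤l = ≤-pred (≤-trans (subst (_≤ ee K + ε) (+-comm (ee K) 1) (+-monoʳ-≤ (ee K) 1≤ε)) eeK<)
          1≤l : 1 ≤ l
          1≤l = ≤-trans (*-mono-≤ {1} {K * K + K} (≤-trans (<⇒≤ 2≤K) (m≤n+m K (K * K))) 1≤ε) eeK≤l
          l≤L : suc l ≤ L
          l≤L = ≤-pred (E-cancel (≤-<-trans lX (≤-<-trans (≤-trans (m≤m*n X t' {{t'≢0}}) Xt≤x) x<EL)))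
          sub : length (primesIn any⊤? (E l) (E (suc l))) ≤ length (lastPrimes t)
          sub = unique-⊆-length (unique-primesIn any⊤? (E l) (E (suc l))) (λ m → let pr , lw , hi , _ = ∈-primesIn⁻ any⊤? {E l} {E (suc l)} m in
            ∈-primesIn⁺ any⊤? pr (≤-<-trans (E-mono eeK≤l) lw) (≤-trans hi lX) tt)

    result : List ℕ
    result = concatMap (λ t → map (c₀ * t *_) (lastPrimes t)) T

    smooth-c₀ : ∀ {t r} → t ∈ T → Prime r → r ∣ c₀ * t → r ≤ y
    smooth-c₀ {t} {r} t∈ pr d with euclidsLemma c₀ t pr d
    ... | inj₂ d' = Stage.smooth st t∈ pr d'
    ... | inj₁ d' = ≤-trans (≤-reflexive (is2 (2 + k) d')) (2≤E (*-mono-≤ {1} {K * K + K} (≤-trans (<⇒≤ 2≤K) (m≤n+m K (K * K))) 1≤ε))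
      where
      is2 : ∀ i → r ∣ 2 ^ i → r ≡ 2
      is2 zero x = ⊥-elim (Pr.¬prime[1] (subst Prime (Div.∣1⇒≡1 x) pr))
      is2 (suc i) x with euclidsLemma 2 (2 ^ i) pr x
      ... | inj₁ z = prime∣prime pr Pr.prime[2] z
      ... | inj₂ z = is2 i z

    last⁻ : ∀ {t p} → p ∈ lastPrimes t → Prime p × y < p × p ≤ Xof t
    last⁻ {t} m = let pr , l , h , _ = ∈-primesIn⁻ any⊤? {y} {Xof t} m in pr , l , h

    unique-result : Unique result
    unique-result = unique-products (c₀ *_) lastPrimes T (Uniq.map⁺ (λ {a} {a'} → *-cancelˡ-≡ a a' c₀) (Stage.unique st))
      (λ {t} t∈ → *-mono-≤ (m^n>0 2 (2 + k)) (proj₁ (Stage.bounds st t∈)) , unique-primesIn any⊤? y (Xof t))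
      (λ {t} {t'} t∈ t'∈ p∈ p'∈ → let pp , l , _ = last⁻ {t} p∈ ; pp' , l' , _ = last⁻ {t'} p'∈ in largePrime-inj pp pp' l l' (smooth-c₀ t∈) (smooth-c₀ t'∈))

    good-result : ∀ {n} → n ∈ result → 1 ≤ n × n ≤ x × TwoDense (totient n) × TwoDense (carmichael n)
    good-result n∈ with ∈-products⁻ (c₀ *_) lastPrimes T n∈
    ... | t , p , t∈ , p∈ , refl with last⁻ {t} p∈
    ... | pp , l , h = 1≤n , ≤-trans (*-monoʳ-≤ (c₀ * t) h) (≤-trans (≤-reflexive (*-comm (c₀ * t) (Xof t))) Xt≤x) ,
         dense (g' + A) 1≤n (Div.∣m⇒∣m*n p (Div.m∣m*n t)) (λ a' lt → Win-∣ {R} {a'} (Div.∣m⇒∣m*n p (Div.n∣m*n c₀)) (Stage.holds st t∈ a' lt)) sm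
      where
      open Cofactor t∈
      1≤n : 1 ≤ c₀ * t * p
      1≤n = *-mono-≤ (*-mono-≤ (m^n>0 2 (2 + k)) (proj₁ (Stage.bounds st t∈))) (prime≥1 pp)
      sm : ∀ {r} → Prime r → r ∣ c₀ * t * p → r ≤ E (R * u (g' + A))
      sm pr d with euclidsLemma (c₀ * t) p pr d
      ... | inj₁ d' = ≤-trans (smooth-c₀ t∈ pr d') (E-mono ee≤)
      ... | inj₂ d' = ≤-trans (≤-reflexive (prime∣prime pr pp d')) (≤-trans h (≤-trans (<⇒≤ small) (E-mono 5Y≤)))

    len = length result

    Σlen : ι len ≡ Σ T (λ t → ι (length (lastPrimes t)))
    Σlen = trans (ι-length-concatMap (λ t → map (c₀ * t *_) (lastPrimes t)) T) (Σ-cong T (λ {t} _ → cong ι (Listₚ.length-map (c₀ * t *_) (lastPrimes t))))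

    count-T : ι x ⊗ Σ T rc ⊑ ι (D * L) ⊗ ι len
    count-T = begin
      ι x ⊗ Σ T rc ≡⟨ sym (Σ-*ˡ T (ι x) rc) ⟩
      Σ T (λ t → ι x ⊗ rc t) ≤⟨ Σ-mono T term ⟩
      Σ T (λ t → ι (D * L) ⊗ ι (length (lastPrimes t))) ≡⟨ trans (Σ-*ˡ T (ι (D * L)) _) (cong (ι (D * L) ⊗_) (sym Σlen)) ⟩
      ι (D * L) ⊗ ι len ∎
      where
      open ℚₚ.≤-Reasoning
      term : ∀ {t} → t ∈ T → ι x ⊗ rc t ⊑ ι (D * L) ⊗ ι (length (lastPrimes t))
      term {t} t∈ = begin
        ι x ⊗ rc t ≤⟨ ⊗-monoʳ (0≤rc t) (ι-mono (Cofactor.many t∈)) ⟩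
        ι (D * L * n * t) ⊗ rc t ≡⟨ cong (_⊗ rc t) (ι-* (D * L * n) t) ⟩
        ι (D * L * n) ⊗ ι t ⊗ rc t ≡⟨ trans (⊗-assoc (ι (D * L * n)) (ι t) (rc t)) (trans (cong (ι (D * L * n) ⊗_) (ι-rc (proj₁ (Stage.bounds st t∈)))) (⊗-identityʳ _)) ⟩
        ι (D * L * n) ≡⟨ ι-* (D * L) n ⟩
        ι (D * L) ⊗ ι n ∎
        where n = length (lastPrimes t)

    -- Each t admits at least x / (D L t) last primes, and Σ 1 / t over T is at least b Z / (4 μ ^
    -- K).
    total : x * (b * Z A) ≤ 4 * μ ^ K * (D * L) * len
    total = ι-cancel-≤ (begin
      ι (x * (b * Z A)) ≡⟨ ι-* x (b * Z A) ⟩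
      ι x ⊗ ι (b * Z A) ≤⟨ ⊗-monoˡ (0≤ι x) (⊑-trans (goodM-sum A) (⊗-monoˡ (0≤ι 4) (Stage.mass st))) ⟩
      ι x ⊗ (4ℚ ⊗ (ι (μ ^ K) ⊗ Σ T rc)) ≡⟨ solve 3 (λ x m s → x :* (con 4ℚ :* (m :* s)) := (con 4ℚ :* m) :* (x :* s)) refl (ι x) (ι (μ ^ K)) (Σ T rc) ⟩
      (4ℚ ⊗ ι (μ ^ K)) ⊗ (ι x ⊗ Σ T rc) ≤⟨ ⊗-monoˡ (⊗-nonneg (0≤ι 4) (0≤ι (μ ^ K))) count-T ⟩
      (4ℚ ⊗ ι (μ ^ K)) ⊗ (ι (D * L) ⊗ ι len) ≡⟨ trans (cong (_⊗ (ι (D * L) ⊗ ι len)) (sym (ι-* 4 (μ ^ K)))) (trans (sym (⊗-assoc (ι (4 * μ ^ K)) (ι (D * L)) (ι len)))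
           (trans (cong (_⊗ ι len) (sym (ι-* (4 * μ ^ K) (D * L)))) (sym (ι-* (4 * μ ^ K * (D * L)) len)))) ⟩
      ι (4 * μ ^ K * (D * L) * len) ∎)
      where open ℚₚ.≤-Reasoning

    -- L and Z are proportional up to constants. So the reciprocal sum, of order Z, compensates the
    -- loss 1 / L in the density of primes.
    L≤Z : L ≤ 2 * Bc * width ^ g * Z A
    L≤Z = begin
      L ≤⟨ ≤-trans (n≤1+n L) L<Bcε ⟩
      Bc * ε + Bc ≤⟨ +-monoʳ-≤ (Bc * ε) (m≤m*n Bc ε {{>-nonZero 1≤ε}}) ⟩
      Bc * ε + Bc * ε ≡⟨ l₁ Bc ε ⟩
      2 * Bc * ε ≤⟨ *-monoʳ-≤ (2 * Bc) (≤-trans (m≤n*m ε (K * K) {{>-nonZero (*-mono-≤ (<⇒≤ 2≤K) (<⇒≤ 2≤K))}}) (<⇒≤ Y<)) ⟩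
      2 * Bc * (C * (width * u (g' + A))) ≡⟨ cong (λ z → 2 * Bc * (C * z)) (u-pow A g) ⟩
      2 * Bc * (C * (width ^ g * u A)) ≡⟨ l₂ (2 * Bc) C (width ^ g) (u A) ⟩
      2 * Bc * width ^ g * (C * u A) ≤⟨ *-monoʳ-≤ (2 * Bc * width ^ g) (≤-trans (*-monoʳ-≤ C (m≤m*n (u A) (2 ^ (R * J)) {{m^n≢0 2 (R * J)}})) (m≤m+n _ _)) ⟩
      2 * Bc * width ^ g * Z A ∎
      where
      open ℕₚ.≤-Reasoning
      l₁ : ∀ B e → B * e + B * e ≡ 2 * B * e
      l₁ = solve-∀
      l₂ : ∀ B c w z → B * (c * (w * z)) ≡ B * w * (c * z)
      l₂ = solve-∀

    conclusion : 1 * x ≤ q₀ * len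
    conclusion = *-cancelʳ-≤ (1 * x) (q₀ * len) (Z A) {{>-nonZero (1≤Z A)}} (begin
      1 * x * Z A ≡⟨ cong (_* Z A) (*-identityˡ x) ⟩
      x * Z A ≤⟨ *-monoʳ-≤ x (m≤n*m (Z A) b {{>-nonZero 1≤b}}) ⟩
      x * (b * Z A) ≤⟨ total ⟩
      4 * μ ^ K * (D * L) * len ≤⟨ *-monoˡ-≤ len (*-monoʳ-≤ (4 * μ ^ K) (*-monoʳ-≤ D L≤Z)) ⟩
      4 * μ ^ K * (D * (2 * Bc * width ^ g * Z A)) * len ≡⟨ lem (4 * μ ^ K) D (2 * Bc * width ^ g) (Z A) len ⟩
      q₀ * len * Z A ∎)
      where
      open ℕₚ.≤-Reasoning
      lem : ∀ m D B z l → m * (D * (B * z)) * l ≡ m * D * B * l * z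
      lem = solve-∀

  Answer : ℕ → Set
  Answer x = ∃ λ (S : List ℕ) → Unique S × All (λ n → 1 ≤ n × n ≤ x × TwoDense (totient n) × TwoDense (carmichael n)) S × 1 * x ≤ q₀ * length S

  answer : ∀ x → E (Bc * N₀) ≤ x → Answer x
  answer x x-large = fromLog (log x (≤-trans (1≤E (Bc * N₀)) x-large))
    where
    fromStage : ∀ {L ε A} → E L ≤ x → x < E (suc L) → N₀ ≤ ε → Bc * ε ≤ L → suc L ≤ Bc * ε + Bc → (1≤ε : 1 ≤ ε) (Cu≤Y : C * u (g' + A) ≤ K * K * ε) →
      K * K * ε < C * (width * u (g' + A)) → ∃ (Stages.Stage A ε 1≤ε Cu≤Y K (Stages.Done A ε 1≤ε Cu≤Y g)) → Answer x
    fromStage {L} {ε} {A} EL≤x x<EL N₀≤ε Bcε≤L L<Bcε 1≤ε Cu≤Y Y< (T , st) = result , unique-result , All.tabulate good-result , conclusion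
      where open Counting x L ε A EL≤x x<EL N₀≤ε Bcε≤L L<Bcε 1≤ε Cu≤Y Y< T st
    fromChoice : ∀ {L ε} → E L ≤ x → x < E (suc L) → N₀ ≤ ε × Bc * ε ≤ L × suc L ≤ Bc * ε + Bc →
      (∃ λ A → 1 ≤ ε × C * u (g' + A) ≤ K * K * ε × K * K * ε < C * (width * u (g' + A))) → Answer x
    fromChoice {L} {ε} EL≤x x<EL (N₀≤ε , Bcε≤L , L<Bcε) (A , 1≤ε , Cu≤Y , Y<) =
      fromStage {L} {ε} {A} EL≤x x<EL N₀≤ε Bcε≤L L<Bcε 1≤ε Cu≤Y Y< (Stages.stages A ε 1≤ε Cu≤Y g ≤-refl)
    fromLog : (∃ λ L → E L ≤ x × x < E (suc L)) → Answer x
    fromLog (L , EL≤x , x<EL) with quotient-bounds Bc N₀ L 1≤Bc (≤-pred (E-cancel {Bc * N₀} {suc L} (≤-<-trans x-large x<EL)))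
    ... | ε , h = fromChoice {L} {ε} EL≤x x<EL h (choice ε (proj₁ h))

  1≤q₀ : 1 ≤ q₀
  1≤q₀ = *-mono-≤ (*-mono-≤ (*-mono-≤ (s≤s {n = 3} z≤n) (m^n>0 μ {{>-nonZero 1≤μ}} K)) (*-mono-≤ (*-mono-≤ (1≤E 1) 1≤κ) (m^n>0 2 (2 + k))))
    (*-mono-≤ (*-mono-≤ (s≤s {n = 1} z≤n) 1≤Bc) (m^n>0 width {{>-nonZero (<⇒≤ 2≤width)}} g))
    where
    1≤μ : 1 ≤ μ
    1≤μ = *-mono-≤ 1≤κ (≤-trans (<⇒≤ 2≤K) (m≤n+m K (K * K)))

-- Fixing R and J, and the conclusion

PositiveProportion : Set
PositiveProportion = ∃₂ λ (p q : ℕ) → 0 < p × 0 < q × ∃ λ (N : ℕ) → ∀ (x : ℕ) → N ≤ x →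
  ∃ λ (S : List ℕ) → Unique S × All (λ n → 1 ≤ n × n ≤ x × TwoDense (totient n) × TwoDense (carmichael n)) S × p * x ≤ q * length S

key⇒positiveProportion : Key → PositiveProportion
key⇒positiveProportion key = 1 , q₀ , s≤s z≤n , 1≤q₀ , E (Bc * N₀) , answer
  where
  open Key key
  R = width * width + 5 * (C * width)
  J = κ * 2 * (12 * (R * R * suc (κ * 2)))
  1≤R : 1 ≤ R
  1≤R = ≤-trans (*-mono-≤ (<⇒≤ 2≤width) (<⇒≤ 2≤width)) (m≤m+n _ _)
  open Count key R J 1≤R ≤-refl (m≤m+n _ _) (m≤n+m _ (width * width))

theorem1 : ∃₂ λ (p q : ℕ) → 0 < p × 0 < q × ∃ λ (N : ℕ) → ∀ (x : ℕ) → N ≤ x →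
    ∃ λ (S : List ℕ) → Unique S
    × All (λ n → 1 ≤ n × n ≤ x × TwoDense (totient n) × TwoDense (carmichael n)) S
    × p * x ≤ q * length S
theorem1 = key⇒positiveProportion key
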